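{- For each $\epsilon > 0$ there exists a positive constant $C = C(\epsilon)$ such that for any generalised Petersen graph $P(n,k)$ (with $n \geq 3$ and $1 \leq k \leq n/2$ integers), the number of eigenvalues $\lambda_i$ of $P(n,k)$, counted with multiplicity, such that $\lambda_i \geq 3 - \epsilon$ is at least $C \cdot 2n$.
   Context: For positive integers $n \geq 3$ and $k \leq n/2$, the generalised Petersen graph $P(n,k)$ is the graph with vertex set $\{a_i, b_i : 0 \leq i \leq n-1\}$ (so $2n$ vertices) and edges $a_i a_{i+1}$, $a_i b_i$, $b_i b_{i+k}$ for $0 \leq i \leq n-1$, with subscripts read modulo $n$. When $k=n/2$, the edges $b_ib_{i+k}$ and $b_{i+k}b_{i+2k}=b_{i+k}b_i$ are counted separately, so that $b_i$ and $b_{i+k}$ are joined by a double edge (adjacency matrix entry $2$). With this convention $P(n,k)$ is always connected and cubic ($3$-regular). The eigenvalues of a graph are the eigenvalues of its adjacency matrix. -}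

module Defs where

open import Algebra.Bundles.Raw using (RawRing)
import Algebra.Definitions.RawSemiring as RawSemiringDefs
open import Data.Bool.Base using (if_then_else_)
open import Data.Fin.Base using (Fin; zero; suc; toℕ; punchIn; combine)
import Data.Fin.Properties as Fin
open import Data.Integer.Base using (+_)
open import Data.List.Base using (List; _++_; tabulate; length; filter)
open import Data.Nat.Base as ℕ using (ℕ; zero; suc; NonZero)
open import Data.Nat.DivMod using (_mod_)
import Data.Nat.Properties as ℕ
open import Data.Product.Base using (_×_; _,_; ∃-syntax)
open import Data.Rational.Base as ℚ using (ℚ; 0ℚ; 1ℚ; _/_; ∣_∣; _+_; _*_; _-_; -_; _≤_; _<_)
import Data.Rational.Properties as ℚ
open import Data.Rational.Solver using (module +-*-Solver)
open import Data.Sum.Base using (_⊎_)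
open import Level using (0ℓ)
open import Relation.Binary.PropositionalEquality using (_≡_; refl; sym; trans; cong; cong₂; subst)
open import Relation.Nullary.Decidable using (Dec; ⌊_⌋; _×-dec_; _⊎-dec_)

------------------------------------------------------------------------
-- Real numbers: Cauchy sequences of rationals with a modulus, compared
-- by a setoid equality.  All operations are termwise.

Eventually : (ℕ → Set) → Set
Eventually P = ∃[ N ] (∀ n → N ℕ.≤ n → P n)

IsCauchy : (ℕ → ℚ) → Set
IsCauchy x = ∀ δ → 0ℚ < δ →
  ∃[ N ] (∀ m n → N ℕ.≤ m → N ℕ.≤ n → ∣ x m - x n ∣ ≤ δ)

record ℝ : Set where
  constructor mkℝ
  field
    seq    : ℕ → ℚ
    cauchy : IsCauchy seq

open ℝ public

infix 4 _≃_ _≤ᴿ_ _<ᴿ_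

_≃_ : ℝ → ℝ → Set
x ≃ y = ∀ δ → 0ℚ < δ → Eventually λ n → ∣ seq x n - seq y n ∣ ≤ δ

_≤ᴿ_ : ℝ → ℝ → Set
x ≤ᴿ y = ∀ δ → 0ℚ < δ → Eventually λ n → seq x n ≤ seq y n + δ

-- The gap δ must be uniform in n: termwise strict inequality would not
-- respect _≃_.
_<ᴿ_ : ℝ → ℝ → Set
x <ᴿ y = ∃[ δ ] (0ℚ < δ × Eventually λ n → seq x n + δ ≤ seq y n)

abstract
  private
    ⊔≤⇒≤ˡ : ∀ M N {n} → M ℕ.⊔ N ℕ.≤ n → M ℕ.≤ n
    ⊔≤⇒≤ˡ M N = ℕ.≤-trans (ℕ.m≤m⊔n M N)

    ⊔≤⇒≤ʳ : ∀ M N {n} → M ℕ.⊔ N ℕ.≤ n → N ℕ.≤ n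
    ⊔≤⇒≤ʳ M N = ℕ.≤-trans (ℕ.m≤n⊔m M N)

    half : ∀ δ → 0ℚ < δ → ∃[ η ] (0ℚ < η × η + η ≡ δ)
    half δ 0<δ = ℚ.½ * δ , 0<½δ , trans (sym (ℚ.*-distribʳ-+ δ ℚ.½ ℚ.½)) (ℚ.*-identityˡ δ)
      where
      0<½δ : 0ℚ < ℚ.½ * δ
      0<½δ = subst (_< ℚ.½ * δ) (ℚ.*-zeroʳ ℚ.½) (ℚ.*-monoʳ-<-pos ℚ.½ 0<δ)

    div : ∀ B δ → 0ℚ < B → 0ℚ < δ → ∃[ η ] (0ℚ < η × B * η ≡ δ)
    div B δ 0<B 0<δ = 1/B * δ , 0<η , Bη≡δ
      where
      instance
        B⁺ : ℚ.Positive B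
        B⁺ = ℚ.positive 0<B
        B≢0 : ℚ.NonZero B
        B≢0 = ℚ.pos⇒nonZero B
      1/B : ℚ
      1/B = ℚ.1/ B
      instance
        1/B⁺ : ℚ.Positive 1/B
        1/B⁺ = ℚ.1/pos⇒pos B
      0<η : 0ℚ < 1/B * δ
      0<η = subst (_< 1/B * δ) (ℚ.*-zeroʳ 1/B) (ℚ.*-monoʳ-<-pos 1/B 0<δ)
      Bη≡δ : B * (1/B * δ) ≡ δ
      Bη≡δ = trans (sym (ℚ.*-assoc B 1/B δ))
               (trans (cong (_* δ) (ℚ.*-inverseʳ B)) (ℚ.*-identityˡ δ))

    ∣p∣≤∣p-q∣+∣q∣ : ∀ p q → ∣ p ∣ ≤ ∣ p - q ∣ + ∣ q ∣
    ∣p∣≤∣p-q∣+∣q∣ p q = subst (λ r → ∣ r ∣ ≤ ∣ p - q ∣ + ∣ q ∣) (sym (eq p q)) (ℚ.∣p+q∣≤∣p∣+∣q∣ (p - q) q)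
      where
      open +-*-Solver
      eq : ∀ p q → p ≡ (p - q) + q
      eq = solve 2 (λ p q → p := (p :- q) :+ q) refl

    +-close : ∀ p q r s {β γ} → ∣ p - r ∣ ≤ β → ∣ q - s ∣ ≤ γ → ∣ (p + q) - (r + s) ∣ ≤ β + γ
    +-close p q r s {β} {γ} p≈r q≈s = begin
      ∣ (p + q) - (r + s) ∣  ≡⟨ cong ∣_∣ (eq p q r s) ⟩
      ∣ (p - r) + (q - s) ∣  ≤⟨ ℚ.∣p+q∣≤∣p∣+∣q∣ (p - r) (q - s) ⟩
      ∣ p - r ∣ + ∣ q - s ∣  ≤⟨ ℚ.+-mono-≤ p≈r q≈s ⟩
      β + γ                  ∎
      where
      open ℚ.≤-Reasoning
      open +-*-Solver
      eq : ∀ p q r s → (p + q) - (r + s) ≡ (p - r) + (q - s)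
      eq = solve 4 (λ p q r s → (p :+ q) :- (r :+ s) := (p :- r) :+ (q :- s)) refl

    ∣p*q∣≤B*η : ∀ p q {B η} → 0ℚ < B → ∣ p ∣ ≤ B → ∣ q ∣ ≤ η → ∣ p * q ∣ ≤ B * η
    ∣p*q∣≤B*η p q {B} {η} 0<B p≤ q≤ = begin
      ∣ p * q ∣      ≡⟨ ℚ.∣p*q∣≡∣p∣*∣q∣ p q ⟩
      ∣ p ∣ * ∣ q ∣  ≤⟨ ℚ.*-monoʳ-≤-nonNeg ∣ q ∣ {{ℚ.nonNegative (ℚ.0≤∣p∣ q)}} p≤ ⟩
      B * ∣ q ∣      ≤⟨ ℚ.*-monoˡ-≤-nonNeg B {{ℚ.nonNegative (ℚ.<⇒≤ 0<B)}} q≤ ⟩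
      B * η          ∎
      where open ℚ.≤-Reasoning

    *-close : ∀ p q r s {B C β γ} → 0ℚ < B → 0ℚ < C → ∣ p ∣ ≤ B → ∣ s ∣ ≤ C →
              ∣ q - s ∣ ≤ β → ∣ p - r ∣ ≤ γ → ∣ p * q - r * s ∣ ≤ B * β + C * γ
    *-close p q r s {B} {C} {β} {γ} 0<B 0<C p≤ s≤ q≈s p≈r = begin
      ∣ p * q - r * s ∣                    ≡⟨ cong ∣_∣ (eq p q r s) ⟩
      ∣ p * (q - s) + s * (p - r) ∣        ≤⟨ ℚ.∣p+q∣≤∣p∣+∣q∣ (p * (q - s)) (s * (p - r)) ⟩
      ∣ p * (q - s) ∣ + ∣ s * (p - r) ∣    ≤⟨ ℚ.+-mono-≤ (∣p*q∣≤B*η p (q - s) 0<B p≤ q≈s)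
                                                         (∣p*q∣≤B*η s (p - r) 0<C s≤ p≈r) ⟩
      B * β + C * γ                        ∎
      where
      open ℚ.≤-Reasoning
      open +-*-Solver
      eq : ∀ p q r s → p * q - r * s ≡ p * (q - s) + s * (p - r)
      eq = solve 4 (λ p q r s → p :* q :- r :* s := p :* (q :- s) :+ s :* (p :- r)) refl

  bounded : ∀ x → IsCauchy x → ∃[ B ] (0ℚ < B × Eventually λ n → ∣ x n ∣ ≤ B)
  bounded x cx =
    let N , close = cx 1ℚ (ℚ.positive⁻¹ 1ℚ)
    in 1ℚ + ∣ x N ∣ , ℚ.+-mono-<-≤ (ℚ.positive⁻¹ 1ℚ) (ℚ.0≤∣p∣ (x N)) , N , λ n N≤n →
      ℚ.≤-trans (∣p∣≤∣p-q∣+∣q∣ (x n) (x N)) (ℚ.+-monoˡ-≤ ∣ x N ∣ (close n N N≤n ℕ.≤-refl))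

  const-cauchy : ∀ q → IsCauchy (λ _ → q)
  const-cauchy q δ 0<δ = 0 , λ _ _ _ _ →
    subst (_≤ δ) (sym (cong ∣_∣ (ℚ.+-inverseʳ q))) (ℚ.<⇒≤ 0<δ)

  neg-cauchy : ∀ x → IsCauchy x → IsCauchy (λ n → - x n)
  neg-cauchy x cx δ 0<δ =
    let N , close = cx δ 0<δ
    in N , λ m n N≤m N≤n →
      subst (_≤ δ)
        (trans (sym (ℚ.∣-p∣≡∣p∣ (x m - x n))) (cong ∣_∣ (ℚ.neg-distrib-+ (x m) (- x n))))
        (close m n N≤m N≤n)

  +-cauchy : ∀ x y → IsCauchy x → IsCauchy y → IsCauchy (λ n → x n + y n)
  +-cauchy x y cx cy δ 0<δ =
    let η , 0<η , η+η≡δ = half δ 0<δ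
        M , closeˣ = cx η 0<η
        N , closeʸ = cy η 0<η
    in M ℕ.⊔ N , λ m n ≤m ≤n → subst (∣ (x m + y m) - (x n + y n) ∣ ≤_) η+η≡δ
      (+-close (x m) (y m) (x n) (y n)
        (closeˣ m n (⊔≤⇒≤ˡ M N ≤m) (⊔≤⇒≤ˡ M N ≤n))
        (closeʸ m n (⊔≤⇒≤ʳ M N ≤m) (⊔≤⇒≤ʳ M N ≤n)))

  *-cauchy : ∀ x y → IsCauchy x → IsCauchy y → IsCauchy (λ n → x n * y n)
  *-cauchy x y cx cy δ 0<δ =
    let η , 0<η , η+η≡δ = half δ 0<δ
        B , 0<B , K , boundˣ = bounded x cx
        C , 0<C , L , boundʸ = bounded y cy
        β , 0<β , Bβ≡η = div B η 0<B 0<η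
        γ , 0<γ , Cγ≡η = div C η 0<C 0<η
        M , closeʸ = cy β 0<β
        N , closeˣ = cx γ 0<γ
        KL = K ℕ.⊔ L
        MN = M ℕ.⊔ N
    in KL ℕ.⊔ MN , λ m n ≤m ≤n →
      subst (∣ x m * y m - x n * y n ∣ ≤_) (trans (cong₂ _+_ Bβ≡η Cγ≡η) η+η≡δ)
        (*-close (x m) (y m) (x n) (y n) 0<B 0<C
          (boundˣ m (⊔≤⇒≤ˡ K L (⊔≤⇒≤ˡ KL MN ≤m)))
          (boundʸ n (⊔≤⇒≤ʳ K L (⊔≤⇒≤ˡ KL MN ≤n)))
          (closeʸ m n (⊔≤⇒≤ˡ M N (⊔≤⇒≤ʳ KL MN ≤m)) (⊔≤⇒≤ˡ M N (⊔≤⇒≤ʳ KL MN ≤n)))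
          (closeˣ m n (⊔≤⇒≤ʳ M N (⊔≤⇒≤ʳ KL MN ≤m)) (⊔≤⇒≤ʳ M N (⊔≤⇒≤ʳ KL MN ≤n))))

infixl 6 _+ᴿ_ _-ᴿ_
infixl 7 _*ᴿ_
infix  8 -ᴿ_

fromℚ : ℚ → ℝ
fromℚ q = mkℝ (λ _ → q) (const-cauchy q)

fromℕ : ℕ → ℝ
fromℕ n = fromℚ (+ n / 1)

0ᴿ 1ᴿ : ℝ
0ᴿ = fromℕ 0
1ᴿ = fromℕ 1

_+ᴿ_ _*ᴿ_ : ℝ → ℝ → ℝ
x +ᴿ y = mkℝ (λ n → seq x n + seq y n) (+-cauchy (seq x) (seq y) (cauchy x) (cauchy y))
x *ᴿ y = mkℝ (λ n → seq x n * seq y n) (*-cauchy (seq x) (seq y) (cauchy x) (cauchy y))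

-ᴿ_ : ℝ → ℝ
-ᴿ x = mkℝ (λ n → - seq x n) (neg-cauchy (seq x) (cauchy x))

_-ᴿ_ : ℝ → ℝ → ℝ
x -ᴿ y = x +ᴿ (-ᴿ y)

ℝ-rawRing : RawRing 0ℓ 0ℓ
ℝ-rawRing = record
  { Carrier = ℝ ; _≈_ = _≃_ ; _+_ = _+ᴿ_ ; _*_ = _*ᴿ_ ; -_ = -ᴿ_ ; 0# = 0ᴿ ; 1# = 1ᴿ }

------------------------------------------------------------------------
-- Determinants and eigenvalues

Matrix : Set → ℕ → Set
Matrix A N = Fin N → Fin N → A

module Determinant {c ℓ} (R : RawRing c ℓ) where
  private
    module R = RawRing R
  open RawSemiringDefs R.rawSemiring using (sum; _^_)

  -- Laplace expansion along the first row.
  det : ∀ {N} → (Fin N → Fin N → R.Carrier) → R.Carrier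
  det {zero}  M = R.1#
  det {suc N} M = sum λ j →
    ((R.- R.1#) ^ toℕ j) R.* (M zero j R.* det (λ r s → M (suc r) (punchIn j s)))

open RawSemiringDefs (RawRing.rawSemiring ℝ-rawRing) using (product)
open Determinant ℝ-rawRing using (det)

-- The characteristic polynomial, as the function x ↦ det (x I − A).
charPoly : ∀ {N} → Matrix ℝ N → ℝ → ℝ
charPoly A x = det λ i j → (if ⌊ i Fin.≟ j ⌋ then x else 0ᴿ) -ᴿ A i j

-- λs lists all eigenvalues of A with multiplicity:
-- det (x I − A) = ∏ᵢ (x − λᵢ).  For symmetric A such a list exists and is
-- unique up to order.
IsSpectrum : ∀ {N} → Matrix ℝ N → (Fin N → ℝ) → Set
IsSpectrum A λs = ∀ x → charPoly A x ≃ product (λ i → x -ᴿ λs i)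

------------------------------------------------------------------------
-- Multigraphs and generalised Petersen graphs

-- Each edge is listed once, with its two ends in arbitrary order;
-- repeated entries are parallel edges.
Multigraph : ℕ → Set
Multigraph N = List (Fin N × Fin N)

Joins : ∀ {N} → Fin N → Fin N → Fin N × Fin N → Set
Joins u v (x , y) = (x ≡ u × y ≡ v) ⊎ (x ≡ v × y ≡ u)

joins? : ∀ {N} (u v : Fin N) e → Dec (Joins u v e)
joins? u v (x , y) = (x Fin.≟ u ×-dec y Fin.≟ v) ⊎-dec (x Fin.≟ v ×-dec y Fin.≟ u)

adjacency : ∀ {N} → Multigraph N → Matrix ℕ N
adjacency G u v = length (filter (joins? u v) G)

IsGraphSpectrum : ∀ {N} → Multigraph N → (Fin N → ℝ) → Set
IsGraphSpectrum G = IsSpectrum λ u v → fromℕ (adjacency G u v)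

module _ (n : ℕ) .{{_ : NonZero n}} where

  a b : Fin n → Fin (2 ℕ.* n)
  a = combine {2} zero
  b = combine {2} (suc zero)

  shift : ℕ → Fin n → Fin n
  shift k i = (toℕ i ℕ.+ k) mod n

  -- The inner edges are listed for every i, so for 2k = n the pair
  -- b i, b (i + k) occurs twice, giving adjacency entry 2.
  petersen : ℕ → Multigraph (2 ℕ.* n)
  petersen k = tabulate (λ i → a i , a (shift 1 i))
            ++ tabulate (λ i → a i , b i)
            ++ tabulate (λ i → b i , b (shift k i))

{-# OPTIONS --safe #-}
module Submission where

-- Let A be the adjacency matrix of P(n,k), M = A + 3, and μ = λ + 3 for the
-- eigenvalues λ of A.  The rows of M sum to 6, and since the end of an
-- m-step walk is determined by its ring (a or b) and its displacements along
-- 1 and k, the walk reaches at most P = 2(2m+1)² vertices.  By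
-- Cauchy–Schwarz each diagonal entry of M^2m is at least 36^m / P.  Hence
-- for J = 2m + 1 the power sum ∑ μ^J = tr M^J is at least 2n · 3 · 36^m / P,
-- whereas ∑ μ^2J = tr M^2J ≤ 2n · 6^2J.  The eigenvalues with μ ≤ 6 - e
-- contribute at most 2n (6 - e)^J to the first sum, which is negligible for
-- a fixed large m because 6^J beats P (6 - e)^J; so a positive proportion of
-- the μ exceed 6 - e.
--
-- That ∑ μ^j = tr M^j follows from the equality of the characteristic
-- polynomials of M and diag(μ).  With s = t^K and G = ∑_{j<K} t^j M^j one has
-- (1 - tM) G = 1 - s M^K and (1 - (t+s) M) G = 1 - s (M^K + M G); comparing
-- determinants for the two matrices to first order in s shows that
-- ∑_{j<K} t^j tr M^(j+1) agrees for both modulo t^K.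

open import Algebra.Bundles using (CommutativeRing; Semiring)
open import Algebra.Bundles.Raw using (RawRing)
import Algebra.Definitions.RawSemiring as RawSemiringDefs
open import Algebra.Morphism.Structures using (IsRingHomomorphism)
open import Algebra.Structures using (IsCommutativeRing)
open import Data.Bool.Base using (Bool; true; false; if_then_else_)
open import Data.Bool.Properties using (T-≡)
open import Data.Empty using (⊥-elim)
open import Data.Fin.Base using (Fin; zero; suc; toℕ; punchIn; combine; remQuot; fromℕ<)
import Data.Fin.Properties as Fin
open import Data.Fin.Subset using (Subset; _∈_)
open import Data.Integer.Base as ℤ using (-[1+_])
import Data.Integer.Properties as ℤ
import Data.List.Properties as List
open import Data.Nat.Base as ℕ using (ℕ; zero; suc; NonZero)
open import Data.Nat.DivMod using (_%_; _mod_; %-distribˡ-+; m%n%n≡m%n; m<n⇒m%n≡m; m*n%n≡0; m%n<n; [m+kn]%n≡m%n)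
import Data.Nat.Properties as ℕ
open import Data.Nat.Solver using () renaming (module +-*-Solver to ℕ-Solver)
open import Data.Product.Base as Product using (_×_; _,_; proj₁; proj₂; ∃; ∃-syntax)
open import Data.Rational.Base as ℚ using (ℚ; 0ℚ; 1ℚ)
import Data.Rational.Properties as ℚ
open import Data.Rational.Solver using (module +-*-Solver)
import Data.Rational.Unnormalised.Base as ℚᵘ
import Data.Rational.Unnormalised.Properties as ℚᵘ
open import Data.Sum.Base as Sum using (_⊎_; inj₁; inj₂)
open import Data.Unit.Polymorphic using (⊤)
import Data.Vec.Base as Vec
import Data.Vec.Properties as Vec
open import Function.Base using (_∘_)
open import Function.Bundles using (Equivalence)
open import Level using (0ℓ; _⊔_)
import Relation.Binary.PropositionalEquality as ≡
open ≡ using (_≡_; _≢_)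
open import Relation.Nullary using (Dec; yes; no; ¬_)
open import Relation.Nullary.Decidable using (⌊_⌋; toWitness)
open import Defs hiding (a; b)

-- All that is known of the `λs` is a pointwise identity between two functions of a real variable.
-- There are no eigenvectors and no bound on a single `λ`, so everything passes through power sums:
-- the moment of order 2J stands in for an upper bound on μ, and J is odd so that the J-th power is
-- monotone and negative μ do no harm. The shift by 3 makes odd traces useful: those of A vanish on
-- bipartite graphs, whereas a diagonal entry of at least 3 yields tr M^(2m+1) ≥ 3 tr M^2m.
--
-- "Modulo t^K" is read in the ring of sequences of reals with a uniform bound, where t takes the
-- values 1/(m+1). Each value is invertible, so the characteristic polynomial can be evaluated at
-- 1/t and t cancels; yet t is no unit, and constants that are congruent modulo t are equal. Hence
-- determinants are developed over an arbitrary commutative ring and then carried along evaluation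
-- homomorphisms.
--
-- The order of the reals is not decidable. The large eigenvalues are therefore selected from
-- rational approximations at one late index, and ε is spent as 2e: one e for the spectral cut, one
-- for the approximation.

module Determinants {c ℓ} (R : CommutativeRing c ℓ) where
  open CommutativeRing R hiding (zero)
  open import Algebra.Properties.Ring ring
  open import Data.Vec.Functional using (_∷_; head; tail)
  open import Algebra.Properties.Semiring.Sum semiring as Summation using (sum)
  open import Algebra.Definitions.RawSemiring (Semiring.rawSemiring semiring) using (_^_; product)
  open import Relation.Binary.Reasoning.Setoid setoid
  open Determinant rawRing renaming (det to detᴰ)
  open import Algebra.Solver.Ring.NaturalCoefficients.Default commutativeSemiring

  -- Vectors, finite sums and determinants over a commutative ring.

  Vec : ℕ → Set c
  Vec n = Fin n → Carrier

  Rows : ℕ → ℕ → Set c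
  Rows m n = Fin m → Vec n

  infix 4 _≋_
  _≋_ : ∀ {n} → Vec n → Vec n → Set ℓ
  v ≋ w = ∀ i → v i ≈ w i

  infixl 6 _⊕_
  infixr 7 _·_
  _⊕_ : ∀ {n} → Vec n → Vec n → Vec n
  (v ⊕ w) i = v i + w i
  _·_ : ∀ {n} → Carrier → Vec n → Vec n
  (x · v) i = x * v i

  𝟘 : ∀ {n} → Vec n
  𝟘 _ = 0#

  -- By recursion instead of decidable equality of indices, so that removing the first row and
  -- column of `𝟙` gives `𝟙` again by computation.
  𝟙 : ∀ {n} → Rows n n
  𝟙 zero    zero    = 1#
  𝟙 zero    (suc _) = 0#
  𝟙 (suc _) zero    = 0#
  𝟙 (suc i) (suc j) = 𝟙 i j

  sgn : ∀ {n} → Fin n → Carrier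
  sgn j = (- 1#) ^ toℕ j

  deleteColumn : ∀ {n} → Fin (suc n) → Vec (suc n) → Vec n
  deleteColumn j v = v ∘ punchIn j

  -- Opaque copies of sum and det: unfolding them would obstruct unification.
  opaque
    ∑ : ∀ {n} → Vec n → Carrier
    ∑ = sum

    ∑-suc : ∀ {n} (f : Vec (suc n)) → ∑ f ≈ f zero + ∑ (f ∘ suc)
    ∑-suc f = refl

    ∑-empty : ∀ (f : Vec 0) → ∑ f ≈ 0#
    ∑-empty f = refl

    ∑≈sum : ∀ {n} (f : Vec n) → ∑ f ≈ sum f
    ∑≈sum f = refl

    ∑-cong : ∀ {n} {f g : Vec n} → f ≋ g → ∑ f ≈ ∑ g
    ∑-cong = Summation.sum-cong-≋

    ∑-+ : ∀ {n} (f g : Vec n) → ∑ (λ i → f i + g i) ≈ ∑ f + ∑ g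
    ∑-+ = Summation.∑-distrib-+

    ∑-*ˡ : ∀ {n} x (f : Vec n) → x * ∑ f ≈ ∑ (λ i → x * f i)
    ∑-*ˡ = Summation.*-distribˡ-sum

    ∑-*ʳ : ∀ {n} x (f : Vec n) → ∑ f * x ≈ ∑ (λ i → f i * x)
    ∑-*ʳ = Summation.*-distribʳ-sum

    ∑-swap : ∀ {m n} (f : Fin m → Vec n) → ∑ (λ i → ∑ (f i)) ≈ ∑ λ j → ∑ λ i → f i j
    ∑-swap = Summation.∑-comm

    ∑-zero : ∀ {n} {f : Vec n} → (∀ i → f i ≈ 0#) → ∑ f ≈ 0#
    ∑-zero {n} f≈0 = trans (Summation.sum-cong-≋ f≈0) (Summation.sum-replicate-zero n)

    det : ∀ {n} → Rows n n → Carrier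
    det = detᴰ

    det≈detᴰ : ∀ {n} (A : Rows n n) → det A ≈ detᴰ A
    det≈detᴰ A = refl

    det-empty : ∀ (A : Rows 0 0) → det A ≈ 1#
    det-empty A = refl

    laplace : ∀ {n} (A : Rows (suc n) (suc n)) →
              det A ≈ ∑ λ j → sgn j * (A zero j * det (deleteColumn j ∘ tail A))
    laplace A = refl

    det-cong : ∀ {n} {A B : Rows n n} → (∀ i → A i ≋ B i) → det A ≈ det B
    det-cong {zero}  A≋B = refl
    det-cong {suc n} A≋B = Summation.sum-cong-≋ λ j →
      *-congˡ {sgn j} (*-cong (A≋B zero j) (det-cong λ r s → A≋B (suc r) (punchIn j s)))

  ∷-cong : ∀ {m n} {v w : Vec n} {A B : Rows m n} → v ≋ w → (∀ i → A i ≋ B i) →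
           ∀ i → (v ∷ A) i ≋ (w ∷ B) i
  ∷-cong v≋w A≋B zero    = v≋w
  ∷-cong v≋w A≋B (suc i) = A≋B i

  ∷-η : ∀ {m n} (A : Rows (suc m) n) i → A i ≋ (head A ∷ tail A) i
  ∷-η A zero    j = refl
  ∷-η A (suc i) j = refl

  -- Alternating multilinear forms.

  Congruent : ∀ {m n} → (Rows m n → Carrier) → Set (c ⊔ ℓ)
  Congruent φ = ∀ {A B} → (∀ i → A i ≋ B i) → φ A ≈ φ B

  record IsLinear {n} (f : Vec n → Carrier) : Set (c ⊔ ℓ) where
    field
      cong   : ∀ {v w} → v ≋ w → f v ≈ f w
      linear : ∀ x v w → f (x · v ⊕ w) ≈ x * f v + f w

    zeroᶠ : f 𝟘 ≈ 0#
    zeroᶠ = begin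
      f 𝟘                    ≈⟨ cong (λ i → sym (trans (+-identityʳ _) (zeroʳ _))) ⟩
      f (- 1# · 𝟘 ⊕ 𝟘)       ≈⟨ linear _ _ _ ⟩
      - 1# * f 𝟘 + f 𝟘       ≈⟨ +-congʳ (-1*x≈-x _) ⟩
      - f 𝟘 + f 𝟘            ≈⟨ -‿inverseˡ _ ⟩
      0#                     ∎

    add : ∀ v w → f (v ⊕ w) ≈ f v + f w
    add v w = begin
      f (v ⊕ w)       ≈⟨ cong (λ i → +-congʳ (sym (*-identityˡ _))) ⟩
      f (1# · v ⊕ w)  ≈⟨ linear _ _ _ ⟩
      1# * f v + f w  ≈⟨ +-congʳ (*-identityˡ _) ⟩
      f v + f w       ∎

  linear-expand : ∀ {n} {f : Vec n → Carrier} → IsLinear f → ∀ v → f v ≈ ∑ λ j → v j * f (𝟙 j)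
  linear-expand {zero}  F v = trans (trans (IsLinear.cong F λ ()) (IsLinear.zeroᶠ F)) (sym (∑-empty _))
  linear-expand {suc n} {f} F v = begin
    f v                                     ≈⟨ F.cong split ⟩
    f (head v · 𝟙 zero ⊕ (0# ∷ tail v))     ≈⟨ F.linear _ _ _ ⟩
    head v * f (𝟙 zero) + f (0# ∷ tail v)   ≈⟨ +-congˡ (linear-expand tailF (tail v)) ⟩
    head v * f (𝟙 zero) + ∑ (λ j → v (suc j) * f (0# ∷ 𝟙 j))
      ≈⟨ +-congˡ (∑-cong λ j → *-congˡ (F.cong λ { zero → refl ; (suc i) → refl })) ⟩
    head v * f (𝟙 zero) + ∑ (λ j → v (suc j) * f (𝟙 (suc j)))  ≈⟨ ∑-suc _ ⟨
    ∑ (λ j → v j * f (𝟙 j)) ∎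
    where
    module F = IsLinear F
    split : v ≋ head v · 𝟙 zero ⊕ (0# ∷ tail v)
    split zero    = sym (trans (+-identityʳ _) (*-identityʳ _))
    split (suc i) = sym (trans (+-congʳ (zeroʳ _)) (+-identityˡ _))
    tailF : IsLinear (λ w → f (0# ∷ w))
    tailF = record
      { cong   = λ v≋w → F.cong λ { zero → refl ; (suc i) → v≋w i }
      ; linear = λ x v w → trans
          (F.cong λ { zero → sym (trans (+-identityʳ _) (zeroʳ _)) ; (suc i) → refl })
          (F.linear x (0# ∷ v) (0# ∷ w))
      }

  -- Only the first two rows are required to alternate at each stage; that
  -- any two equal rows give zero is derived in vanishes.
  Alternating : ∀ m {n} → (Rows m n → Carrier) → Set (c ⊔ ℓ)
  Alternating zero    φ = ⊤
  Alternating (suc m) φ =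
      (∀ A → IsLinear (λ v → φ (v ∷ A)))
    × (∀ v A (i : Fin m) → toℕ i ≡ 0 → A i ≋ v → φ (v ∷ A) ≈ 0#)
    × (∀ v → Alternating m (λ A → φ (v ∷ A)))

  fix-cong : ∀ {m n} {φ : Rows (suc m) n → Carrier} → Congruent φ → ∀ v → Congruent (λ A → φ (v ∷ A))
  fix-cong φ-cong v A≋B = φ-cong (∷-cong (λ _ → refl) A≋B)

  -- Polarisation: in the expansion of `φ` on two rows both equal to `v ⊕ w` the unmixed terms
  -- vanish, so the two mixed ones are opposite.
  swap : ∀ {m n} {φ : Rows (2 ℕ.+ m) n → Carrier} → Congruent φ → Alternating (2 ℕ.+ m) φ →
         ∀ v w A → φ (v ∷ w ∷ A) ≈ - φ (w ∷ v ∷ A)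
  swap {φ = φ} φ-cong (lin₀ , alt , rest) v w A = +-inverseˡ-unique _ _ (begin
    φ (v ∷ w ∷ A) + φ (w ∷ v ∷ A)
      ≈⟨ solve 2 (λ x y → x :+ y := (con 0 :+ x) :+ (y :+ con 0)) refl _ _ ⟩
    (0# + φ (v ∷ w ∷ A)) + (φ (w ∷ v ∷ A) + 0#)
      ≈⟨ +-cong (+-congʳ (sym (diag v))) (+-congˡ (sym (diag w))) ⟩
    (φ (v ∷ v ∷ A) + φ (v ∷ w ∷ A)) + (φ (w ∷ v ∷ A) + φ (w ∷ w ∷ A))
      ≈⟨ +-cong (add₁ v v w) (add₁ w v w) ⟨
    φ (v ∷ (v ⊕ w) ∷ A) + φ (w ∷ (v ⊕ w) ∷ A)
      ≈⟨ IsLinear.add (lin₀ ((v ⊕ w) ∷ A)) v w ⟨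
    φ ((v ⊕ w) ∷ (v ⊕ w) ∷ A)
      ≈⟨ diag (v ⊕ w) ⟩
    0# ∎)
    where
    diag : ∀ v → φ (v ∷ v ∷ A) ≈ 0#
    diag v = alt v (v ∷ A) zero ≡.refl (λ _ → refl)
    add₁ : ∀ u v w → φ (u ∷ (v ⊕ w) ∷ A) ≈ φ (u ∷ v ∷ A) + φ (u ∷ w ∷ A)
    add₁ u v w = IsLinear.add (proj₁ (rest u) A) v w

  -- If the row equal to `v` is not the next one, `swap` moves `v` one place down, and the induction
  -- applies to the form with `head A` fixed in front.
  vanishes : ∀ {m n} {φ : Rows (suc m) n → Carrier} → Congruent φ → Alternating (suc m) φ →
             ∀ v A i → A i ≋ v → φ (v ∷ A) ≈ 0#
  vanishes φ-cong (_ , alt , _) v A zero Ai≋v = alt v A zero ≡.refl Ai≋v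
  vanishes {φ = φ} φ-cong alt@(_ , _ , rest) v A (suc i) Ai≋v = begin
    φ (v ∷ A)                      ≈⟨ φ-cong (∷-cong (λ _ → refl) (∷-η A)) ⟩
    φ (v ∷ head A ∷ tail A)        ≈⟨ swap φ-cong alt v (head A) (tail A) ⟩
    - φ (head A ∷ v ∷ tail A)
      ≈⟨ -‿cong (vanishes (fix-cong φ-cong (head A)) (rest (head A)) v (tail A) i Ai≋v) ⟩
    - 0#                           ≈⟨ -0#≈0# ⟩
    0#                             ∎

  -- Row `j` passes the `j` rows above it by adjacent transpositions. With `A = 𝟙` this supplies the
  -- sign of a cofactor in `alternating-unique`.
  move-to-front : ∀ {m n} {φ : Rows (suc m) n → Carrier} → Congruent φ → Alternating (suc m) φ →
                  ∀ (A : Rows (suc m) n) j → φ (A j ∷ (A ∘ punchIn j)) ≈ sgn j * φ A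
  move-to-front φ-cong alt A zero =
    trans (φ-cong λ { zero j → refl ; (suc i) j → refl }) (sym (*-identityˡ _))
  move-to-front {suc m} {φ = φ} φ-cong alt@(_ , _ , rest) A (suc j) = begin
    φ (A (suc j) ∷ (A ∘ punchIn (suc j)))
      ≈⟨ φ-cong (∷-cong (λ _ → refl) λ { zero _ → refl ; (suc i) _ → refl }) ⟩
    φ (A (suc j) ∷ A zero ∷ (A ∘ suc ∘ punchIn j))
      ≈⟨ swap φ-cong alt _ _ _ ⟩
    - φ (A zero ∷ A (suc j) ∷ (A ∘ suc ∘ punchIn j))
      ≈⟨ -‿cong (move-to-front (fix-cong φ-cong (A zero)) (rest (A zero)) (A ∘ suc) j) ⟩
    - (sgn j * φ (A zero ∷ (A ∘ suc)))
      ≈⟨ -‿cong (*-congˡ (φ-cong λ i k → sym (∷-η A i k))) ⟩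
    - (sgn j * φ A)                ≈⟨ -1*x≈-x _ ⟨
    - 1# * (sgn j * φ A)           ≈⟨ *-assoc _ _ _ ⟨
    sgn (suc j) * φ A              ∎

  record IsLinearMap {m n} (L : Vec m → Vec n) : Set (c ⊔ ℓ) where
    field
      cong   : ∀ {v w} → v ≋ w → L v ≋ L w
      linear : ∀ x v w → L (x · v ⊕ w) ≋ x · L v ⊕ L w

  alternating-cong : ∀ m {n} {φ ψ : Rows m n → Carrier} → (∀ A → φ A ≈ ψ A) → Alternating m φ → Alternating m ψ
  alternating-cong zero    eq _ = _
  alternating-cong (suc m) eq (lin , alt , rest) =
      (λ A → record
        { cong   = λ v≋w → trans (sym (eq _)) (trans (IsLinear.cong (lin A) v≋w) (eq _))
        ; linear = λ x v w → trans (sym (eq _)) (trans (IsLinear.linear (lin A) x v w)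
                     (+-cong (*-congˡ (eq _)) (eq _))) })
    , (λ v A i i≡0 e → trans (sym (eq _)) (alt v A i i≡0 e))
    , (λ v → alternating-cong m (λ A → eq (v ∷ A)) (rest v))

  -- Applied with `L` the deletion of a column, the insertion `embed` of a zero coordinate, and
  -- right multiplication by a matrix.
  pullback : ∀ m {n n′} {φ : Rows m n′ → Carrier} {L : Vec n → Vec n′} → Congruent φ → IsLinearMap L →
             Alternating m φ → Alternating m (λ A → φ (L ∘ A))
  pullback zero    φ-cong L _ = _
  pullback (suc m) {φ = φ} {L} φ-cong L-lin (lin , alt , rest) =
      (λ A → record
        { cong   = λ v≋w → φ-cong λ { zero → L.cong v≋w ; (suc i) j → refl }
        ; linear = λ x v w → trans
            (φ-cong λ { zero → L.linear x v w ; (suc i) j → refl })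
            (trans (IsLinear.linear (lin (L ∘ A)) x (L v) (L w))
              (+-cong (*-congˡ (sym (L-∷ v A))) (sym (L-∷ w A)))) })
    , (λ v A i i≡0 e → trans (L-∷ v A) (alt (L v) (L ∘ A) i i≡0 (L.cong e)))
    , (λ v → alternating-cong m (λ A → sym (L-∷ v A))
               (pullback m (fix-cong φ-cong (L v)) L-lin (rest (L v))))
    where
    module L = IsLinearMap L-lin
    L-∷ : ∀ v A → φ (L ∘ (v ∷ A)) ≈ φ (L v ∷ (L ∘ A))
    L-∷ v A = φ-cong λ { zero _ → refl ; (suc i) _ → refl }

  -- The Laplace expansion with its first row held fixed has this shape: a combination of minors
  -- with constant coefficients.
  sum-alternating : ∀ m {n N} (x : Vec N) {φ : Fin N → Rows m n → Carrier} →
                    (∀ j → Alternating m (φ j)) → Alternating m (λ A → ∑ λ j → x j * φ j A)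
  sum-alternating zero    x alts = _
  sum-alternating (suc m) x {φ} alts =
      (λ A → record
        { cong   = λ v≋w → ∑-cong λ j → *-congˡ (IsLinear.cong (proj₁ (alts j) A) v≋w)
        ; linear = λ y v w → begin
            ∑ (λ j → x j * φ j ((y · v ⊕ w) ∷ A))
              ≈⟨ ∑-cong (λ j → trans (*-congˡ (IsLinear.linear (proj₁ (alts j) A) y v w))
                   (solve 4 (λ x y a b → x :* (y :* a :+ b) := y :* (x :* a) :+ x :* b) refl (x j) y _ _)) ⟩
            ∑ (λ j → y * (x j * φ j (v ∷ A)) + x j * φ j (w ∷ A))
              ≈⟨ ∑-+ (λ j → y * (x j * φ j (v ∷ A))) (λ j → x j * φ j (w ∷ A)) ⟩
            ∑ (λ j → y * (x j * φ j (v ∷ A))) + ∑ (λ j → x j * φ j (w ∷ A))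
              ≈⟨ +-congʳ (∑-*ˡ y _) ⟨
            y * ∑ (λ j → x j * φ j (v ∷ A)) + ∑ (λ j → x j * φ j (w ∷ A)) ∎ })
    , (λ v A i i≡0 e → ∑-zero λ j → trans (*-congˡ (proj₁ (proj₂ (alts j)) v A i i≡0 e)) (zeroʳ _))
    , (λ v → sum-alternating m x λ j → proj₂ (proj₂ (alts j)) v)

  -- The determinant by Laplace expansion is alternating.

  punchIn-exchange : ∀ {n} (j : Fin (2 ℕ.+ n)) l j′ l′ → punchIn j l ≡ j′ → punchIn j′ l′ ≡ j →
                     ∀ k → punchIn j (punchIn l k) ≡ punchIn j′ (punchIn l′ k)
  punchIn-exchange zero    l       _ zero     ≡.refl _  k = ≡.refl
  punchIn-exchange zero    l       _ (suc l′) ≡.refl () k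
  punchIn-exchange (suc j) zero    _ l′       ≡.refl ≡.refl k = ≡.refl
  punchIn-exchange (suc j) (suc l) _ zero     ≡.refl () k
  punchIn-exchange (suc j) (suc l) _ (suc l′) ≡.refl e zero    = ≡.refl
  punchIn-exchange {suc n} (suc j) (suc l) _ (suc l′) ≡.refl e (suc k) =
    ≡.cong suc (punchIn-exchange j l _ l′ ≡.refl (Fin.suc-injective e) k)

  -- The sum runs over ordered pairs of distinct indices `j` and `punchIn j l`, and exchanging the
  -- pair reverses the sign. This alone would only show that twice the sum is 0, and 2 may be a zero
  -- divisor; so the pairs are cancelled explicitly, those involving index 0 first and the others by
  -- induction.
  pair-sum-zero : ∀ {n} (G : Fin (suc n) → Fin n → Carrier) →
    (∀ j l j′ l′ → punchIn j l ≡ j′ → punchIn j′ l′ ≡ j → G j l ≈ G j′ l′) →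
    (∑ λ j → ∑ λ l → sgn j * (sgn l * G j l)) ≈ 0#
  pair-sum-zero {zero}  G G-sym = ∑-zero λ j → ∑-empty _
  pair-sum-zero {suc n} G G-sym = begin
    (∑ λ j → ∑ λ l → sgn j * (sgn l * G j l))
      ≈⟨ ∑-suc _ ⟩
    (∑ λ l → 1# * (sgn l * G zero l)) + (∑ λ j → ∑ λ l → sgn (suc j) * (sgn l * G (suc j) l))
      ≈⟨ +-congˡ (trans (∑-cong λ j → ∑-suc _) (∑-+ _ _)) ⟩
    (∑ λ l → 1# * (sgn l * G zero l)) +
      ((∑ λ j → sgn (suc j) * (1# * G (suc j) zero)) + (∑ λ j → ∑ λ l → sgn (suc j) * (sgn (suc l) * G (suc j) (suc l))))
      ≈⟨ +-assoc _ _ _ ⟨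
    ((∑ λ l → 1# * (sgn l * G zero l)) + (∑ λ j → sgn (suc j) * (1# * G (suc j) zero))) +
      (∑ λ j → ∑ λ l → sgn (suc j) * (sgn (suc l) * G (suc j) (suc l)))
      ≈⟨ +-cong (trans (sym (∑-+ _ _)) (∑-zero cancel))
           (trans (∑-cong λ j → ∑-cong λ l → signs (sgn j) (sgn l) (G (suc j) (suc l)))
             (pair-sum-zero (λ j l → G (suc j) (suc l)) λ j l j′ l′ p q → G-sym _ _ _ _ (≡.cong suc p) (≡.cong suc q))) ⟩
    0# + 0# ≈⟨ +-identityˡ _ ⟩
    0# ∎
    where
    signs : ∀ x y g → (- 1# * x) * ((- 1# * y) * g) ≈ x * (y * g)
    signs x y g = begin
      (- 1# * x) * ((- 1# * y) * g)
        ≈⟨ solve 4 (λ m x y g → (m :* x) :* ((m :* y) :* g) := (m :* m) :* (x :* (y :* g))) refl (- 1#) x y g ⟩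
      (- 1# * - 1#) * (x * (y * g))  ≈⟨ *-congʳ (trans (-1*x≈-x _) (-‿involutive 1#)) ⟩
      1# * (x * (y * g))             ≈⟨ *-identityˡ _ ⟩
      x * (y * g)                    ∎
    cancel : ∀ l → 1# * (sgn l * G zero l) + sgn (suc l) * (1# * G (suc l) zero) ≈ 0#
    cancel l = begin
      1# * (sgn l * G zero l) + (- 1# * sgn l) * (1# * G (suc l) zero)
        ≈⟨ +-congˡ (*-congˡ (*-congˡ (G-sym (suc l) zero zero l ≡.refl ≡.refl))) ⟩
      1# * (sgn l * G zero l) + (- 1# * sgn l) * (1# * G zero l)
        ≈⟨ solve 3 (λ m s g → con 1 :* (s :* g) :+ (m :* s) :* (con 1 :* g) := s :* g :+ m :* (s :* g)) refl (- 1#) (sgn l) _ ⟩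
      sgn l * G zero l + - 1# * (sgn l * G zero l) ≈⟨ +-congˡ (-1*x≈-x _) ⟩
      sgn l * G zero l + - (sgn l * G zero l)      ≈⟨ -‿inverseʳ _ ⟩
      0# ∎

  deleteColumn-linear : ∀ {n} (j : Fin (suc n)) → IsLinearMap (deleteColumn j)
  deleteColumn-linear j = record { cong = λ e i → e (punchIn j i) ; linear = λ x v w i → refl }

  -- Equality of the first two rows is settled by expanding along both of them. For the lower rows
  -- the induction hypothesis suffices, since `det` with a fixed first row is a combination of
  -- smaller determinants.
  det-alternating : ∀ n → Alternating n (det {n})
  det-alternating zero    = _
  det-alternating (suc n) = lin , alt , tail-alternating
    where
    lin : ∀ A → IsLinear (λ v → det (v ∷ A))
    lin A = record
      { cong   = λ v≋w → det-cong (∷-cong v≋w λ _ _ → refl)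
      ; linear = λ x v w → begin
          det ((x · v ⊕ w) ∷ A)
            ≈⟨ laplace _ ⟩
          (∑ λ j → sgn j * ((x * v j + w j) * D j))
            ≈⟨ ∑-cong (λ j → solve 5 (λ s x v w d → s :* ((x :* v :+ w) :* d) := x :* (s :* (v :* d)) :+ s :* (w :* d)) refl (sgn j) x (v j) (w j) (D j)) ⟩
          (∑ λ j → x * (sgn j * (v j * D j)) + sgn j * (w j * D j))
            ≈⟨ ∑-+ (λ j → x * (sgn j * (v j * D j))) _ ⟩
          (∑ λ j → x * (sgn j * (v j * D j))) + (∑ λ j → sgn j * (w j * D j))
            ≈⟨ +-congʳ (∑-*ˡ x _) ⟨
          x * (∑ λ j → sgn j * (v j * D j)) + (∑ λ j → sgn j * (w j * D j))
            ≈⟨ +-cong (*-congˡ (laplace _)) (laplace _) ⟨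
          x * det (v ∷ A) + det (w ∷ A) ∎
      }
      where
      D : Fin (suc n) → Carrier
      D j = det (λ r s → A r (punchIn j s))

    tail-alternating : ∀ v → Alternating n (λ A → det (v ∷ A))
    tail-alternating v = alternating-cong n (λ A → trans (∑-cong λ j → *-assoc (sgn j) (v j) _) (sym (laplace (v ∷ A))))
      (sum-alternating n (λ j → sgn j * v j)
        λ j → pullback n det-cong (deleteColumn-linear j) (det-alternating n))

    alt : ∀ v A (i : Fin n) → toℕ i ≡ 0 → A i ≋ v → det (v ∷ A) ≈ 0#
    alt v A zero _ A₀≋v = begin
      det (v ∷ A)
        ≈⟨ trans (laplace (v ∷ A)) (∑-cong λ j → *-congˡ (*-congˡ (laplace (deleteColumn j ∘ A)))) ⟩
      (∑ λ j → sgn j * (v j * ∑ λ l → sgn l * (A zero (punchIn j l) * D j l)))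
        ≈⟨ ∑-cong (λ j → begin
             sgn j * (v j * ∑ λ l → sgn l * (A zero (punchIn j l) * D j l))
               ≈⟨ *-assoc _ _ _ ⟨
             (sgn j * v j) * (∑ λ l → sgn l * (A zero (punchIn j l) * D j l))
               ≈⟨ ∑-*ˡ _ _ ⟩
             (∑ λ l → (sgn j * v j) * (sgn l * (A zero (punchIn j l) * D j l)))
               ≈⟨ ∑-cong (λ l → trans (*-congˡ (*-congˡ (*-congʳ (A₀≋v _))))
                    (solve 5 (λ s v t w d → (s :* v) :* (t :* (w :* d)) := s :* (t :* (v :* w :* d))) refl
                      (sgn j) (v j) (sgn l) (v (punchIn j l)) (D j l))) ⟩
             (∑ λ l → sgn j * (sgn l * (v j * v (punchIn j l) * D j l))) ∎) ⟩
      (∑ λ j → ∑ λ l → sgn j * (sgn l * (v j * v (punchIn j l) * D j l)))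
        ≈⟨ pair-sum-zero (λ j l → v j * v (punchIn j l) * D j l) exchange ⟩
      0# ∎
      where
      D : ∀ j l → Carrier
      D j l = det (λ r s → A (suc r) (punchIn j (punchIn l s)))
      -- The order in which two columns are deleted is immaterial: either way the remaining ones are
      -- enumerated in increasing order.
      exchange : ∀ j l j′ l′ → punchIn j l ≡ j′ → punchIn j′ l′ ≡ j →
                 v j * v (punchIn j l) * D j l ≈ v j′ * v (punchIn j′ l′) * D j′ l′
      exchange j l j′ l′ ≡.refl q = *-cong
        (trans (*-comm _ _) (*-congˡ (reflexive (≡.cong v (≡.sym q)))))
        (det-cong λ r s → reflexive (≡.cong (A (suc r)) (punchIn-exchange j l j′ l′ ≡.refl q s)))

  -- Uniqueness of alternating forms.

  embed : ∀ {n} → Fin (suc n) → Vec n → Vec (suc n)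
  embed         zero    v = 0# ∷ v
  embed {suc n} (suc j) v = v zero ∷ embed j (tail v)

  embed-linear : ∀ {n} (j : Fin (suc n)) → IsLinearMap (embed j)
  embed-linear j = record { cong = cong j ; linear = linear j }
    where
    cong : ∀ {n} (j : Fin (suc n)) {v w : Vec n} → v ≋ w → embed j v ≋ embed j w
    cong         zero    e zero    = refl
    cong         zero    e (suc i) = e i
    cong {suc n} (suc j) e zero    = e zero
    cong {suc n} (suc j) e (suc i) = cong j (e ∘ suc) i
    linear : ∀ {n} (j : Fin (suc n)) x (v w : Vec n) → embed j (x · v ⊕ w) ≋ x · embed j v ⊕ embed j w
    linear         zero    x v w zero    = sym (trans (+-identityʳ _) (zeroʳ _))
    linear         zero    x v w (suc i) = refl
    linear {suc n} (suc j) x v w zero    = refl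
    linear {suc n} (suc j) x v w (suc i) = linear j x (tail v) (tail w) i

  embed-𝟙 : ∀ {n} (j : Fin (suc n)) k → embed j (𝟙 k) ≋ 𝟙 (punchIn j k)
  embed-𝟙 zero    k       zero    = refl
  embed-𝟙 zero    k       (suc i) = refl
  embed-𝟙 {suc n} (suc j) zero    zero    = refl
  embed-𝟙 {suc n} (suc j) zero    (suc i) = embed-𝟘 j i
    where
    embed-𝟘 : ∀ {n} (j : Fin (suc n)) → embed j 𝟘 ≋ 𝟘
    embed-𝟘         zero    zero    = refl
    embed-𝟘         zero    (suc i) = refl
    embed-𝟘 {suc n} (suc j) zero    = refl
    embed-𝟘 {suc n} (suc j) (suc i) = embed-𝟘 j i
  embed-𝟙 {suc n} (suc j) (suc k) zero    = refl
  embed-𝟙 {suc n} (suc j) (suc k) (suc i) = embed-𝟙 j k i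

  split-off : ∀ {n} (j : Fin (suc n)) v → v ≋ v j · 𝟙 j ⊕ embed j (deleteColumn j v)
  split-off         zero    v zero    = sym (trans (+-identityʳ _) (*-identityʳ _))
  split-off         zero    v (suc i) = sym (trans (+-congʳ (zeroʳ _)) (+-identityˡ _))
  split-off {suc n} (suc j) v zero    = sym (trans (+-congʳ (zeroʳ _)) (+-identityˡ _))
  split-off {suc n} (suc j) v (suc i) = split-off j (tail v) i

  -- Column `j` can be cleared row by row: by linearity the part `v j · 𝟙 j` of a row splits off,
  -- and its contribution is killed. What remains is `embed j` of the row without that column.
  eliminate : ∀ m {n} (j : Fin (suc n)) {ψ : Rows m (suc n) → Carrier} → Congruent ψ → Alternating m ψ →
              (∀ A i → A i ≋ 𝟙 j → ψ A ≈ 0#) → ∀ A → ψ A ≈ ψ (embed j ∘ deleteColumn j ∘ A)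
  eliminate zero    j ψ-cong alt kills A = ψ-cong λ ()
  eliminate (suc m) j {ψ} ψ-cong alt@(lin , _ , rest) kills A = begin
    ψ A                                       ≈⟨ ψ-cong (∷-η A) ⟩
    ψ (head A ∷ tail A)                       ≈⟨ IsLinear.cong (lin (tail A)) (split-off j (head A)) ⟩
    ψ ((head A j · 𝟙 j ⊕ z (head A)) ∷ tail A) ≈⟨ IsLinear.linear (lin (tail A)) _ _ _ ⟩
    head A j * ψ (𝟙 j ∷ tail A) + ψ (z (head A) ∷ tail A)
      ≈⟨ +-congʳ (trans (*-congˡ (kills _ zero λ _ → refl)) (zeroʳ _)) ⟩
    0# + ψ (z (head A) ∷ tail A)              ≈⟨ +-identityˡ _ ⟩
    ψ (z (head A) ∷ tail A)
      ≈⟨ eliminate m j (fix-cong ψ-cong (z (head A))) (rest (z (head A))) (λ B i → kills (z (head A) ∷ B) (suc i)) (tail A) ⟩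
    ψ (z (head A) ∷ (z ∘ tail A))             ≈⟨ ψ-cong (λ { zero _ → refl ; (suc i) _ → refl }) ⟩
    ψ (z ∘ A)                                 ∎
    where
    z = embed j ∘ deleteColumn j

  -- The first row is expanded in the standard basis. With `𝟙 j` in front, column `j` of the other
  -- rows no longer matters, so `φ` becomes an alternating form in the minor and the induction
  -- hypothesis applies. Its normalising value is `φ` on the rows of `𝟙` with row `j` moved to the
  -- front, which is where the Laplace sign comes from.
  alternating-unique : ∀ n {φ : Rows n n → Carrier} → Congruent φ → Alternating n φ →
                       ∀ A → φ A ≈ det A * φ 𝟙
  alternating-unique zero    φ-cong alt A = sym (trans (*-cong (det-empty A) (φ-cong λ ())) (*-identityˡ _))
  alternating-unique (suc n) {φ} φ-cong alt@(lin , _ , rest) A = begin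
    φ A                                          ≈⟨ φ-cong (∷-η A) ⟩
    φ (head A ∷ tail A)                          ≈⟨ linear-expand (lin (tail A)) (head A) ⟩
    (∑ λ j → A zero j * φ (𝟙 j ∷ tail A))      ≈⟨ ∑-cong (λ j → trans (*-congˡ (cofactor j))
         (solve 4 (λ a s d p → a :* (d :* (s :* p)) := (s :* (a :* d)) :* p) refl (A zero j) (sgn j) _ (φ 𝟙))) ⟩
    (∑ λ j → (sgn j * (A zero j * det (deleteColumn j ∘ tail A))) * φ 𝟙)
      ≈⟨ ∑-*ʳ (φ 𝟙) _ ⟨
    (∑ λ j → sgn j * (A zero j * det (deleteColumn j ∘ tail A))) * φ 𝟙
      ≈⟨ *-congʳ (laplace A) ⟨
    det A * φ 𝟙                                  ∎
    where
    cofactor : ∀ j → φ (𝟙 j ∷ tail A) ≈ det (deleteColumn j ∘ tail A) * (sgn j * φ 𝟙)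
    cofactor j = begin
      φ (𝟙 j ∷ tail A)
        ≈⟨ eliminate n j (fix-cong φ-cong (𝟙 j)) (rest (𝟙 j)) (λ B i → vanishes φ-cong alt (𝟙 j) B i) (tail A) ⟩
      φ (𝟙 j ∷ (embed j ∘ deleteColumn j ∘ tail A))
        ≈⟨ alternating-unique n {λ B → φ (𝟙 j ∷ (embed j ∘ B))}
             (λ e → φ-cong (∷-cong (λ _ → refl) λ i → IsLinearMap.cong (embed-linear j) (e i)))
             (pullback n (fix-cong φ-cong (𝟙 j)) (embed-linear j) (rest (𝟙 j))) _ ⟩
      det (deleteColumn j ∘ tail A) * φ (𝟙 j ∷ (embed j ∘ 𝟙))
        ≈⟨ *-congˡ (φ-cong (∷-cong (λ _ → refl) (embed-𝟙 j))) ⟩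
      det (deleteColumn j ∘ tail A) * φ (𝟙 j ∷ (𝟙 ∘ punchIn j))
        ≈⟨ *-congˡ (move-to-front φ-cong alt 𝟙 j) ⟩
      det (deleteColumn j ∘ tail A) * (sgn j * φ 𝟙) ∎

  -- Determinants of products and of perturbations of the identity.

  infixl 7 _⊗_
  _⊗_ : ∀ {l m n} → Rows l m → Rows m n → Rows l n
  (A ⊗ B) i j = ∑ λ k → A i k * B k j

  𝟙-⊗ : ∀ {m n} (B : Rows m n) i → (𝟙 ⊗ B) i ≋ B i
  𝟙-⊗ B zero    j = trans (∑-suc _) (trans (+-cong (*-identityˡ _) (∑-zero λ k → zeroˡ _)) (+-identityʳ _))
  𝟙-⊗ B (suc i) j = trans (∑-suc _) (trans (+-cong (zeroˡ _) (𝟙-⊗ (tail B) i j)) (+-identityˡ _))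

  ⊗-linear : ∀ {m n} (B : Rows m n) → IsLinearMap (λ v j → ∑ λ k → v k * B k j)
  ⊗-linear B = record
    { cong   = λ e j → ∑-cong λ k → *-congʳ (e k)
    ; linear = λ x v w j → begin
        (∑ λ k → (x * v k + w k) * B k j)
          ≈⟨ ∑-cong (λ k → trans (distribʳ _ _ _) (+-congʳ (*-assoc _ _ _))) ⟩
        (∑ λ k → x * (v k * B k j) + w k * B k j)
          ≈⟨ ∑-+ (λ k → x * (v k * B k j)) _ ⟩
        (∑ λ k → x * (v k * B k j)) + (∑ λ k → w k * B k j)
          ≈⟨ +-congʳ (∑-*ˡ x _) ⟨
        x * (∑ λ k → v k * B k j) + (∑ λ k → w k * B k j) ∎ }

  -- For fixed `B` the left side is an alternating form in the rows of `A`, hence a multiple of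
  -- `det A`; the factor is its value at `𝟙`.
  det-⊗ : ∀ {n} (A B : Rows n n) → det (A ⊗ B) ≈ det A * det B
  det-⊗ {n} A B = begin
    det (A ⊗ B)         ≈⟨ alternating-unique n {λ A → det (A ⊗ B)}
                             (λ e → det-cong λ i → IsLinearMap.cong (⊗-linear B) (e i))
                             (pullback n det-cong (⊗-linear B) (det-alternating n)) A ⟩
    det A * det (𝟙 ⊗ B) ≈⟨ *-congˡ (det-cong (𝟙-⊗ B)) ⟩
    det A * det B       ∎

  diag : ∀ {n} → Vec n → Rows n n
  diag v i = v i · 𝟙 i

  det-diag : ∀ {n} (v : Vec n) → det (diag v) ≈ product v
  det-diag {zero}  v = det-empty _
  det-diag {suc n} v = begin
    det (diag v)
      ≈⟨ trans (laplace _) (∑-suc _) ⟩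
    1# * ((v zero * 1#) * det (diag (tail v))) + (∑ λ j → sgn (suc j) * ((v zero * 0#) * det (deleteColumn (suc j) ∘ tail (diag v))))
      ≈⟨ +-cong (solve 2 (λ x d → con 1 :* ((x :* con 1) :* d) := x :* d) refl _ _)
                (∑-zero λ j → solve 3 (λ s x d → s :* ((x :* con 0) :* d) := con 0) refl _ _ _) ⟩
    v zero * det (diag (tail v)) + 0#  ≈⟨ +-identityʳ _ ⟩
    v zero * det (diag (tail v))       ≈⟨ *-congˡ (det-diag (tail v)) ⟩
    product v                          ∎

  det-scale : ∀ {n} u (A : Rows n n) → det (λ i → u · A i) ≈ u ^ n * det A
  det-scale {zero}  u A = trans (det-empty _) (sym (trans (*-identityˡ _) (det-empty A)))
  det-scale {suc n} u A = begin
    det (λ i → u · A i)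
      ≈⟨ laplace _ ⟩
    (∑ λ j → sgn j * ((u * A zero j) * det (λ r → u · deleteColumn j (A (suc r)))))
      ≈⟨ ∑-cong (λ j → trans (*-congˡ (*-congˡ (det-scale u (deleteColumn j ∘ tail A))))
           (solve 5 (λ s u a p d → s :* ((u :* a) :* (p :* d)) := (u :* p) :* (s :* (a :* d))) refl _ _ _ _ _)) ⟩
    (∑ λ j → (u * u ^ n) * (sgn j * (A zero j * det (deleteColumn j ∘ tail A))))
      ≈⟨ ∑-*ˡ _ _ ⟨
    (u * u ^ n) * (∑ λ j → sgn j * (A zero j * det (deleteColumn j ∘ tail A)))
      ≈⟨ *-congˡ (laplace A) ⟨
    u ^ suc n * det A ∎

  tr : ∀ {n} → Rows n n → Carrier
  tr A = ∑ λ i → A i i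

  -- Every term of the expansion meets column 0, either in the entry taken from the first row or
  -- inside the minor, whose column 0 is again divisible by `s`.
  det-divisible-column : ∀ {n} s (A : Rows (suc n) (suc n)) (a : Vec (suc n)) →
                         (∀ i → A i zero ≈ s * a i) → ∃ λ d → det A ≈ s * d
  det-divisible-column {n} s A a A≈sa = minors n A a A≈sa
    where
    minors : ∀ n (A : Rows (suc n) (suc n)) (a : Vec (suc n)) → (∀ i → A i zero ≈ s * a i) → ∃ λ d → det A ≈ s * d
    minors n A a A≈sa = _ , (begin
      det A
        ≈⟨ trans (laplace A) (∑-suc _) ⟩
      1# * (A zero zero * D zero) + (∑ λ j → sgn (suc j) * (A zero (suc j) * D (suc j)))
        ≈⟨ +-cong
             (trans (*-congˡ (*-congʳ (A≈sa zero)))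
               (solve 3 (λ s a d → con 1 :* ((s :* a) :* d) := s :* (a :* d)) refl s (a zero) _))
             (∑-cong λ j → trans (*-congˡ (*-congˡ (proj₂ (rest n A a A≈sa j))))
               (solve 4 (λ g x s d → g :* (x :* (s :* d)) := s :* (g :* (x :* d))) refl (sgn (suc j)) _ s _)) ⟩
      s * (a zero * D zero) + (∑ λ j → s * (sgn (suc j) * (A zero (suc j) * proj₁ (rest n A a A≈sa j))))
        ≈⟨ trans (+-congˡ (sym (∑-*ˡ s _))) (sym (distribˡ s _ _)) ⟩
      s * (a zero * D zero + ∑ λ j → sgn (suc j) * (A zero (suc j) * proj₁ (rest n A a A≈sa j))) ∎)
      where
      D : Fin (suc n) → Carrier
      D j = det (deleteColumn j ∘ tail A)
      -- With `n` generalised, the index `j : Fin n` forces it to be a successor; then deleting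
      -- column `suc j` leaves column 0 in place by computation.
      rest : ∀ n (A : Rows (suc n) (suc n)) (a : Vec (suc n)) → (∀ i → A i zero ≈ s * a i) → (j : Fin n) →
             ∃ λ d → det (deleteColumn (suc j) ∘ tail A) ≈ s * d
      rest (suc n) A a A≈sa j = minors n (deleteColumn (suc j) ∘ tail A) (tail a) (λ i → A≈sa (suc i))

  -- An off-diagonal term of the first row carries one `s` from its own entry and a second from the
  -- first column of its minor, which lies below the diagonal. Only the product along the diagonal
  -- contributes to first order. The remainder is given as a ring element, so no topology or
  -- division is involved.
  det-first-order : ∀ {n} s (X : Rows n n) →
                    ∃ λ q → det (λ i → 𝟙 i ⊕ s · X i) ≈ 1# + s * tr X + s * s * q
  det-first-order {zero}  s X = 0# , (begin
    det (λ i → 𝟙 i ⊕ s · X i)   ≈⟨ det-empty _ ⟩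
    1#                          ≈⟨ solve 1 (λ s → con 1 := con 1 :+ s :* con 0 :+ s :* s :* con 0) refl s ⟩
    1# + s * 0# + s * s * 0#    ≈⟨ +-congʳ (+-congˡ (*-congˡ (∑-empty _))) ⟨
    1# + s * tr X + s * s * 0#  ∎)
  det-first-order {suc n} s X = _ , (begin
    det A
      ≈⟨ trans (laplace A) (∑-suc _) ⟩
    1# * ((1# + s * x) * det (λ i → 𝟙 i ⊕ s · X′ i)) + (∑ λ j → sgn (suc j) * ((0# + s * X zero (suc j)) * det (minor j)))
      ≈⟨ +-cong (*-congˡ (*-congˡ (proj₂ ih)))
           (∑-cong λ j → trans (*-congˡ (*-congˡ (proj₂ (divisible j))))
             (solve 4 (λ g s x d → g :* ((con 0 :+ s :* x) :* (s :* d)) := s :* s :* (g :* (x :* d))) refl (sgn (suc j)) s _ _)) ⟩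
    1# * ((1# + s * x) * (1# + s * tr X′ + s * s * proj₁ ih)) + (∑ λ j → s * s * (sgn (suc j) * (X zero (suc j) * proj₁ (divisible j))))
      ≈⟨ +-congˡ (∑-*ˡ (s * s) _) ⟨
    1# * ((1# + s * x) * (1# + s * tr X′ + s * s * proj₁ ih)) + s * s * rest
      ≈⟨ solve 5 (λ s x t q r → con 1 :* ((con 1 :+ s :* x) :* (con 1 :+ s :* t :+ s :* s :* q)) :+ s :* s :* r
            := con 1 :+ s :* (x :+ t) :+ s :* s :* (q :+ x :* t :+ s :* x :* q :+ r)) refl s x (tr X′) (proj₁ ih) rest ⟩
    1# + s * (x + tr X′) + s * s * (proj₁ ih + x * tr X′ + s * x * proj₁ ih + rest)
      ≈⟨ +-congʳ (+-congˡ (*-congˡ (∑-suc _))) ⟨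
    1# + s * tr X + s * s * (proj₁ ih + x * tr X′ + s * x * proj₁ ih + rest) ∎)
    where
    A = λ i → 𝟙 i ⊕ s · X i
    x = X zero zero
    X′ : Rows n n
    X′ i j = X (suc i) (suc j)
    ih = det-first-order s X′
    minor : Fin n → Rows n n
    minor j = deleteColumn (suc j) ∘ tail A
    minor-divisible : ∀ n (A : Rows (suc n) (suc n)) (a : Vec n) → (∀ i → A (suc i) zero ≈ s * a i) →
                      ∀ j → ∃ λ d → det (deleteColumn (suc j) ∘ tail A) ≈ s * d
    minor-divisible (suc n) A a A≈sa j = det-divisible-column s (deleteColumn (suc j) ∘ tail A) a A≈sa
    divisible : ∀ j → ∃ λ d → det (minor j) ≈ s * d
    divisible = minor-divisible n A (λ i → X (suc i) zero) (λ i → +-identityˡ _)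
    rest = ∑ λ j → sgn (suc j) * (X zero (suc j) * proj₁ (divisible j))

  -- Traces of powers from characteristic polynomials.

  pow : ∀ {n} → Rows n n → ℕ → Rows n n
  pow M zero    = 𝟙
  pow M (suc j) = M ⊗ pow M j

  pow-diag : ∀ {n} (v : Vec n) j i → pow (diag v) j i ≋ (v i ^ j) · 𝟙 i
  pow-diag v zero    i k = sym (*-identityˡ _)
  pow-diag v (suc j) i k = begin
    (∑ λ l → (v i * 𝟙 i l) * pow (diag v) j l k)  ≈⟨ ∑-cong (λ l → *-assoc _ _ _) ⟩
    (∑ λ l → v i * (𝟙 i l * pow (diag v) j l k))  ≈⟨ ∑-*ˡ _ _ ⟨
    v i * (𝟙 ⊗ pow (diag v) j) i k                ≈⟨ *-congˡ (𝟙-⊗ (pow (diag v) j) i k) ⟩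
    v i * pow (diag v) j i k                      ≈⟨ *-congˡ (pow-diag v j i k) ⟩
    v i * (v i ^ j * 𝟙 i k)                       ≈⟨ *-assoc _ _ _ ⟨
    v i ^ suc j * 𝟙 i k                           ∎

  𝟙-diagonal : ∀ {n} (i : Fin n) → 𝟙 i i ≈ 1#
  𝟙-diagonal zero    = refl
  𝟙-diagonal (suc i) = 𝟙-diagonal i

  tr-pow-diag : ∀ {n} (v : Vec n) j → tr (pow (diag v) j) ≈ ∑ λ i → v i ^ j
  tr-pow-diag v j = ∑-cong λ i → trans (pow-diag v j i i) (trans (*-congˡ (𝟙-diagonal i)) (*-identityʳ _))

  -- At `- t` this is the reversed characteristic polynomial det (1 - tM).
  pencil : ∀ {n} → Rows n n → Carrier → Carrier
  pencil M x = det (λ i → 𝟙 i ⊕ x · M i)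

  module _ (t : Carrier) where

    geometric : ∀ {n} → Rows n n → ℕ → Rows n n
    geometric M zero    i j = 0#
    geometric M (suc K) i j = geometric M K i j + t ^ K * pow M K i j

    ⊗-geometric-suc : ∀ {n} (M : Rows n n) K i j →
      (M ⊗ geometric M (suc K)) i j ≈ (M ⊗ geometric M K) i j + t ^ K * pow M (suc K) i j
    ⊗-geometric-suc M K i j = begin
      (∑ λ k → M i k * (geometric M K k j + t ^ K * pow M K k j))
        ≈⟨ ∑-cong (λ k → solve 4 (λ m g p a → m :* (g :+ p :* a) := m :* g :+ p :* (m :* a)) refl _ _ _ _) ⟩
      (∑ λ k → M i k * geometric M K k j + t ^ K * (M i k * pow M K k j))
        ≈⟨ ∑-+ _ _ ⟩
      (M ⊗ geometric M K) i j + (∑ λ k → t ^ K * (M i k * pow M K k j))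
        ≈⟨ +-congˡ (∑-*ˡ _ _) ⟨
      (M ⊗ geometric M K) i j + t ^ K * pow M (suc K) i j ∎

    -- The identity (1 - tM) G = 1 - t^K M^K with its last term brought to the left. The solver
    -- works over commutative semirings, so `- t` enters it as an unrelated atom and `- t + t` is
    -- cancelled by hand.
    geometric-telescope : ∀ {n} (M : Rows n n) K i j →
      geometric M K i j + - t * (M ⊗ geometric M K) i j + t ^ K * pow M K i j ≈ 𝟙 i j
    geometric-telescope M zero    i j = begin
      0# + - t * (M ⊗ geometric M zero) i j + 1# * 𝟙 i j
        ≈⟨ +-congʳ (+-congˡ (*-congˡ (∑-zero λ k → zeroʳ _))) ⟩
      0# + - t * 0# + 1# * 𝟙 i j
        ≈⟨ solve 2 (λ t a → con 0 :+ t :* con 0 :+ con 1 :* a := a) refl _ _ ⟩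
      𝟙 i j ∎
    geometric-telescope M (suc K) i j = begin
      (g + p * a) + - t * (M ⊗ geometric M (suc K)) i j + t * p * b
        ≈⟨ +-congʳ (+-congˡ (*-congˡ (⊗-geometric-suc M K i j))) ⟩
      (g + p * a) + - t * (h + p * b) + t * p * b
        ≈⟨ solve 7 (λ g p a n h b t → (g :+ p :* a) :+ n :* (h :+ p :* b) :+ t :* p :* b
             := (g :+ n :* h :+ p :* a) :+ (n :+ t) :* (p :* b)) refl g p a (- t) h b t ⟩
      (g + - t * h + p * a) + (- t + t) * (p * b)
        ≈⟨ +-cong (geometric-telescope M K i j) (trans (*-congʳ (-‿inverseˡ t)) (zeroˡ _)) ⟩
      𝟙 i j + 0#  ≈⟨ +-identityʳ _ ⟩
      𝟙 i j       ∎
      where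
      g = geometric M K i j
      p = t ^ K
      a = pow M K i j
      b = pow M (suc K) i j
      h = (M ⊗ geometric M K) i j

    ⊗-perturbed-𝟙 : ∀ {n} x (M B : Rows n n) i j →
                    ((λ i → 𝟙 i ⊕ x · M i) ⊗ B) i j ≈ B i j + x * (M ⊗ B) i j
    ⊗-perturbed-𝟙 x M B i j = begin
      (∑ λ k → (𝟙 i k + x * M i k) * B k j)
        ≈⟨ ∑-cong (λ k → trans (distribʳ _ _ _) (+-congˡ (*-assoc _ _ _))) ⟩
      (∑ λ k → 𝟙 i k * B k j + x * (M i k * B k j))
        ≈⟨ ∑-+ _ _ ⟩
      (𝟙 ⊗ B) i j + (∑ λ k → x * (M i k * B k j))
        ≈⟨ +-cong (𝟙-⊗ B i j) (sym (∑-*ˡ x _)) ⟩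
      B i j + x * (M ⊗ B) i j ∎

    pencil-expansion : ∀ {n} (M : Rows n n) K → let r = - (t ^ K) in
      ∃ λ q → pencil M (- t) * det (geometric M K) ≈ 1# + r * tr (pow M K) + r * r * q
    pencil-expansion M K = proj₁ expansion , (begin
      pencil M (- t) * det (geometric M K)
        ≈⟨ det-⊗ _ _ ⟨
      det ((λ i → 𝟙 i ⊕ - t · M i) ⊗ geometric M K)
        ≈⟨ det-cong (λ i j → trans (⊗-perturbed-𝟙 (- t) M (geometric M K) i j) (entry i j)) ⟩
      det (λ i → 𝟙 i ⊕ - (t ^ K) · pow M K i)
        ≈⟨ proj₂ expansion ⟩
      _ ∎)
      where
      expansion = det-first-order (- (t ^ K)) (pow M K)
      entry : ∀ i j → geometric M K i j + - t * (M ⊗ geometric M K) i j ≈ 𝟙 i j + - (t ^ K) * pow M K i j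
      entry i j = begin
        geometric M K i j + - t * (M ⊗ geometric M K) i j
          ≈⟨ trans (+-congˡ (-‿inverseʳ _)) (+-identityʳ _) ⟨
        geometric M K i j + - t * (M ⊗ geometric M K) i j + (t ^ K * pow M K i j + - (t ^ K * pow M K i j))
          ≈⟨ +-assoc _ _ _ ⟨
        geometric M K i j + - t * (M ⊗ geometric M K) i j + t ^ K * pow M K i j + - (t ^ K * pow M K i j)
          ≈⟨ +-cong (geometric-telescope M K i j) (-‿distribˡ-* _ _) ⟩
        𝟙 i j + - (t ^ K) * pow M K i j ∎

    pencil-expansion′ : ∀ {n} (M : Rows n n) K → let r = - (t ^ K) in
      ∃ λ q → pencil M (- t + r) * det (geometric M K) ≈
              1# + r * (tr (pow M K) + tr (M ⊗ geometric M K)) + r * r * q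
    pencil-expansion′ M K = proj₁ expansion , (begin
      pencil M (- t + r) * det (geometric M K)
        ≈⟨ det-⊗ _ _ ⟨
      det ((λ i → 𝟙 i ⊕ (- t + r) · M i) ⊗ geometric M K)
        ≈⟨ det-cong (λ i j → trans (⊗-perturbed-𝟙 (- t + r) M (geometric M K) i j) (entry i j)) ⟩
      det (λ i → 𝟙 i ⊕ r · (pow M K i ⊕ (M ⊗ geometric M K) i))
        ≈⟨ proj₂ expansion ⟩
      1# + r * tr (λ i → pow M K i ⊕ (M ⊗ geometric M K) i) + r * r * proj₁ expansion
        ≈⟨ +-congʳ (+-congˡ (*-congˡ (∑-+ _ _))) ⟩
      _ ∎)
      where
      r = - (t ^ K)
      expansion = det-first-order r (λ i → pow M K i ⊕ (M ⊗ geometric M K) i)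
      entry : ∀ i j → geometric M K i j + (- t + r) * (M ⊗ geometric M K) i j
                    ≈ 𝟙 i j + r * (pow M K i j + (M ⊗ geometric M K) i j)
      entry i j = begin
        g + (- t + r) * h
          ≈⟨ trans (+-congˡ (trans (*-congʳ (-‿inverseʳ (t ^ K))) (zeroˡ a))) (+-identityʳ _) ⟨
        g + (- t + r) * h + (t ^ K + r) * a
          ≈⟨ solve 6 (λ g n r h p a → g :+ (n :+ r) :* h :+ (p :+ r) :* a := (g :+ n :* h :+ p :* a) :+ r :* (a :+ h)) refl
               g (- t) r h (t ^ K) a ⟩
        (g + - t * h + t ^ K * a) + r * (a + h)
          ≈⟨ +-congʳ (geometric-telescope M K i j) ⟩
        𝟙 i j + r * (a + h) ∎
        where
        g = geometric M K i j
        a = pow M K i j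
        h = (M ⊗ geometric M K) i j

    -- Here `e` and `e′` are the two pencil values, common to both matrices, while `g` and `h` are
    -- the determinants of the geometric sums. Both ways of pairing give `e e′ g h`, so none of the
    -- factors has to be invertible. At first order in `r` the two sides contain `τM + τD` alike,
    -- and what is left compares `σM` with `σD`.
    cross-multiply : ∀ {e e′ g h r τM σM qM q′M τD σD qD q′D} →
      e * g ≈ 1# + r * τM + r * r * qM → e′ * g ≈ 1# + r * (τM + σM) + r * r * q′M →
      e * h ≈ 1# + r * τD + r * r * qD → e′ * h ≈ 1# + r * (τD + σD) + r * r * q′D →
      ∃ λ x → ∃ λ y → r * (σM + r * x) ≈ r * (σD + r * y)
    cross-multiply {e} {e′} {g} {h} {r} {τM} {σM} {qM} {q′M} {τD} {σD} {qD} {q′D} eg e′g eh e′h =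
      x , y , +-cancelˡ (1# + r * (τM + τD)) _ _ (begin
        1# + r * (τM + τD) + r * (σM + r * x)
          ≈⟨ expand τM σM q′M τD qD ⟨
        (1# + r * (τM + σM) + r * r * q′M) * (1# + r * τD + r * r * qD)
          ≈⟨ *-cong e′g eh ⟨
        (e′ * g) * (e * h)
          ≈⟨ solve 4 (λ a b c d → (a :* b) :* (c :* d) := (a :* d) :* (c :* b)) refl e′ g e h ⟩
        (e′ * h) * (e * g)
          ≈⟨ *-cong e′h eg ⟩
        (1# + r * (τD + σD) + r * r * q′D) * (1# + r * τM + r * r * qM)
          ≈⟨ expand τD σD q′D τM qM ⟩
        1# + r * (τD + τM) + r * (σD + r * y)
          ≈⟨ +-congʳ (+-congˡ (*-congˡ (+-comm τD τM))) ⟩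
        1# + r * (τM + τD) + r * (σD + r * y) ∎)
      where
      x = q′M + qD + (τM + σM + r * q′M) * (τD + r * qD)
      y = q′D + qM + (τD + σD + r * q′D) * (τM + r * qM)
      factor : ∀ u q → 1# + r * u + r * r * q ≈ 1# + r * (u + r * q)
      factor u q = solve 3 (λ r u q → con 1 :+ r :* u :+ r :* r :* q := con 1 :+ r :* (u :+ r :* q)) refl r u q
      expand : ∀ τ σ q′ τ′ q → (1# + r * (τ + σ) + r * r * q′) * (1# + r * τ′ + r * r * q) ≈
        1# + r * (τ + τ′) + r * (σ + r * (q′ + q + (τ + σ + r * q′) * (τ′ + r * q)))
      expand τ σ q′ τ′ q = begin
        (1# + r * (τ + σ) + r * r * q′) * (1# + r * τ′ + r * r * q)
          ≈⟨ *-cong (factor (τ + σ) q′) (factor τ′ q) ⟩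
        (1# + r * a) * (1# + r * b)
          ≈⟨ solve 3 (λ r a b → (con 1 :+ r :* a) :* (con 1 :+ r :* b) := con 1 :+ r :* (a :+ b :+ r :* (a :* b))) refl r a b ⟩
        1# + r * (τ + σ + r * q′ + (τ′ + r * q) + r * (a * b))
          ≈⟨ +-congˡ (*-congˡ (solve 6 (λ τ σ x τ′ y z → τ :+ σ :+ x :+ (τ′ :+ y) :+ z := (τ :+ τ′) :+ (σ :+ (x :+ y :+ z)))
               refl τ σ (r * q′) τ′ (r * q) (r * (a * b)))) ⟩
        1# + r * ((τ + τ′) + (σ + (r * q′ + r * q + r * (a * b))))
          ≈⟨ +-congˡ (*-congˡ (+-congˡ (+-congˡ (trans (distribˡ r (q′ + q) (a * b)) (+-congʳ (distribˡ r q′ q)))))) ⟨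
        1# + r * ((τ + τ′) + (σ + r * (q′ + q + a * b)))
          ≈⟨ trans (+-congˡ (distribˡ r (τ + τ′) _)) (sym (+-assoc 1# (r * (τ + τ′)) _)) ⟩
        1# + r * (τ + τ′) + r * (σ + r * (q′ + q + a * b)) ∎
        where
        a = τ + σ + r * q′
        b = τ′ + r * q

    -- Multiplying the pencils at -t and -t - t^K by det (geometric M K)
    -- makes both a first-order perturbation of 1; the determinant factor
    -- drops out on cross-multiplying the identities for M and D.
    tr-pow-unique : ∀ {m n} (M : Rows m m) (D : Rows n n) →
      (∀ x y → t * x ≈ t * y → x ≈ y) →
      pencil M (- t) ≈ pencil D (- t) →
      (∀ K → pencil M (- t + - (t ^ K)) ≈ pencil D (- t + - (t ^ K))) →
      (∀ K x y → tr (pow M K) + - t * x ≈ tr (pow D K) + - t * y → tr (pow M K) ≈ tr (pow D K)) →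
      ∀ K → tr (pow M (suc K)) ≈ tr (pow D (suc K))
    tr-pow-unique M D cancel at-t at-t+s rigid = λ K → step K (equal K)
      where
      σM σD : ℕ → Carrier
      σM K = tr (M ⊗ geometric M K)
      σD K = tr (D ⊗ geometric D K)

      cancel-power : ∀ K x y → t ^ K * x ≈ t ^ K * y → x ≈ y
      cancel-power zero    x y e = trans (sym (*-identityˡ x)) (trans e (*-identityˡ y))
      cancel-power (suc K) x y e = cancel-power K x y
        (cancel _ _ (trans (sym (*-assoc _ _ _)) (trans e (*-assoc _ _ _))))

      cancel-neg-power : ∀ K x y → - (t ^ K) * x ≈ - (t ^ K) * y → x ≈ y
      cancel-neg-power K x y e = cancel-power K x y
        (-‿injective (trans (-‿distribˡ-* _ _) (trans e (sym (-‿distribˡ-* _ _)))))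

      -- Cancelling the factor `- (t ^ K)` costs one order: the second-order comparison of
      -- determinants becomes a congruence of the `σ` modulo `t ^ K`.
      congruent : ∀ K → ∃ λ x → ∃ λ y → σM K + - (t ^ K) * x ≈ σD K + - (t ^ K) * y
      congruent K =
        let x , y , e = cross-multiply
                          (proj₂ (pencil-expansion M K)) (proj₂ (pencil-expansion′ M K))
                          (trans (*-congʳ at-t) (proj₂ (pencil-expansion D K)))
                          (trans (*-congʳ (at-t+s K)) (proj₂ (pencil-expansion′ D K)))
        in x , y , cancel-neg-power K _ _ e

      tr-⊗-geometric-suc : ∀ {n} (M : Rows n n) K →
        tr (M ⊗ geometric M (suc K)) ≈ tr (M ⊗ geometric M K) + t ^ K * tr (pow M (suc K))
      tr-⊗-geometric-suc M K = begin
        tr (M ⊗ geometric M (suc K))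
          ≈⟨ ∑-cong (λ i → ⊗-geometric-suc M K i i) ⟩
        ∑ (λ i → (M ⊗ geometric M K) i i + t ^ K * pow M (suc K) i i)
          ≈⟨ ∑-+ _ _ ⟩
        tr (M ⊗ geometric M K) + ∑ (λ i → t ^ K * pow M (suc K) i i)
          ≈⟨ +-congˡ (∑-*ˡ _ _) ⟨
        tr (M ⊗ geometric M K) + t ^ K * tr (pow M (suc K)) ∎

      regroup : ∀ {n} (M : Rows n n) K x → tr (M ⊗ geometric M (suc K)) + - (t ^ suc K) * x ≈
                tr (M ⊗ geometric M K) + t ^ K * (tr (pow M (suc K)) + - t * x)
      regroup M K x = begin
        tr (M ⊗ geometric M (suc K)) + - (t * t ^ K) * x
          ≈⟨ +-cong (tr-⊗-geometric-suc M K) (*-congʳ (-‿distribˡ-* t (t ^ K))) ⟩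
        (tr (M ⊗ geometric M K) + t ^ K * tr (pow M (suc K))) + (- t * t ^ K) * x
          ≈⟨ solve 5 (λ s p a n x → (s :+ p :* a) :+ (n :* p) :* x := s :+ p :* (a :+ n :* x)) refl
               (tr (M ⊗ geometric M K)) (t ^ K) (tr (pow M (suc K))) (- t) x ⟩
        tr (M ⊗ geometric M K) + t ^ K * (tr (pow M (suc K)) + - t * x) ∎

      -- The lower traces already agree exactly, so in the congruence modulo `t ^ suc K` the factor
      -- `t ^ K` can be removed. The next traces then agree modulo `t`, which `rigid` turns into
      -- equality.
      step : ∀ K → σM K ≈ σD K → tr (pow M (suc K)) ≈ tr (pow D (suc K))
      step K σ≈ =
        let x , y , e = congruent (suc K)
        in rigid (suc K) x y (cancel-power K _ _ (+-cancelˡ (σM K) _ _ (begin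
          σM K + t ^ K * (tr (pow M (suc K)) + - t * x)  ≈⟨ regroup M K x ⟨
          σM (suc K) + - (t ^ suc K) * x                 ≈⟨ e ⟩
          σD (suc K) + - (t ^ suc K) * y                 ≈⟨ regroup D K y ⟩
          σD K + t ^ K * (tr (pow D (suc K)) + - t * y)  ≈⟨ +-congʳ σ≈ ⟨
          σM K + t ^ K * (tr (pow D (suc K)) + - t * y)  ∎)))

      equal : ∀ K → σM K ≈ σD K
      equal zero    = trans (∑-zero λ i → ∑-zero λ k → zeroʳ _) (sym (∑-zero λ i → ∑-zero λ k → zeroʳ _))
      equal (suc K) = begin
        σM (suc K)                            ≈⟨ tr-⊗-geometric-suc M K ⟩
        σM K + t ^ K * tr (pow M (suc K))     ≈⟨ +-cong (equal K) (*-congˡ (step K (equal K))) ⟩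
        σD K + t ^ K * tr (pow D (suc K))     ≈⟨ tr-⊗-geometric-suc D K ⟨
        σD (suc K)                            ∎

  module _ {n} (M : Rows n n) (μ : Vec n) (q y : Carrier) (qy≈1 : q * y ≈ 1#) where

    pencil-resolvent : ∀ A → pencil A (- q) ≈ q ^ n * det (λ i j → y * 𝟙 i j + - A i j)
    pencil-resolvent A = trans (det-cong entry) (det-scale {n} q _)
      where
      entry : ∀ i j → 𝟙 i j + - q * A i j ≈ q * (y * 𝟙 i j + - A i j)
      entry i j = begin
        𝟙 i j + - q * A i j               ≈⟨ +-cong (*-identityˡ _) (-‿distribˡ-* q _) ⟨
        1# * 𝟙 i j + - (q * A i j)        ≈⟨ +-cong (*-congʳ (sym qy≈1)) (-‿distribʳ-* q _) ⟩
        q * y * 𝟙 i j + q * - A i j       ≈⟨ +-congʳ (*-assoc q y _) ⟩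
        q * (y * 𝟙 i j) + q * - A i j     ≈⟨ distribˡ q _ _ ⟨
        q * (y * 𝟙 i j + - A i j)         ∎

    -- Since det (1 - qM) = q^n det (1/q - M), the characteristic polynomials are compared only at
    -- the single point `y`; no passage from functions to coefficients is required.
    pencil-unique : det (λ i j → y * 𝟙 i j + - M i j) ≈ product (λ i → y + - μ i) →
                    pencil M (- q) ≈ pencil (diag μ) (- q)
    pencil-unique spectrum = begin
      pencil M (- q)                                 ≈⟨ pencil-resolvent M ⟩
      q ^ n * det (λ i j → y * 𝟙 i j + - M i j)        ≈⟨ *-congˡ spectrum ⟩
      q ^ n * product (λ i → y + - μ i)                ≈⟨ *-congˡ (det-diag _) ⟨
      q ^ n * det (diag (λ i → y + - μ i))
        ≈⟨ *-congˡ (det-cong λ i j → trans (distribʳ _ _ _) (+-congˡ (sym (-‿distribˡ-* _ _)))) ⟩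
      q ^ n * det (λ i j → y * 𝟙 i j + - (diag μ) i j) ≈⟨ pencil-resolvent (diag μ) ⟨
      pencil (diag μ) (- q)                          ∎

  -- Symmetry and row sums of matrix powers.

  𝟙-sym : ∀ {n} (i j : Fin n) → 𝟙 i j ≈ 𝟙 j i
  𝟙-sym zero    zero    = refl
  𝟙-sym zero    (suc j) = refl
  𝟙-sym (suc i) zero    = refl
  𝟙-sym (suc i) (suc j) = 𝟙-sym i j

  𝟙-≡ : ∀ {n} {i j : Fin n} → i ≡ j → 𝟙 i j ≈ 1#
  𝟙-≡ {i = i} ≡.refl = 𝟙-diagonal i

  𝟙-≢ : ∀ {n} {i j : Fin n} → i ≢ j → 𝟙 i j ≈ 0#
  𝟙-≢ {i = zero}  {zero}  i≢j = ⊥-elim (i≢j ≡.refl)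
  𝟙-≢ {i = zero}  {suc j} i≢j = refl
  𝟙-≢ {i = suc i} {zero}  i≢j = refl
  𝟙-≢ {i = suc i} {suc j} i≢j = 𝟙-≢ (i≢j ∘ ≡.cong suc)

  ∑-𝟙 : ∀ {n} (i : Fin n) → ∑ (𝟙 i) ≈ 1#
  ∑-𝟙 i = begin
    ∑ (𝟙 i)               ≈⟨ ∑-cong (λ j → sym (*-identityʳ _)) ⟩
    ∑ (λ j → 𝟙 i j * 1#)  ≈⟨ 𝟙-⊗ {n = 1} (λ _ _ → 1#) i zero ⟩
    1#                    ∎

  ⊗-assoc : ∀ {m n p q} (A : Rows m n) (B : Rows n p) (C : Rows p q) i → (A ⊗ B ⊗ C) i ≋ (A ⊗ (B ⊗ C)) i
  ⊗-assoc A B C i j = begin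
    (∑ λ k → (∑ λ l → A i l * B l k) * C k j)    ≈⟨ ∑-cong (λ k → trans (∑-*ʳ _ _) (∑-cong λ l → *-assoc _ _ _)) ⟩
    (∑ λ k → ∑ λ l → A i l * (B l k * C k j))    ≈⟨ ∑-swap (λ k l → A i l * (B l k * C k j)) ⟩
    (∑ λ l → ∑ λ k → A i l * (B l k * C k j))    ≈⟨ ∑-cong (λ l → ∑-*ˡ _ _) ⟨
    (∑ λ l → A i l * ∑ λ k → B l k * C k j)      ∎

  ⊗-congˡ : ∀ {m n p} (A : Rows m n) {B C : Rows n p} → (∀ i → B i ≋ C i) → ∀ i → (A ⊗ B) i ≋ (A ⊗ C) i
  ⊗-congˡ A B≋C i j = ∑-cong λ k → *-congˡ (B≋C k j)

  pow-+ : ∀ {n} (M : Rows n n) j k i → pow M (j ℕ.+ k) i ≋ (pow M j ⊗ pow M k) i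
  pow-+ M zero    k i l = sym (𝟙-⊗ (pow M k) i l)
  pow-+ M (suc j) k i l = trans (⊗-congˡ M (pow-+ M j k) i l) (sym (⊗-assoc M (pow M j) (pow M k) i l))

  ⊗-𝟙 : ∀ {m n} (A : Rows m n) i → (A ⊗ 𝟙) i ≋ A i
  ⊗-𝟙 A i j = trans (∑-cong λ k → trans (*-comm _ _) (*-congʳ (𝟙-sym k j))) (𝟙-⊗ (λ k _ → A i k) j i)

  pow-suc′ : ∀ {n} (M : Rows n n) k i → pow M (suc k) i ≋ (pow M k ⊗ M) i
  pow-suc′ M zero    i j = trans (⊗-𝟙 M i j) (sym (𝟙-⊗ M i j))
  pow-suc′ M (suc k) i j = trans (⊗-congˡ M (pow-suc′ M k) i j) (sym (⊗-assoc M (pow M k) M i j))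

  pow-symmetric : ∀ {n} (M : Rows n n) → (∀ i j → M i j ≈ M j i) → ∀ k i j → pow M k i j ≈ pow M k j i
  pow-symmetric M M-sym zero    i j = 𝟙-sym i j
  pow-symmetric M M-sym (suc k) i j = begin
    (∑ λ l → M i l * pow M k l j)  ≈⟨ ∑-cong (λ l → trans (*-cong (M-sym i l) (pow-symmetric M M-sym k l j)) (*-comm _ _)) ⟩
    (pow M k ⊗ M) j i              ≈⟨ pow-suc′ M k j i ⟨
    pow M (suc k) j i              ∎

  pow-row-sum : ∀ {n} (M : Rows n n) d → (∀ i → ∑ (M i) ≈ d) → ∀ k i → ∑ (pow M k i) ≈ d ^ k
  pow-row-sum M d regular zero    i = ∑-𝟙 i
  pow-row-sum M d regular (suc k) i = begin
    (∑ λ j → ∑ λ l → M i l * pow M k l j)  ≈⟨ ∑-swap (λ j l → M i l * pow M k l j) ⟩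
    (∑ λ l → ∑ λ j → M i l * pow M k l j)  ≈⟨ ∑-cong (λ l → trans (sym (∑-*ˡ _ _)) (*-congˡ (pow-row-sum M d regular k l))) ⟩
    (∑ λ l → M i l * d ^ k)                ≈⟨ ∑-*ʳ _ _ ⟨
    ∑ (M i) * d ^ k                        ≈⟨ *-congʳ (regular i) ⟩
    d ^ suc k                              ∎

-- Naturality of determinants and traces under ring homomorphisms.

module Homomorphisms {c ℓ c′ ℓ′} (R : CommutativeRing c ℓ) (S : CommutativeRing c′ ℓ′)
  {f : CommutativeRing.Carrier R → CommutativeRing.Carrier S}
  (f-hom : IsRingHomomorphism (CommutativeRing.rawRing R) (CommutativeRing.rawRing S) f) where
  open import Data.Vec.Functional using (tail)
  private
    module R = Determinants R
    module S = Determinants S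
    module f = IsRingHomomorphism f-hom
    open CommutativeRing R using (_+_; _*_; -_; 1#)
  open CommutativeRing S using (_≈_; sym; trans; refl; +-cong; *-cong; *-congʳ; *-congˡ)
  open import Algebra.Definitions.RawSemiring (Semiring.rawSemiring (CommutativeRing.semiring R)) using () renaming (_^_ to _^ᴿ_)
  open import Algebra.Definitions.RawSemiring (Semiring.rawSemiring (CommutativeRing.semiring S)) using () renaming (_^_ to _^ˢ_)

  ^-homo : ∀ x k → f (x ^ᴿ k) ≈ f x ^ˢ k
  ^-homo x zero    = f.1#-homo
  ^-homo x (suc k) = trans (f.*-homo _ _) (*-congˡ (^-homo x k))

  ∑-homo : ∀ {n} (v : R.Vec n) → f (R.∑ v) ≈ S.∑ (f ∘ v)
  ∑-homo {zero}  v = trans (f.⟦⟧-cong (R.∑-empty v)) (trans f.0#-homo (sym (S.∑-empty _)))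
  ∑-homo {suc n} v = trans (f.⟦⟧-cong (R.∑-suc v))
    (trans (f.+-homo _ _) (trans (+-cong refl (∑-homo (v ∘ suc))) (sym (S.∑-suc _))))

  sgn-homo : ∀ {n} (j : Fin n) → f (R.sgn j) ≈ S.sgn j
  sgn-homo {suc n} zero    = f.1#-homo
  sgn-homo {suc n} (suc j) = trans (f.*-homo _ _)
    (*-cong (trans (f.-‿homo _) (CommutativeRing.-‿cong S f.1#-homo)) (sgn-homo j))

  det-homo : ∀ {n} (A : R.Rows n n) → f (R.det A) ≈ S.det (λ i j → f (A i j))
  det-homo {zero}  A = trans (f.⟦⟧-cong (R.det-empty A)) (trans f.1#-homo (sym (S.det-empty _)))
  det-homo {suc n} A = trans (f.⟦⟧-cong (R.laplace A)) (trans (∑-homo _) (trans (S.∑-cong cofactor) (sym (S.laplace _))))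
    where
    cofactor : ∀ j → f (R.sgn j * (A zero j * R.det (R.deleteColumn j ∘ tail A)))
             ≈ CommutativeRing._*_ S (S.sgn j) (CommutativeRing._*_ S (f (A zero j)) (S.det (λ r s → f (A (suc r) (punchIn j s)))))
    cofactor j = trans (f.*-homo _ _)
      (*-cong (sgn-homo j) (trans (f.*-homo _ _) (*-congˡ (det-homo (R.deleteColumn j ∘ tail A)))))

  𝟙-homo : ∀ {n} (i j : Fin n) → f (R.𝟙 i j) ≈ S.𝟙 i j
  𝟙-homo zero    zero    = f.1#-homo
  𝟙-homo zero    (suc j) = f.0#-homo
  𝟙-homo (suc i) zero    = f.0#-homo
  𝟙-homo (suc i) (suc j) = 𝟙-homo i j

  pow-homo : ∀ {n} (M : R.Rows n n) k i j → f (R.pow M k i j) ≈ S.pow (λ i j → f (M i j)) k i j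
  pow-homo M zero    i j = 𝟙-homo i j
  pow-homo M (suc k) i j = trans (∑-homo _)
    (S.∑-cong λ l → trans (f.*-homo _ _) (*-congˡ (pow-homo M k l j)))

  tr-pow-homo : ∀ {n} (M : R.Rows n n) k → f (R.tr (R.pow M k)) ≈ S.tr (S.pow (λ i j → f (M i j)) k)
  tr-pow-homo M k = trans (∑-homo _) (S.∑-cong λ i → pow-homo M k i i)

  pencil-homo : ∀ {n} (M : R.Rows n n) x → f (R.pencil M x) ≈ S.pencil (λ i j → f (M i j)) (f x)
  pencil-homo M x = trans (det-homo _) (S.det-cong λ i j →
    trans (f.+-homo _ _) (+-cong (𝟙-homo i j) (f.*-homo _ _)))

module PetersenSpectrum where
  open import Data.Fin.Subset using () renaming (∣_∣ to card)
  open import Data.List.Base using (_∷_; _++_; tabulate; length; filter)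
  open import Data.Rational.Base using (∣_∣; _+_; _*_; _-_; -_; _/_; _≤_; _<_)
  open ≡ using (refl; sym; trans; cong; cong₂; subst; subst₂; module ≡-Reasoning)

  -- The reals as a commutative ring

  _∧ᵉ_ : ∀ {P Q : ℕ → Set} → Eventually P → Eventually Q → Eventually (λ n → P n × Q n)
  (M , p) ∧ᵉ (N , q) = M ℕ.⊔ N , λ n le →
    p n (ℕ.≤-trans (ℕ.m≤m⊔n M N) le) , q n (ℕ.≤-trans (ℕ.m≤n⊔m M N) le)

  mapᵉ : ∀ {P Q : ℕ → Set} → (∀ n → P n → Q n) → Eventually P → Eventually Q
  mapᵉ f (N , p) = N , λ n le → f n (p n le)

  fraction : ∀ B δ → 0ℚ < B → 0ℚ < δ → ∃[ η ] (0ℚ < η × B * η ≡ δ)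
  fraction B δ 0<B 0<δ = ℚ.1/ B * δ , 0<η ,
    trans (sym (ℚ.*-assoc B (ℚ.1/ B) δ)) (trans (cong (_* δ) (ℚ.*-inverseʳ B)) (ℚ.*-identityˡ δ))
    where
    instance
      B⁺ : ℚ.Positive B
      B⁺ = ℚ.positive 0<B
      B≢0 : ℚ.NonZero B
      B≢0 = ℚ.pos⇒nonZero B
      1/B⁺ : ℚ.Positive (ℚ.1/ B)
      1/B⁺ = ℚ.1/pos⇒pos B
    0<η : 0ℚ < ℚ.1/ B * δ
    0<η = subst (_< ℚ.1/ B * δ) (ℚ.*-zeroʳ (ℚ.1/ B)) (ℚ.*-monoʳ-<-pos (ℚ.1/ B) 0<δ)

  halve : ∀ δ → 0ℚ < δ → ∃[ η ] (0ℚ < η × η + η ≡ δ)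
  halve δ 0<δ =
    let η , 0<η , eq = fraction (1ℚ + 1ℚ) δ (ℚ.positive⁻¹ (1ℚ + 1ℚ)) 0<δ
    in η , 0<η , trans (sym (trans (ℚ.*-distribʳ-+ η 1ℚ 1ℚ) (cong₂ _+_ (ℚ.*-identityˡ η) (ℚ.*-identityˡ η)))) eq

  ≃-pointwise : ∀ {x y} → (∀ n → seq x n ≡ seq y n) → x ≃ y
  ≃-pointwise {x} {y} eq δ 0<δ = 0 , λ n _ →
    subst (_≤ δ) (sym (trans (cong (λ z → ∣ z - seq y n ∣) (eq n)) (cong ∣_∣ (ℚ.+-inverseʳ (seq y n))))) (ℚ.<⇒≤ 0<δ)

  ∣-∣-sym : ∀ p q → ∣ p - q ∣ ≡ ∣ q - p ∣
  ∣-∣-sym p q = trans (sym (ℚ.∣-p∣≡∣p∣ (p - q))) (cong ∣_∣ (solve 2 (λ p q → :- (p :- q) := q :- p) refl p q))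
    where open +-*-Solver

  ∣-∣-triangle : ∀ p q r → ∣ p - r ∣ ≤ ∣ p - q ∣ + ∣ q - r ∣
  ∣-∣-triangle p q r = subst (_≤ ∣ p - q ∣ + ∣ q - r ∣)
    (cong ∣_∣ (solve 3 (λ p q r → (p :- q) :+ (q :- r) := p :- r) refl p q r)) (ℚ.∣p+q∣≤∣p∣+∣q∣ (p - q) (q - r))
    where open +-*-Solver

  ∣-∣-+ : ∀ p q r s → ∣ (p + q) - (r + s) ∣ ≤ ∣ p - r ∣ + ∣ q - s ∣
  ∣-∣-+ p q r s = subst (_≤ ∣ p - r ∣ + ∣ q - s ∣)
    (cong ∣_∣ (solve 4 (λ p q r s → (p :- r) :+ (q :- s) := (p :+ q) :- (r :+ s)) refl p q r s))
    (ℚ.∣p+q∣≤∣p∣+∣q∣ (p - r) (q - s))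
    where open +-*-Solver

  ∣*∣-mono : ∀ p q {B C} → ∣ p ∣ ≤ B → ∣ q ∣ ≤ C → ∣ p * q ∣ ≤ B * C
  ∣*∣-mono p q {B} {C} p≤ q≤ = begin
    ∣ p * q ∣      ≡⟨ ℚ.∣p*q∣≡∣p∣*∣q∣ p q ⟩
    ∣ p ∣ * ∣ q ∣  ≤⟨ ℚ.*-monoʳ-≤-nonNeg ∣ q ∣ {{ℚ.nonNegative (ℚ.0≤∣p∣ q)}} p≤ ⟩
    B * ∣ q ∣      ≤⟨ ℚ.*-monoˡ-≤-nonNeg B {{ℚ.nonNegative (ℚ.≤-trans (ℚ.0≤∣p∣ p) p≤)}} q≤ ⟩
    B * C          ∎
    where open ℚ.≤-Reasoning

  ∣-∣-* : ∀ p q r s {B C η} → ∣ p ∣ ≤ B → ∣ s ∣ ≤ C → ∣ p - r ∣ ≤ η → ∣ q - s ∣ ≤ η →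
          ∣ p * q - r * s ∣ ≤ B * η + C * η
  ∣-∣-* p q r s {B} {C} {η} p≤ s≤ dp dq = begin
    ∣ p * q - r * s ∣                  ≡⟨ cong ∣_∣ (solve 4 (λ p q r s → p :* q :- r :* s := p :* (q :- s) :+ s :* (p :- r)) refl p q r s) ⟩
    ∣ p * (q - s) + s * (p - r) ∣      ≤⟨ ℚ.∣p+q∣≤∣p∣+∣q∣ (p * (q - s)) (s * (p - r)) ⟩
    ∣ p * (q - s) ∣ + ∣ s * (p - r) ∣  ≤⟨ ℚ.+-mono-≤ (∣*∣-mono p (q - s) p≤ dq) (∣*∣-mono s (p - r) s≤ dp) ⟩
    B * η + C * η                      ∎
    where
    open ℚ.≤-Reasoning
    open +-*-Solver

  ≃-refl : ∀ {x} → x ≃ x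
  ≃-refl {x} = ≃-pointwise {x} {x} λ _ → refl

  ≃-sym : ∀ {x y} → x ≃ y → y ≃ x
  ≃-sym {x} {y} x≃y δ 0<δ = mapᵉ (λ n → subst (_≤ δ) (∣-∣-sym (seq x n) (seq y n))) (x≃y δ 0<δ)

  ≃-trans : ∀ {x y z} → x ≃ y → y ≃ z → x ≃ z
  ≃-trans {x} {y} {z} x≃y y≃z δ 0<δ = let η , 0<η , η+η≡δ = halve δ 0<δ in
    mapᵉ (λ n (p , q) → subst (∣ seq x n - seq z n ∣ ≤_) η+η≡δ
           (ℚ.≤-trans (∣-∣-triangle (seq x n) (seq y n) (seq z n)) (ℚ.+-mono-≤ p q)))
      (x≃y η 0<η ∧ᵉ y≃z η 0<η)

  +ᴿ-cong : ∀ {x x′ y y′} → x ≃ x′ → y ≃ y′ → x +ᴿ y ≃ x′ +ᴿ y′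
  +ᴿ-cong {x} {x′} {y} {y′} x≃x′ y≃y′ δ 0<δ = let η , 0<η , η+η≡δ = halve δ 0<δ in
    mapᵉ (λ n (p , q) → subst (∣ (seq x n + seq y n) - (seq x′ n + seq y′ n) ∣ ≤_) η+η≡δ
           (ℚ.≤-trans (∣-∣-+ (seq x n) (seq y n) (seq x′ n) (seq y′ n)) (ℚ.+-mono-≤ p q)))
      (x≃x′ η 0<η ∧ᵉ y≃y′ η 0<η)

  -ᴿ-cong : ∀ {x y} → x ≃ y → -ᴿ x ≃ -ᴿ y
  -ᴿ-cong {x} {y} x≃y δ 0<δ = mapᵉ (λ n → subst (_≤ δ)
    (trans (∣-∣-sym (seq x n) (seq y n)) (cong ∣_∣ (solve 2 (λ p q → q :- p := (:- p) :- (:- q)) refl (seq x n) (seq y n)))))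
    (x≃y δ 0<δ)
    where open +-*-Solver

  *ᴿ-cong : ∀ {x x′ y y′} → x ≃ x′ → y ≃ y′ → x *ᴿ y ≃ x′ *ᴿ y′
  *ᴿ-cong {x} {x′} {y} {y′} x≃x′ y≃y′ δ 0<δ =
    let B , 0<B , Bx = bounded (seq x) (cauchy x)
        C , 0<C , Cy = bounded (seq y′) (cauchy y′)
        η , 0<η , eq = fraction (B + C) δ (ℚ.+-mono-< 0<B 0<C) 0<δ
    in mapᵉ (λ n ((x≤ , y′≤) , (dx , dy)) →
               subst (∣ seq x n * seq y n - seq x′ n * seq y′ n ∣ ≤_) (trans (sym (ℚ.*-distribʳ-+ η B C)) eq)
                 (∣-∣-* (seq x n) (seq y n) (seq x′ n) (seq y′ n) x≤ y′≤ dx dy))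
         ((Bx ∧ᵉ Cy) ∧ᵉ (x≃x′ η 0<η ∧ᵉ y≃y′ η 0<η))

  ℝ-isCommutativeRing : IsCommutativeRing _≃_ _+ᴿ_ _*ᴿ_ -ᴿ_ 0ᴿ 1ᴿ
  ℝ-isCommutativeRing = record
    { isRing = record
      { +-isAbelianGroup = record
        { isGroup = record
          { isMonoid = record
            { isSemigroup = record
              { isMagma = record
                { isEquivalence = record
                  { refl  = λ {x} → ≃-refl {x}
                  ; sym   = λ {x} {y} → ≃-sym {x} {y}
                  ; trans = λ {x} {y} {z} → ≃-trans {x} {y} {z}
                  }
                ; ∙-cong = λ {x} {x′} {y} {y′} → +ᴿ-cong {x} {x′} {y} {y′}
                }
              ; assoc = λ x y z → ≃-pointwise {(x +ᴿ y) +ᴿ z} {x +ᴿ (y +ᴿ z)} λ n → ℚ.+-assoc (seq x n) (seq y n) (seq z n)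
              }
            ; identity = (λ x → ≃-pointwise {0ᴿ +ᴿ x} {x} λ n → ℚ.+-identityˡ (seq x n))
                       , (λ x → ≃-pointwise {x +ᴿ 0ᴿ} {x} λ n → ℚ.+-identityʳ (seq x n))
            }
          ; inverse = (λ x → ≃-pointwise {(-ᴿ x) +ᴿ x} {0ᴿ} λ n → ℚ.+-inverseˡ (seq x n))
                    , (λ x → ≃-pointwise {x +ᴿ (-ᴿ x)} {0ᴿ} λ n → ℚ.+-inverseʳ (seq x n))
          ; ⁻¹-cong = λ {x} {y} → -ᴿ-cong {x} {y}
          }
        ; comm = λ x y → ≃-pointwise {x +ᴿ y} {y +ᴿ x} λ n → ℚ.+-comm (seq x n) (seq y n)
        }
      ; *-cong = λ {x} {x′} {y} {y′} → *ᴿ-cong {x} {x′} {y} {y′}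
      ; *-assoc = λ x y z → ≃-pointwise {(x *ᴿ y) *ᴿ z} {x *ᴿ (y *ᴿ z)} λ n → ℚ.*-assoc (seq x n) (seq y n) (seq z n)
      ; *-identity = (λ x → ≃-pointwise {1ᴿ *ᴿ x} {x} λ n → ℚ.*-identityˡ (seq x n))
                   , (λ x → ≃-pointwise {x *ᴿ 1ᴿ} {x} λ n → ℚ.*-identityʳ (seq x n))
      ; distrib = (λ x y z → ≃-pointwise {x *ᴿ (y +ᴿ z)} {(x *ᴿ y) +ᴿ (x *ᴿ z)} λ n → ℚ.*-distribˡ-+ (seq x n) (seq y n) (seq z n))
                , (λ x y z → ≃-pointwise {(y +ᴿ z) *ᴿ x} {(y *ᴿ x) +ᴿ (z *ᴿ x)} λ n → ℚ.*-distribʳ-+ (seq x n) (seq y n) (seq z n))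
      }
    ; *-comm = λ x y → ≃-pointwise {x *ᴿ y} {y *ᴿ x} λ n → ℚ.*-comm (seq x n) (seq y n)
    }

  ℝ-commutativeRing : CommutativeRing 0ℓ 0ℓ
  ℝ-commutativeRing = record { isCommutativeRing = ℝ-isCommutativeRing }

  -- Bounded sequences of reals, playing the role of functions of t = 1 / (m + 1)
  -- near t = 0.
  record 𝔹 : Set where
    constructor mk𝔹
    field
      at      : ℕ → ℝ
      -- The bound is uniform in `m`, which makes t x tend to 0; only the index from which it holds
      -- may depend on `m`.
      bound   : ℚ
      at≤bound : ∀ m → Eventually λ n → ∣ seq (at m) n ∣ ≤ bound

  open 𝔹

  infix 4 _≈ᴮ_
  _≈ᴮ_ : 𝔹 → 𝔹 → Set
  x ≈ᴮ y = ∀ m → at x m ≃ at y m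

  infixl 6 _+ᴮ_
  infixl 7 _*ᴮ_
  infix  8 -ᴮ_

  _+ᴮ_ _*ᴮ_ : 𝔹 → 𝔹 → 𝔹
  x +ᴮ y = mk𝔹 (λ m → at x m +ᴿ at y m) (bound x + bound y) λ m →
    mapᵉ (λ n (p , q) → ℚ.≤-trans (ℚ.∣p+q∣≤∣p∣+∣q∣ (seq (at x m) n) (seq (at y m) n)) (ℚ.+-mono-≤ p q))
      (at≤bound x m ∧ᵉ at≤bound y m)
  x *ᴮ y = mk𝔹 (λ m → at x m *ᴿ at y m) (bound x * bound y) λ m →
    mapᵉ (λ n (p , q) → ∣*∣-mono (seq (at x m) n) (seq (at y m) n) p q) (at≤bound x m ∧ᵉ at≤bound y m)

  -ᴮ_ : 𝔹 → 𝔹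
  -ᴮ x = mk𝔹 (λ m → -ᴿ at x m) (bound x) λ m →
    mapᵉ (λ n → subst (_≤ bound x) (sym (ℚ.∣-p∣≡∣p∣ (seq (at x m) n)))) (at≤bound x m)

  constantᴮ : ℝ → 𝔹
  constantᴮ x = let B , _ , x≤B = bounded (seq x) (cauchy x) in mk𝔹 (λ _ → x) B λ _ → x≤B

  fromℚᴮ : ℚ → 𝔹
  fromℚᴮ q = mk𝔹 (λ _ → fromℚ q) ∣ q ∣ λ _ → 0 , λ _ _ → ℚ.≤-refl

  𝔹-commutativeRing : CommutativeRing 0ℓ 0ℓ
  𝔹-commutativeRing = record
    { _≈_ = _≈ᴮ_ ; _+_ = _+ᴮ_ ; _*_ = _*ᴮ_ ; -_ = -ᴮ_ ; 0# = fromℚᴮ 0ℚ ; 1# = fromℚᴮ 1ℚ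
    ; isCommutativeRing = record
      { isRing = record
        { +-isAbelianGroup = record
          { isGroup = record
            { isMonoid = record
              { isSemigroup = record
                { isMagma = record
                  { isEquivalence = record
                    { refl  = λ {x} m → R.refl {at x m}
                    ; sym   = λ {x} {y} e m → R.sym {at x m} {at y m} (e m)
                    ; trans = λ {x} {y} {z} e f m → R.trans {at x m} {at y m} {at z m} (e m) (f m)
                    }
                  ; ∙-cong = λ {x} {x′} {y} {y′} e f m → R.+-cong {at x m} {at x′ m} {at y m} {at y′ m} (e m) (f m)
                  }
                ; assoc = λ x y z m → R.+-assoc (at x m) (at y m) (at z m)
                }
              ; identity = (λ x m → R.+-identityˡ (at x m)) , (λ x m → R.+-identityʳ (at x m))
              }
            ; inverse = (λ x m → R.-‿inverseˡ (at x m)) , (λ x m → R.-‿inverseʳ (at x m))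
            ; ⁻¹-cong = λ {x} {y} e m → R.-‿cong {at x m} {at y m} (e m)
            }
          ; comm = λ x y m → R.+-comm (at x m) (at y m)
          }
        ; *-cong = λ {x} {x′} {y} {y′} e f m → R.*-cong {at x m} {at x′ m} {at y m} {at y′ m} (e m) (f m)
        ; *-assoc = λ x y z m → R.*-assoc (at x m) (at y m) (at z m)
        ; *-identity = (λ x m → R.*-identityˡ (at x m)) , (λ x m → R.*-identityʳ (at x m))
        ; distrib = (λ x y z m → R.distribˡ (at x m) (at y m) (at z m)) , (λ x y z m → R.distribʳ (at x m) (at y m) (at z m))
        }
      ; *-comm = λ x y m → R.*-comm (at x m) (at y m)
      }
    }
    where module R = CommutativeRing ℝ-commutativeRing

  module ℝR = CommutativeRing ℝ-commutativeRing
  module 𝔹R = CommutativeRing 𝔹-commutativeRing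
  module Dᴿ = Determinants ℝ-commutativeRing
  module Dᴮ = Determinants 𝔹-commutativeRing
  module ℚM = Determinants ℚ.+-*-commutativeRing
  open ℚM using (∑; 𝟙; tr; pow)
  open RawSemiringDefs (RawRing.rawSemiring ℝ-rawRing) using (product; sum) renaming (_^_ to _^ᴿ_)
  open RawSemiringDefs (Semiring.rawSemiring 𝔹R.semiring) using () renaming (_^_ to _^ᴮ_)
  open RawSemiringDefs (Semiring.rawSemiring (CommutativeRing.semiring ℚ.+-*-commutativeRing)) using () renaming (_^_ to _^ℚ_)

  -- Power sums of the roots of a characteristic polynomial

  opaque
    -- Opaque, so that values such as `ι 225` are not unfolded into normalised fractions during type
    -- checking.
    ι : ℕ → ℚ
    ι n = ℤ.+ n / 1

    ι-+ : ∀ m n → ι (m ℕ.+ n) ≡ ι m + ι n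
    ι-+ m n = ℚ.toℚᵘ-injective (begin
      ℚ.toℚᵘ (ι (m ℕ.+ n))                    ≈⟨ ℚ.toℚᵘ-fromℚᵘ (ℚᵘ.mkℚᵘ (ℤ.+ (m ℕ.+ n)) 0) ⟩
      ℚᵘ.mkℚᵘ (ℤ.+ (m ℕ.+ n)) 0                 ≈⟨ ℚᵘ.*≡* (cong (ℤ._* ℤ.+ 1) (cong₂ ℤ._+_ (sym (ℤ.*-identityʳ (ℤ.+ m))) (sym (ℤ.*-identityʳ (ℤ.+ n))))) ⟩
      ℚᵘ.mkℚᵘ (ℤ.+ m) 0 ℚᵘ.+ ℚᵘ.mkℚᵘ (ℤ.+ n) 0    ≈⟨ ℚᵘ.+-cong (ℚ.toℚᵘ-fromℚᵘ (ℚᵘ.mkℚᵘ (ℤ.+ m) 0)) (ℚ.toℚᵘ-fromℚᵘ (ℚᵘ.mkℚᵘ (ℤ.+ n) 0)) ⟨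
      ℚ.toℚᵘ (ι m) ℚᵘ.+ ℚ.toℚᵘ (ι n)          ≈⟨ ℚ.toℚᵘ-homo-+ (ι m) (ι n) ⟨
      ℚ.toℚᵘ (ι m + ι n)                      ∎)
      where open ℚᵘ.≃-Reasoning

    ι-0 : ι 0 ≡ 0ℚ
    ι-0 = refl

    ι-1 : ι 1 ≡ 1ℚ
    ι-1 = refl

    fromℕ≡ι : ∀ n → ℤ.+ n / 1 ≡ ι n
    fromℕ≡ι n = refl

    0≤ι : ∀ n → 0ℚ ≤ ι n
    0≤ι n = ℚ.nonNegative⁻¹ (ι n) {{ℚ.normalize-nonNeg n 1}}

    0<ι-suc : ∀ n → 0ℚ < ι (suc n)
    0<ι-suc n = ℚ.positive⁻¹ (ι (suc n)) {{ℚ.normalize-pos (suc n) 1}}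

    archimedean : ∀ p → ∃[ n ] p ≤ ι n
    archimedean p@(ℚ.mkℚ (ℤ.+ a) d _) = a , ℚ.toℚᵘ-cancel-≤ (ℚᵘ.≤-respʳ-≃
      (ℚᵘ.≃-sym (ℚ.toℚᵘ-fromℚᵘ (ℚᵘ.mkℚᵘ (ℤ.+ a) 0)))
      (ℚᵘ.*≤* (ℤ.*-monoˡ-≤-nonNeg (ℤ.+ a) (ℤ.+≤+ (ℕ.s≤s ℕ.z≤n)))))
    archimedean p@(ℚ.mkℚ -[1+ a ] d _) = 0 , ℚ.<⇒≤ (ℚ.negative⁻¹ p)

  ι-* : ∀ m n → ι (m ℕ.* n) ≡ ι m * ι n
  ι-* zero    n = trans ι-0 (sym (trans (cong (_* ι n) ι-0) (ℚ.*-zeroˡ (ι n))))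
  ι-* (suc m) n = begin
    ι (n ℕ.+ m ℕ.* n)  ≡⟨ ι-+ n (m ℕ.* n) ⟩
    ι n + ι (m ℕ.* n)  ≡⟨ cong (ι n +_) (ι-* m n) ⟩
    ι n + ι m * ι n    ≡⟨ solve 2 (λ m n → n :+ m :* n := (con 1ℚ :+ m) :* n) refl (ι m) (ι n) ⟩
    (1ℚ + ι m) * ι n   ≡⟨ cong (_* ι n) (trans (ι-+ 1 m) (cong (_+ ι m) ι-1)) ⟨
    ι (suc m) * ι n    ∎
    where
    open ≡-Reasoning
    open +-*-Solver

  ι-mono : ∀ {m n} → m ℕ.≤ n → ι m ≤ ι n
  ι-mono {m} {n} m≤n = begin
    ι m                    ≡⟨ ℚ.+-identityʳ (ι m) ⟨
    ι m + 0ℚ               ≤⟨ ℚ.+-monoʳ-≤ (ι m) (0≤ι (n ℕ.∸ m)) ⟩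
    ι m + ι (n ℕ.∸ m)      ≡⟨ ι-+ m (n ℕ.∸ m) ⟨
    ι (m ℕ.+ (n ℕ.∸ m))    ≡⟨ cong ι (ℕ.m+[n∸m]≡n m≤n) ⟩
    ι n                    ∎
    where open ℚ.≤-Reasoning

  opaque
    inv : ℕ → ℚ
    inv m = proj₁ (fraction (ι (suc m)) 1ℚ (0<ι-suc m) (ℚ.positive⁻¹ 1ℚ))

    0<inv : ∀ m → 0ℚ < inv m
    0<inv m = proj₁ (proj₂ (fraction (ι (suc m)) 1ℚ (0<ι-suc m) (ℚ.positive⁻¹ 1ℚ)))

    ι*inv : ∀ m → ι (suc m) * inv m ≡ 1ℚ
    ι*inv m = proj₂ (proj₂ (fraction (ι (suc m)) 1ℚ (0<ι-suc m) (ℚ.positive⁻¹ 1ℚ)))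

  *-mono-≤ˡ : ∀ {p q} r → 0ℚ ≤ r → p ≤ q → r * p ≤ r * q
  *-mono-≤ˡ r 0≤r p≤q = ℚ.*-monoˡ-≤-nonNeg r {{ℚ.nonNegative 0≤r}} p≤q

  *-mono-≤ʳ : ∀ {p q} r → 0ℚ ≤ r → p ≤ q → p * r ≤ q * r
  *-mono-≤ʳ r 0≤r p≤q = ℚ.*-monoʳ-≤-nonNeg r {{ℚ.nonNegative 0≤r}} p≤q

  inv≤1 : ∀ m → inv m ≤ 1ℚ
  inv≤1 m = begin
    inv m              ≡⟨ trans (cong (_* inv m) ι-1) (ℚ.*-identityˡ (inv m)) ⟨
    ι 1 * inv m        ≤⟨ *-mono-≤ʳ (inv m) (ℚ.<⇒≤ (0<inv m)) (ι-mono (ℕ.s≤s ℕ.z≤n)) ⟩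
    ι (suc m) * inv m  ≡⟨ ι*inv m ⟩
    1ℚ                 ∎
    where open ℚ.≤-Reasoning

  inv-small : ∀ B η → 0ℚ < η → ∃[ m ] B * inv m ≤ η
  inv-small B η 0<η =
    let η⁻¹ , _ , ηη⁻¹≡1 = fraction η 1ℚ 0<η (ℚ.positive⁻¹ 1ℚ)
        m , B/η≤m = archimedean (B * η⁻¹)
    in m , scaled η⁻¹ ηη⁻¹≡1 m B/η≤m
    where
    open ℚ.≤-Reasoning
    open +-*-Solver
    scaled : ∀ η⁻¹ → η * η⁻¹ ≡ 1ℚ → ∀ m → B * η⁻¹ ≤ ι m → B * inv m ≤ η
    scaled η⁻¹ ηη⁻¹≡1 m B/η≤m = begin
      B * inv m                     ≡⟨ cong (_* inv m) (trans (sym (ℚ.*-identityʳ B)) (cong (B *_) (sym ηη⁻¹≡1))) ⟩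
      B * (η * η⁻¹) * inv m         ≡⟨ solve 4 (λ b e f i → b :* (e :* f) :* i := e :* (b :* f :* i)) refl B η η⁻¹ (inv m) ⟩
      η * (B * η⁻¹ * inv m)         ≤⟨ *-mono-≤ˡ η (ℚ.<⇒≤ 0<η) (*-mono-≤ʳ (inv m) (ℚ.<⇒≤ (0<inv m)) (ℚ.≤-trans B/η≤m (ι-mono (ℕ.n≤1+n m)))) ⟩
      η * (ι (suc m) * inv m)       ≡⟨ cong (η *_) (ι*inv m) ⟩
      η * 1ℚ                        ≡⟨ ℚ.*-identityʳ η ⟩
      η                             ∎

  tᴮ : 𝔹
  tᴮ = mk𝔹 (λ m → fromℚ (inv m)) 1ℚ λ m → 0 , λ n _ →
    subst (_≤ 1ℚ) (sym (ℚ.0≤p⇒∣p∣≡p (ℚ.<⇒≤ (0<inv m)))) (inv≤1 m)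

  -- Each value of t is inverted by `suc m`. These inverses are unbounded, so t is cancellable
  -- without being a unit of `𝔹`.
  tᴮ-cancel : ∀ x y → tᴮ *ᴮ x ≈ᴮ tᴮ *ᴮ y → x ≈ᴮ y
  tᴮ-cancel x y tx≈ty m = ≃-trans {at x m} {c *ᴿ (τ *ᴿ at x m)} {at y m} (undo (at x m))
    (≃-trans {c *ᴿ (τ *ᴿ at x m)} {c *ᴿ (τ *ᴿ at y m)} {at y m}
      (*ᴿ-cong {c} {c} {τ *ᴿ at x m} {τ *ᴿ at y m} (≃-refl {c}) (tx≈ty m))
      (≃-sym {at y m} {c *ᴿ (τ *ᴿ at y m)} (undo (at y m))))
    where
    c τ : ℝ
    c = fromℚ (ι (suc m))
    τ = fromℚ (inv m)
    undo : ∀ z → z ≃ c *ᴿ (τ *ᴿ z)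
    undo z = ≃-pointwise {z} {c *ᴿ (τ *ᴿ z)} λ n →
      trans (sym (ℚ.*-identityˡ (seq z n))) (trans (cong (_* seq z n) (sym (ι*inv m))) (ℚ.*-assoc (ι (suc m)) (inv m) (seq z n)))

  -- The distance of the constants `a` and `b` is at most the sum of the two bounds divided by m +
  -- 1, up to the error allowed in the hypothesis; a single large `m` therefore serves for a given
  -- `δ`.
  tᴮ-rigid : ∀ a b (x y : 𝔹) →
    (∀ m → a +ᴿ (-ᴿ fromℚ (inv m)) *ᴿ at x m ≃ b +ᴿ (-ᴿ fromℚ (inv m)) *ᴿ at y m) → a ≃ b
  tᴮ-rigid a b x y e δ 0<δ =
    let η , 0<η , η+η≡δ = halve δ 0<δ
        m , small = inv-small (bound x + bound y) η 0<η
    in mapᵉ (λ n (d , (x≤ , y≤)) → subst (∣ seq a n - seq b n ∣ ≤_) η+η≡δ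
               (close (seq a n) (seq b n) (seq (at x m) n) (seq (at y m) n) (inv m) (ℚ.<⇒≤ (0<inv m)) small d x≤ y≤))
         (e m η 0<η ∧ᵉ (at≤bound x m ∧ᵉ at≤bound y m))
    where
    close : ∀ p q r s i {B C η} → 0ℚ ≤ i → (B + C) * i ≤ η → ∣ (p + (- i) * r) - (q + (- i) * s) ∣ ≤ η →
            ∣ r ∣ ≤ B → ∣ s ∣ ≤ C → ∣ p - q ∣ ≤ η + η
    close p q r s i {B} {C} {η} 0≤i small d r≤ s≤ = begin
      ∣ p - q ∣                                             ≡⟨ cong ∣_∣ (solve 5 (λ p q i r s → p :- q := ((p :+ (:- i) :* r) :- (q :+ (:- i) :* s)) :+ (r :- s) :* i) refl p q i r s) ⟩
      ∣ ((p + (- i) * r) - (q + (- i) * s)) + (r - s) * i ∣   ≤⟨ ℚ.∣p+q∣≤∣p∣+∣q∣ ((p + (- i) * r) - (q + (- i) * s)) ((r - s) * i) ⟩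
      ∣ (p + (- i) * r) - (q + (- i) * s) ∣ + ∣ (r - s) * i ∣ ≤⟨ ℚ.+-mono-≤ d (∣*∣-mono (r - s) i r-s≤ (ℚ.≤-reflexive (ℚ.0≤p⇒∣p∣≡p 0≤i))) ⟩
      η + (B + C) * i                                         ≤⟨ ℚ.+-monoʳ-≤ η small ⟩
      η + η                                                   ∎
      where
      open ℚ.≤-Reasoning
      open +-*-Solver
      r-s≤ : ∣ r - s ∣ ≤ B + C
      r-s≤ = ℚ.≤-trans (ℚ.∣p+q∣≤∣p∣+∣q∣ r (- s)) (ℚ.+-mono-≤ r≤ (subst (_≤ C) (sym (ℚ.∣-p∣≡∣p∣ s)) s≤))

  at-hom : ∀ m → IsRingHomomorphism 𝔹R.rawRing ℝR.rawRing (λ x → at x m)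
  at-hom m = record
    { isSemiringHomomorphism = record
      { isNearSemiringHomomorphism = record
        { +-isMonoidHomomorphism = record
          { isMagmaHomomorphism = record
            { isRelHomomorphism = record { cong = λ e → e m }
            ; homo = λ x y → ≃-refl {at x m +ᴿ at y m}
            }
          ; ε-homo = ≃-refl {0ᴿ}
          }
        ; *-homo = λ x y → ≃-refl {at x m *ᴿ at y m}
        }
      ; 1#-homo = ≃-refl {1ᴿ}
      }
    ; -‿homo = λ x → ≃-refl { -ᴿ at x m}
    }

  seq-^ : ∀ x k n → seq (x ^ᴿ k) n ≡ seq x n ^ℚ k
  seq-^ x zero    n = refl
  seq-^ x (suc k) n = cong (seq x n *_) (seq-^ x k n)

  0<^ : ∀ {p} k → 0ℚ < p → 0ℚ < p ^ℚ k
  0<^     zero    0<p = ℚ.positive⁻¹ 1ℚ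
  0<^ {p} (suc k) 0<p = ℚ.positive⁻¹ _ {{ℚ.pos*pos⇒pos p {{ℚ.positive 0<p}} (p ^ℚ k) {{ℚ.positive (0<^ k 0<p)}}}}

  module _ {N} (M : Matrix ℝ N) (μ : Fin N → ℝ)
    (spectrum : ∀ y → Dᴿ.det (λ i j → y *ᴿ Dᴿ.𝟙 i j +ᴿ (-ᴿ M i j)) ≃ product (λ i → y +ᴿ (-ᴿ μ i))) where

    private
      Mᴮ : Matrix 𝔹 N
      Mᴮ i j = constantᴮ (M i j)

      Dᴮ′ : Matrix 𝔹 N
      Dᴮ′ = Dᴮ.diag (λ i → constantᴮ (μ i))

      module at m = Homomorphisms 𝔹-commutativeRing ℝ-commutativeRing (at-hom m)

      invertible : ∀ q → (∃[ ρ ] (0ℚ < ρ × ∀ n → seq q n ≡ ρ)) → ∃[ y ] q *ᴿ y ≃ 1ᴿ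
      invertible q (ρ , 0<ρ , q≡ρ) = let y , _ , eq = fraction ρ 1ℚ 0<ρ (ℚ.positive⁻¹ 1ℚ) in
        fromℚ y , ≃-pointwise {q *ᴿ fromℚ y} {1ᴿ} λ n → trans (cong (_* y) (q≡ρ n)) eq

      at-diag : ∀ m i j → at (Dᴮ′ i j) m ≃ Dᴿ.diag μ i j
      at-diag m i j = *ᴿ-cong {μ i} {μ i} {at (Dᴮ.𝟙 i j) m} {Dᴿ.𝟙 i j} (≃-refl {μ i}) (at.𝟙-homo m i j)

      pencil-cong : ∀ (A B : Matrix ℝ N) x x′ → (∀ i j → A i j ≃ B i j) → x ≃ x′ → Dᴿ.pencil A x ≃ Dᴿ.pencil B x′
      pencil-cong A B x x′ A≃B x≃x′ = Dᴿ.det-cong λ i j →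
        +ᴿ-cong {Dᴿ.𝟙 i j} {Dᴿ.𝟙 i j} {x *ᴿ A i j} {x′ *ᴿ B i j} (≃-refl {Dᴿ.𝟙 i j})
          (*ᴿ-cong {x} {x′} {A i j} {B i j} x≃x′ (A≃B i j))

      -- A separate point y = 1/q is used at each index `m`. Asking that `q m` be a constant
      -- positive rational sequence makes its inverse immediate.
      pencils-agree : ∀ (x : 𝔹) (q : ℕ → ℝ) → (∀ m → at x m ≃ -ᴿ q m) → (∀ m → ∃[ ρ ] (0ℚ < ρ × ∀ n → seq (q m) n ≡ ρ)) →
                      Dᴮ.pencil Mᴮ x ≈ᴮ Dᴮ.pencil Dᴮ′ x
      pencils-agree x q x≃-q q-pos m = let y , qy≃1 = invertible (q m) (q-pos m) in
        ℝR.trans {at (Dᴮ.pencil Mᴮ x) m} {Dᴿ.pencil M (-ᴿ q m)} {at (Dᴮ.pencil Dᴮ′ x) m}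
          (ℝR.trans {at (Dᴮ.pencil Mᴮ x) m} {Dᴿ.pencil M (at x m)} {Dᴿ.pencil M (-ᴿ q m)}
            (at.pencil-homo m Mᴮ x)
            (pencil-cong M M (at x m) (-ᴿ q m) (λ i j → ≃-refl {M i j}) (x≃-q m)))
          (ℝR.trans {Dᴿ.pencil M (-ᴿ q m)} {Dᴿ.pencil (Dᴿ.diag μ) (-ᴿ q m)} {at (Dᴮ.pencil Dᴮ′ x) m}
            (Dᴿ.pencil-unique M μ (q m) y qy≃1 (spectrum y))
            (ℝR.sym {at (Dᴮ.pencil Dᴮ′ x) m} {Dᴿ.pencil (Dᴿ.diag μ) (-ᴿ q m)}
              (ℝR.trans {at (Dᴮ.pencil Dᴮ′ x) m} {Dᴿ.pencil (λ i j → at (Dᴮ′ i j) m) (at x m)} {Dᴿ.pencil (Dᴿ.diag μ) (-ᴿ q m)}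
                (at.pencil-homo m Dᴮ′ x)
                (pencil-cong (λ i j → at (Dᴮ′ i j) m) (Dᴿ.diag μ) (at x m) (-ᴿ q m) (at-diag m) (x≃-q m)))))

      tr-M : ∀ m K → at (Dᴮ.tr (Dᴮ.pow Mᴮ K)) m ≃ Dᴿ.tr (Dᴿ.pow M K)
      tr-M m K = at.tr-pow-homo m Mᴮ K

      tr-D : ∀ m K → at (Dᴮ.tr (Dᴮ.pow Dᴮ′ K)) m ≃ Dᴿ.∑ (λ i → μ i ^ᴿ K)
      tr-D m K = ℝR.trans {at (Dᴮ.tr (Dᴮ.pow Dᴮ′ K)) m} {at (Dᴮ.∑ (λ i → constantᴮ (μ i) ^ᴮ K)) m} {Dᴿ.∑ (λ i → μ i ^ᴿ K)}
        (Dᴮ.tr-pow-diag (λ i → constantᴮ (μ i)) K m)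
        (ℝR.trans {at (Dᴮ.∑ (λ i → constantᴮ (μ i) ^ᴮ K)) m} {Dᴿ.∑ (λ i → at (constantᴮ (μ i) ^ᴮ K) m)} {Dᴿ.∑ (λ i → μ i ^ᴿ K)}
          (at.∑-homo m (λ i → constantᴮ (μ i) ^ᴮ K))
          (Dᴿ.∑-cong λ i → at.^-homo m (constantᴮ (μ i)) K))

    power-sums : ∀ K → Dᴿ.tr (Dᴿ.pow M (suc K)) ≃ Dᴿ.∑ (λ i → μ i ^ᴿ suc K)
    power-sums K = ℝR.trans {trM} {at trMᴮ 0} {∑D}
        (ℝR.sym {at trMᴮ 0} {trM} (tr-M 0 (suc K)))
        -- Both traces come from constant sequences, so any index may be read off.
        (ℝR.trans {at trMᴮ 0} {at trDᴮ 0} {∑D} (traces 0) (tr-D 0 (suc K)))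
      where
      trM = Dᴿ.tr (Dᴿ.pow M (suc K))
      ∑D = Dᴿ.∑ (λ i → μ i ^ᴿ suc K)
      trMᴮ = Dᴮ.tr (Dᴮ.pow Mᴮ (suc K))
      trDᴮ = Dᴮ.tr (Dᴮ.pow Dᴮ′ (suc K))

      rigid : ∀ K (x y : 𝔹) → Dᴮ.tr (Dᴮ.pow Mᴮ K) +ᴮ (-ᴮ tᴮ) *ᴮ x ≈ᴮ Dᴮ.tr (Dᴮ.pow Dᴮ′ K) +ᴮ (-ᴮ tᴮ) *ᴮ y →
              Dᴮ.tr (Dᴮ.pow Mᴮ K) ≈ᴮ Dᴮ.tr (Dᴮ.pow Dᴮ′ K)
      rigid K x y e m = ℝR.trans {at τM m} {α} {at τD m} (tr-M m K)
        (ℝR.trans {α} {β} {at τD m} α≃β (ℝR.sym {at τD m} {β} (tr-D m K)))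
        where
        τM = Dᴮ.tr (Dᴮ.pow Mᴮ K)
        τD = Dᴮ.tr (Dᴮ.pow Dᴮ′ K)
        α = Dᴿ.tr (Dᴿ.pow M K)
        β = Dᴿ.∑ (λ i → μ i ^ᴿ K)
        s : 𝔹 → ℕ → ℝ
        s x m = (-ᴿ fromℚ (inv m)) *ᴿ at x m
        α≃β : α ≃ β
        α≃β = tᴮ-rigid α β x y λ m → ℝR.trans {α +ᴿ s x m} {at τM m +ᴿ s x m} {β +ᴿ s y m}
          (+ᴿ-cong {α} {at τM m} {s x m} {s x m} (ℝR.sym {at τM m} {α} (tr-M m K)) (≃-refl {s x m}))
          (ℝR.trans {at τM m +ᴿ s x m} {at τD m +ᴿ s y m} {β +ᴿ s y m} (e m)
            (+ᴿ-cong {at τD m} {β} {s y m} {s y m} (tr-D m K) (≃-refl {s y m})))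

      traces : trMᴮ ≈ᴮ trDᴮ
      traces = Dᴮ.tr-pow-unique tᴮ Mᴮ Dᴮ′ tᴮ-cancel
        (pencils-agree (-ᴮ tᴮ) (λ m → fromℚ (inv m)) (λ m → ≃-refl { -ᴿ fromℚ (inv m)}) (λ m → inv m , 0<inv m , λ _ → refl))
        -- The second point is -(t + t^K), and t + t^K is again positive and rational at every
        -- index.
        (λ K → pencils-agree (-ᴮ tᴮ +ᴮ -ᴮ (tᴮ ^ᴮ K)) (λ m → fromℚ (inv m) +ᴿ fromℚ (inv m) ^ᴿ K)
          (λ m → ℝR.trans { -ᴿ τ m +ᴿ -ᴿ (at (tᴮ ^ᴮ K) m)} { -ᴿ τ m +ᴿ -ᴿ (τ m ^ᴿ K)} { -ᴿ (τ m +ᴿ τ m ^ᴿ K)}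
            (+ᴿ-cong { -ᴿ τ m} { -ᴿ τ m} { -ᴿ at (tᴮ ^ᴮ K) m} { -ᴿ (τ m ^ᴿ K)} (≃-refl { -ᴿ τ m}) (-ᴿ-cong {at (tᴮ ^ᴮ K) m} {τ m ^ᴿ K} (at.^-homo m tᴮ K)))
            (≃-pointwise { -ᴿ τ m +ᴿ -ᴿ (τ m ^ᴿ K)} { -ᴿ (τ m +ᴿ τ m ^ᴿ K)} λ n → sym (ℚ.neg-distrib-+ (inv m) (seq (τ m ^ᴿ K) n))))
          (λ m → inv m + inv m ^ℚ K , ℚ.+-mono-< (0<inv m) (0<^ K (0<inv m)) , λ n → cong (inv m +_) (seq-^ (τ m) K n)))
        rigid K
        where
        τ : ℕ → ℝ
        τ m = fromℚ (inv m)

  -- Walk counts in regular weighted graphs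

  0≤* : ∀ {p q} → 0ℚ ≤ p → 0ℚ ≤ q → 0ℚ ≤ p * q
  0≤* {p} {q} 0≤p 0≤q = subst (_≤ p * q) (ℚ.*-zeroʳ p) (*-mono-≤ˡ p 0≤p 0≤q)

  0≤+ : ∀ {p q} → 0ℚ ≤ p → 0ℚ ≤ q → 0ℚ ≤ p + q
  0≤+ {p} {q} 0≤p 0≤q = subst (_≤ p + q) (ℚ.+-identityʳ 0ℚ) (ℚ.+-mono-≤ 0≤p 0≤q)

  0≤1 : 0ℚ ≤ 1ℚ
  0≤1 = ℚ.<⇒≤ (ℚ.positive⁻¹ 1ℚ)

  0≤p*p : ∀ p → 0ℚ ≤ p * p
  0≤p*p p = by-sign (ℚ.≤-total 0ℚ p)
    where
    by-sign : 0ℚ ≤ p ⊎ p ≤ 0ℚ → 0ℚ ≤ p * p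
    by-sign (inj₁ 0≤p) = 0≤* 0≤p 0≤p
    by-sign (inj₂ p≤0) = subst (0ℚ ≤_) (solve 1 (λ p → (:- p) :* (:- p) := p :* p) refl p)
      (0≤* (ℚ.neg-antimono-≤ p≤0) (ℚ.neg-antimono-≤ p≤0))
      where open +-*-Solver

  ∑-mono : ∀ {n} {f g : Fin n → ℚ} → (∀ i → f i ≤ g i) → ∑ f ≤ ∑ g
  ∑-mono {zero}  {f} {g} f≤g = ℚ.≤-reflexive (trans (ℚM.∑-empty f) (sym (ℚM.∑-empty g)))
  ∑-mono {suc n} {f} {g} f≤g = subst₂ _≤_ (sym (ℚM.∑-suc f)) (sym (ℚM.∑-suc g))
    (ℚ.+-mono-≤ (f≤g zero) (∑-mono (f≤g ∘ suc)))

  ∑-const : ∀ n c → ∑ {n} (λ _ → c) ≡ ι n * c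
  ∑-const zero    c = trans (ℚM.∑-empty (λ _ → c)) (sym (trans (cong (_* c) ι-0) (ℚ.*-zeroˡ c)))
  ∑-const (suc n) c = begin
    ∑ {suc n} (λ _ → c)      ≡⟨ ℚM.∑-suc {n} (λ _ → c) ⟩
    c + ∑ {n} (λ _ → c)      ≡⟨ cong (c +_) (∑-const n c) ⟩
    c + ι n * c              ≡⟨ solve 2 (λ c n → c :+ n :* c := (con 1ℚ :+ n) :* c) refl c (ι n) ⟩
    (1ℚ + ι n) * c           ≡⟨ cong (_* c) (trans (ι-+ 1 n) (cong (_+ ι n) ι-1)) ⟨
    ι (suc n) * c            ∎
    where
    open ≡-Reasoning
    open +-*-Solver

  ∑-nonneg : ∀ {n} {f : Fin n → ℚ} → (∀ i → 0ℚ ≤ f i) → 0ℚ ≤ ∑ f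
  ∑-nonneg {n} {f} 0≤f = subst (_≤ ∑ f) (trans (∑-const n 0ℚ) (ℚ.*-zeroʳ (ι n))) (∑-mono 0≤f)

  term≤∑ : ∀ {n} {f : Fin n → ℚ} → (∀ i → 0ℚ ≤ f i) → ∀ i → f i ≤ ∑ f
  term≤∑ {suc n} {f} 0≤f zero    = subst₂ _≤_ (ℚ.+-identityʳ (f zero)) (sym (ℚM.∑-suc f))
    (ℚ.+-monoʳ-≤ (f zero) (∑-nonneg (0≤f ∘ suc)))
  term≤∑ {suc n} {f} 0≤f (suc i) = subst₂ _≤_ (ℚ.+-identityˡ (f (suc i))) (sym (ℚM.∑-suc f))
    (ℚ.+-mono-≤ (0≤f zero) (term≤∑ (0≤f ∘ suc) i))

  -- Carries displacement witnesses through a matrix product without deciding which entries vanish.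
  ∑-zero-or : ∀ {n} {Q : Set} {f : Fin n → ℚ} → (∀ i → f i ≡ 0ℚ ⊎ Q) → ∑ f ≡ 0ℚ ⊎ Q
  ∑-zero-or {zero}  {f = f} h = inj₁ (ℚM.∑-empty f)
  ∑-zero-or {suc n} {Q} {f} h = combined (h zero) (∑-zero-or (h ∘ suc))
    where
    combined : f zero ≡ 0ℚ ⊎ Q → ∑ (f ∘ suc) ≡ 0ℚ ⊎ Q → ∑ f ≡ 0ℚ ⊎ Q
    combined (inj₂ q) _        = inj₂ q
    combined (inj₁ _) (inj₂ q) = inj₂ q
    combined (inj₁ e) (inj₁ e′) = inj₁ (trans (ℚM.∑-suc f) (trans (cong₂ _+_ e e′) (ℚ.+-identityʳ 0ℚ)))

  𝟙-nonneg : ∀ {n} (i j : Fin n) → 0ℚ ≤ 𝟙 i j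
  𝟙-nonneg zero    zero    = 0≤1
  𝟙-nonneg zero    (suc j) = ℚ.≤-refl
  𝟙-nonneg (suc i) zero    = ℚ.≤-refl
  𝟙-nonneg (suc i) (suc j) = 𝟙-nonneg i j

  2*p*q≤p²+q² : ∀ p q → (1ℚ + 1ℚ) * (p * q) ≤ p * p + q * q
  2*p*q≤p²+q² p q = begin
    (1ℚ + 1ℚ) * (p * q)                            ≡⟨ ℚ.+-identityʳ _ ⟨
    (1ℚ + 1ℚ) * (p * q) + 0ℚ                       ≤⟨ ℚ.+-monoʳ-≤ ((1ℚ + 1ℚ) * (p * q)) (0≤p*p (p - q)) ⟩
    (1ℚ + 1ℚ) * (p * q) + (p - q) * (p - q)        ≡⟨ solve 2 (λ p q → (con 1ℚ :+ con 1ℚ) :* (p :* q) :+ (p :- q) :* (p :- q) := p :* p :+ q :* q) refl p q ⟩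
    p * p + q * q                                  ∎
    where
    open ℚ.≤-Reasoning
    open +-*-Solver

  -- The support is only covered by `P` cells, which may repeat or miss it, so its size is never
  -- computed. Each vertex is weighted by the number of cells hitting it; these weights add up to
  -- `P`.
  support-cauchy-schwarz : ∀ {N P} (w : Fin N → ℚ) (cell : Fin P → Fin N) → 0ℚ < ι P →
    (∀ u → w u ≡ 0ℚ ⊎ ∃[ p ] cell p ≡ u) → ∑ w * ∑ w ≤ ι P * ∑ (λ u → w u * w u)
  support-cauchy-schwarz {N} {P} w cell 0<P cover = ℚ.*-cancelˡ-≤-pos (ι P) {{ℚ.positive 0<P}} (begin
    ι P * (s * s)                                          ≡⟨ solve 2 (λ P s → P :* (s :* s) := (con 1ℚ :+ con 1ℚ) :* P :* s :* s :- P :* (s :* s)) refl (ι P) s ⟩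
    (1ℚ + 1ℚ) * ι P * s * s - ι P * (s * s)                ≤⟨ ℚ.+-monoˡ-≤ (- (ι P * (s * s))) total ⟩
    ι P * (s * s) + ι P * ι P * s₂ - ι P * (s * s)         ≡⟨ solve 3 (λ P s s₂ → P :* (s :* s) :+ P :* P :* s₂ :- P :* (s :* s) := P :* (P :* s₂)) refl (ι P) s s₂ ⟩
    ι P * (ι P * s₂)                                       ∎)
    where
    open ℚ.≤-Reasoning
    open +-*-Solver
    s s₂ : ℚ
    s = ∑ w
    s₂ = ∑ (λ u → w u * w u)
    count : Fin N → ℚ
    count u = ∑ (λ p → 𝟙 (cell p) u)

    ∑-count : ∑ count ≡ ι P
    ∑-count = trans (ℚM.∑-swap (λ u p → 𝟙 (cell p) u)) (trans (ℚM.∑-cong (λ p → ℚM.∑-𝟙 (cell p)))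
      (trans (∑-const P 1ℚ) (ℚ.*-identityʳ (ι P))))

    -- The inequality 2pq ≤ p² + q² at p = s, q = P w, with `count u ≥ 1` on the covered vertices.
    -- Summation gives 2P s² ≤ P s² + P² s₂.
    termwise : ∀ u → (1ℚ + 1ℚ) * ι P * s * w u ≤ count u * (s * s) + ι P * ι P * (w u * w u)
    termwise u = by-cover (cover u)
      where
      by-cover : w u ≡ 0ℚ ⊎ ∃[ p ] cell p ≡ u → (1ℚ + 1ℚ) * ι P * s * w u ≤ count u * (s * s) + ι P * ι P * (w u * w u)
      by-cover (inj₁ w≡0) = begin
        (1ℚ + 1ℚ) * ι P * s * w u  ≡⟨ trans (cong ((1ℚ + 1ℚ) * ι P * s *_) w≡0) (ℚ.*-zeroʳ ((1ℚ + 1ℚ) * ι P * s)) ⟩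
        0ℚ                         ≤⟨ 0≤+ (0≤* (∑-nonneg λ p → 𝟙-nonneg (cell p) u) (0≤p*p s)) (0≤* (0≤p*p (ι P)) (0≤p*p (w u))) ⟩
        count u * (s * s) + ι P * ι P * (w u * w u) ∎
      by-cover (inj₂ (p , cell≡u)) = begin
        (1ℚ + 1ℚ) * ι P * s * w u
          ≡⟨ solve 3 (λ P s w → (con 1ℚ :+ con 1ℚ) :* P :* s :* w := (con 1ℚ :+ con 1ℚ) :* (s :* (P :* w))) refl (ι P) s (w u) ⟩
        (1ℚ + 1ℚ) * (s * (ι P * w u))
          ≤⟨ 2*p*q≤p²+q² s (ι P * w u) ⟩
        s * s + (ι P * w u) * (ι P * w u)
          ≡⟨ solve 3 (λ P s w → s :* s :+ (P :* w) :* (P :* w) := con 1ℚ :* (s :* s) :+ P :* P :* (w :* w)) refl (ι P) s (w u) ⟩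
        1ℚ * (s * s) + ι P * ι P * (w u * w u)
          ≤⟨ ℚ.+-monoˡ-≤ (ι P * ι P * (w u * w u)) (*-mono-≤ʳ (s * s) (0≤p*p s)
               (subst (_≤ count u) (ℚM.𝟙-≡ cell≡u) (term≤∑ (λ p → 𝟙-nonneg (cell p) u) p))) ⟩
        count u * (s * s) + ι P * ι P * (w u * w u) ∎

    total : (1ℚ + 1ℚ) * ι P * s * s ≤ ι P * (s * s) + ι P * ι P * s₂
    total = begin
      (1ℚ + 1ℚ) * ι P * s * s                                        ≡⟨ ℚM.∑-*ˡ ((1ℚ + 1ℚ) * ι P * s) w ⟩
      ∑ (λ u → (1ℚ + 1ℚ) * ι P * s * w u)                            ≤⟨ ∑-mono termwise ⟩
      ∑ (λ u → count u * (s * s) + ι P * ι P * (w u * w u))          ≡⟨ ℚM.∑-+ (λ u → count u * (s * s)) (λ u → ι P * ι P * (w u * w u)) ⟩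
      ∑ (λ u → count u * (s * s)) + ∑ (λ u → ι P * ι P * (w u * w u))
        ≡⟨ cong₂ _+_ (trans (sym (ℚM.∑-*ʳ (s * s) count)) (cong (_* (s * s)) ∑-count)) (sym (ℚM.∑-*ˡ (ι P * ι P) (λ u → w u * w u))) ⟩
      ι P * (s * s) + ι P * ι P * s₂                                 ∎

  module WalkCounts {N} (M : Matrix ℚ N) (M≥0 : ∀ i j → 0ℚ ≤ M i j) (M-sym : ∀ i j → M i j ≡ M j i)
    (d : ℚ) (regular : ∀ i → ∑ (M i) ≡ d) where

    pow≥0 : ∀ k i j → 0ℚ ≤ pow M k i j
    pow≥0 zero    i j = 𝟙-nonneg i j
    pow≥0 (suc k) i j = ∑-nonneg λ l → 0≤* (M≥0 i l) (pow≥0 k l j)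

    -- A diagonal entry is at most its row sum, because all entries are nonnegative.
    tr-upper : ∀ k → tr (pow M k) ≤ ι N * d ^ℚ k
    tr-upper k = ℚ.≤-trans
      (∑-mono λ i → ℚ.≤-trans (term≤∑ (pow≥0 k i) i) (ℚ.≤-reflexive (ℚM.pow-row-sum M d regular k i)))
      (ℚ.≤-reflexive (∑-const N (d ^ℚ k)))

    -- By symmetry the sum of squares along row `v` of M^m is the diagonal entry of M^2m at `v`.
    returns : ∀ m {P} (cell : Fin N → Fin P → Fin N) → 0ℚ < ι P →
              (∀ v u → pow M m v u ≡ 0ℚ ⊎ ∃[ p ] cell v p ≡ u) →
              ∀ v → d ^ℚ m * d ^ℚ m ≤ ι P * pow M (m ℕ.+ m) v v
    returns m {P} cell 0<P cover v = begin
      d ^ℚ m * d ^ℚ m                                ≡⟨ cong₂ _*_ (row m) (row m) ⟨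
      ∑ (pow M m v) * ∑ (pow M m v)                  ≤⟨ support-cauchy-schwarz (pow M m v) (cell v) 0<P (cover v) ⟩
      ι P * ∑ (λ u → pow M m v u * pow M m v u)      ≡⟨ cong (ι P *_) (ℚM.∑-cong λ u → cong (pow M m v u *_) (ℚM.pow-symmetric M M-sym m v u)) ⟩
      ι P * ∑ (λ u → pow M m v u * pow M m u v)      ≡⟨ cong (ι P *_) (ℚM.pow-+ M m m v v) ⟨
      ι P * pow M (m ℕ.+ m) v v                      ∎
      where
      open ℚ.≤-Reasoning
      row : ∀ k → ∑ (pow M k v) ≡ d ^ℚ k
      row k = ℚM.pow-row-sum M d regular k v

    -- Among the closed walks of length 2m + 1 only those whose first step stays at `v` are kept;
    -- each diagonal entry provides a factor of at least `g`.
    tr-lower : ∀ g → 0ℚ ≤ g → (∀ v → g ≤ M v v) → ∀ m {P} (cell : Fin N → Fin P → Fin N) → 0ℚ < ι P →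
               (∀ v u → pow M m v u ≡ 0ℚ ⊎ ∃[ p ] cell v p ≡ u) →
               ι N * (g * (d ^ℚ m * d ^ℚ m)) ≤ ι P * tr (pow M (suc (m ℕ.+ m)))
    tr-lower g 0≤g g≤M m {P} cell 0<P cover = begin
      ι N * (g * (d ^ℚ m * d ^ℚ m))                        ≡⟨ ∑-const N (g * (d ^ℚ m * d ^ℚ m)) ⟨
      ∑ (λ (_ : Fin N) → g * (d ^ℚ m * d ^ℚ m))            ≤⟨ ∑-mono termwise ⟩
      ∑ (λ v → ι P * pow M (suc (m ℕ.+ m)) v v)            ≡⟨ ℚM.∑-*ˡ (ι P) (λ v → pow M (suc (m ℕ.+ m)) v v) ⟨
      ι P * tr (pow M (suc (m ℕ.+ m)))                     ∎
      where
      open ℚ.≤-Reasoning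
      open +-*-Solver
      termwise : ∀ v → g * (d ^ℚ m * d ^ℚ m) ≤ ι P * pow M (suc (m ℕ.+ m)) v v
      termwise v = begin
        g * (d ^ℚ m * d ^ℚ m)                    ≤⟨ *-mono-≤ˡ g 0≤g (returns m cell 0<P cover v) ⟩
        g * (ι P * pow M (m ℕ.+ m) v v)          ≡⟨ solve 3 (λ g P p → g :* (P :* p) := P :* (g :* p)) refl g (ι P) (pow M (m ℕ.+ m) v v) ⟩
        ι P * (g * pow M (m ℕ.+ m) v v)          ≤⟨ *-mono-≤ˡ (ι P) (ℚ.<⇒≤ 0<P) (*-mono-≤ʳ (pow M (m ℕ.+ m) v v) (pow≥0 (m ℕ.+ m) v v) (g≤M v)) ⟩
        ι P * (M v v * pow M (m ℕ.+ m) v v)      ≤⟨ *-mono-≤ˡ (ι P) (ℚ.<⇒≤ 0<P) (term≤∑ (λ l → 0≤* (M≥0 v l) (pow≥0 (m ℕ.+ m) l v)) v) ⟩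
        ι P * pow M (suc (m ℕ.+ m)) v v          ∎

  -- Generalised Petersen graphs

  -- Built from `1ℚ` because `ι` is opaque, whereas the row sums and the comparison with `fromℕ 3`
  -- rely on closed rationals computing.
  three : ℚ
  three = 1ℚ + (1ℚ + 1ℚ)

  six : ℚ
  six = three + three

  0≤three : 0ℚ ≤ three
  0≤three = 0≤+ 0≤1 (0≤+ 0≤1 0≤1)

  module _ {N : ℕ} where

    shiftedAdjacency : Multigraph N → Matrix ℚ N
    shiftedAdjacency G i j = ι (adjacency G i j) + three * 𝟙 i j

    indicator : ∀ {A : Set} → Dec A → ℚ
    indicator (yes _) = 1ℚ
    indicator (no  _) = 0ℚ

    degreeᵉ : Fin N → Fin N × Fin N → ℚ
    degreeᵉ v (x , y) = 𝟙 x v + 𝟙 y v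

    Loopless : Fin N × Fin N → Set
    Loopless (x , y) = x ≢ y

    adjacency-∷ : ∀ e (G : Multigraph N) u v →
                  ι (adjacency (e ∷ G) u v) ≡ indicator (joins? u v e) + ι (adjacency G u v)
    adjacency-∷ e G u v = by-dec (joins? u v e)
      where
      by-dec : (d : Dec (Joins u v e)) → ι (adjacency (e ∷ G) u v) ≡ indicator d + ι (adjacency G u v)
      by-dec (yes j) = trans (cong (ι ∘ length) (List.filter-accept (joins? u v) j))
        (trans (ι-+ 1 (adjacency G u v)) (cong (_+ ι (adjacency G u v)) ι-1))
      by-dec (no ¬j) = trans (cong (ι ∘ length) (List.filter-reject (joins? u v) ¬j)) (sym (ℚ.+-identityˡ _))

    adjacency-++ : ∀ (G H : Multigraph N) u v → adjacency (G ++ H) u v ≡ adjacency G u v ℕ.+ adjacency H u v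
    adjacency-++ G H u v = trans (cong length (List.filter-++ (joins? u v) G H)) (List.length-++ (filter (joins? u v) G))

    adjacency-sym : ∀ (G : Multigraph N) u v → adjacency G u v ≡ adjacency G v u
    adjacency-sym G u v = cong length (List.filter-≐ (joins? u v) (joins? v u) (Sum.swap , Sum.swap) G)

    𝟙*𝟙≡0 : ∀ (x v y u : Fin N) → ¬ (x ≡ v × y ≡ u) → 𝟙 x v * 𝟙 y u ≡ 0ℚ
    𝟙*𝟙≡0 x v y u ¬both = by-dec (x Fin.≟ v)
      where
      by-dec : Dec (x ≡ v) → 𝟙 x v * 𝟙 y u ≡ 0ℚ
      by-dec (yes x≡v) = trans (cong (𝟙 x v *_) (ℚM.𝟙-≢ (λ y≡u → ¬both (x≡v , y≡u)))) (ℚ.*-zeroʳ (𝟙 x v))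
      by-dec (no x≢v)  = trans (cong (_* 𝟙 y u) (ℚM.𝟙-≢ x≢v)) (ℚ.*-zeroˡ (𝟙 y u))

    𝟙*𝟙≡1 : ∀ {x v y u : Fin N} → x ≡ v → y ≡ u → 𝟙 x v * 𝟙 y u ≡ 1ℚ
    𝟙*𝟙≡1 x≡v y≡u = trans (cong₂ _*_ (ℚM.𝟙-≡ x≡v) (ℚM.𝟙-≡ y≡u)) (ℚ.*-identityˡ 1ℚ)

    -- Looplessness keeps the two alternatives of `Joins` exclusive: a loop counts once on the left
    -- and twice on the right.
    joins-indicator : ∀ v u e → Loopless e →
      indicator (joins? v u e) ≡ 𝟙 (proj₁ e) v * 𝟙 (proj₂ e) u + 𝟙 (proj₂ e) v * 𝟙 (proj₁ e) u
    joins-indicator v u (x , y) x≢y = by-dec (joins? v u (x , y))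
      where
      by-dec : (d : Dec (Joins v u (x , y))) → indicator d ≡ 𝟙 x v * 𝟙 y u + 𝟙 y v * 𝟙 x u
      by-dec (yes (inj₁ (x≡v , y≡u))) = sym (trans
        (cong₂ _+_ (𝟙*𝟙≡1 x≡v y≡u) (𝟙*𝟙≡0 y v x u (λ (y≡v , _) → x≢y (trans x≡v (sym y≡v))))) (ℚ.+-identityʳ 1ℚ))
      by-dec (yes (inj₂ (x≡u , y≡v))) = sym (trans
        (cong₂ _+_ (𝟙*𝟙≡0 x v y u (λ (x≡v , _) → x≢y (trans x≡v (sym y≡v)))) (𝟙*𝟙≡1 y≡v x≡u)) (ℚ.+-identityˡ 1ℚ))
      by-dec (no ¬j) = sym (trans
        (cong₂ _+_ (𝟙*𝟙≡0 x v y u (¬j ∘ inj₁)) (𝟙*𝟙≡0 y v x u (λ (y≡v , x≡u) → ¬j (inj₂ (x≡u , y≡v))))) (ℚ.+-identityˡ 0ℚ))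

    ∑-joins : ∀ v e → Loopless e → ∑ (λ u → indicator (joins? v u e)) ≡ degreeᵉ v e
    ∑-joins v e@(x , y) x≢y = begin
      ∑ (λ u → indicator (joins? v u e))
        ≡⟨ ℚM.∑-cong (λ u → joins-indicator v u e x≢y) ⟩
      ∑ (λ u → 𝟙 x v * 𝟙 y u + 𝟙 y v * 𝟙 x u)
        ≡⟨ ℚM.∑-+ (λ u → 𝟙 x v * 𝟙 y u) (λ u → 𝟙 y v * 𝟙 x u) ⟩
      ∑ (λ u → 𝟙 x v * 𝟙 y u) + ∑ (λ u → 𝟙 y v * 𝟙 x u)
        ≡⟨ cong₂ _+_ (scaled (𝟙 x v) y) (scaled (𝟙 y v) x) ⟩
      𝟙 x v + 𝟙 y v ∎
      where
      open ≡-Reasoning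
      scaled : ∀ c z → ∑ (λ u → c * 𝟙 z u) ≡ c
      scaled c z = trans (sym (ℚM.∑-*ˡ c (𝟙 z))) (trans (cong (c *_) (ℚM.∑-𝟙 z)) (ℚ.*-identityʳ c))

    row-sum : Multigraph N → Fin N → ℚ
    row-sum G v = ∑ (λ u → ι (adjacency G v u))

    row-sum-++ : ∀ G H v → row-sum (G ++ H) v ≡ row-sum G v + row-sum H v
    row-sum-++ G H v = trans
      (ℚM.∑-cong λ u → trans (cong ι (adjacency-++ G H v u)) (ι-+ (adjacency G v u) (adjacency H v u)))
      (ℚM.∑-+ (λ u → ι (adjacency G v u)) (λ u → ι (adjacency H v u)))

    row-sum-tabulate : ∀ {n} (f : Fin n → Fin N × Fin N) → (∀ i → Loopless (f i)) → ∀ v →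
                       row-sum (tabulate f) v ≡ ∑ (λ i → degreeᵉ v (f i))
    row-sum-tabulate {zero}  f loopless v = trans
      (ℚM.∑-zero λ u → ι-0) (sym (ℚM.∑-empty (λ i → degreeᵉ v (f i))))
    row-sum-tabulate {suc n} f loopless v = begin
      ∑ (λ u → ι (adjacency (f zero ∷ tabulate (f ∘ suc)) v u))
        ≡⟨ ℚM.∑-cong (adjacency-∷ (f zero) (tabulate (f ∘ suc)) v) ⟩
      ∑ (λ u → indicator (joins? v u (f zero)) + ι (adjacency (tabulate (f ∘ suc)) v u))
        ≡⟨ ℚM.∑-+ (λ u → indicator (joins? v u (f zero))) (λ u → ι (adjacency (tabulate (f ∘ suc)) v u)) ⟩
      ∑ (λ u → indicator (joins? v u (f zero))) + row-sum (tabulate (f ∘ suc)) v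
        ≡⟨ cong₂ _+_ (∑-joins v (f zero) (loopless zero)) (row-sum-tabulate (f ∘ suc) (loopless ∘ suc) v) ⟩
      degreeᵉ v (f zero) + ∑ (λ i → degreeᵉ v (f (suc i)))
        ≡⟨ ℚM.∑-suc (λ i → degreeᵉ v (f i)) ⟨
      ∑ (λ i → degreeᵉ v (f i)) ∎
      where open ≡-Reasoning

    adjacency-++-zero-or : ∀ {Q : Set} G H {v u} → adjacency G v u ≡ 0 ⊎ Q → adjacency H v u ≡ 0 ⊎ Q →
                           adjacency (G ++ H) v u ≡ 0 ⊎ Q
    adjacency-++-zero-or G H         (inj₂ q) _         = inj₂ q
    adjacency-++-zero-or G H         (inj₁ _) (inj₂ q)  = inj₂ q
    adjacency-++-zero-or G H {v} {u} (inj₁ e) (inj₁ e′) = inj₁ (trans (adjacency-++ G H v u) (cong₂ ℕ._+_ e e′))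

    adjacency-tabulate-zero-or : ∀ {n} {Q : Set} (f : Fin n → Fin N × Fin N) {v u} → (∀ i → Joins v u (f i) → Q) →
                                 adjacency (tabulate f) v u ≡ 0 ⊎ Q
    adjacency-tabulate-zero-or {zero}  f h = inj₁ refl
    adjacency-tabulate-zero-or {suc n} {Q} f {v} {u} h = by-dec (joins? v u (f zero))
      where
      by-dec : Dec (Joins v u (f zero)) → adjacency (tabulate f) v u ≡ 0 ⊎ Q
      by-dec (yes j) = inj₂ (h zero j)
      by-dec (no ¬j) = Sum.map₁ (trans (cong length (List.filter-reject (joins? v u) ¬j)))
                         (adjacency-tabulate-zero-or (f ∘ suc) (h ∘ suc))

  module Cyclic (n : ℕ) .{{_ : NonZero n}} where

    infix 4 _≋ₙ_
    _≋ₙ_ : ℕ → ℕ → Set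
    x ≋ₙ y = x % n ≡ y % n

    +-congₙ : ∀ {x x′ y y′} → x ≋ₙ x′ → y ≋ₙ y′ → x ℕ.+ y ≋ₙ x′ ℕ.+ y′
    +-congₙ {x} {x′} {y} {y′} p q = trans (%-distribˡ-+ x y n)
      (trans (cong (_% n) (cong₂ ℕ._+_ p q)) (sym (%-distribˡ-+ x′ y′ n)))

    toℕ-mod : ∀ x → toℕ (x mod n) ≡ x % n
    toℕ-mod x = Fin.toℕ-fromℕ< (m%n<n x n)

    toℕ-shift : ∀ k i → toℕ (shift n k i) ≋ₙ toℕ i ℕ.+ k
    toℕ-shift k i = trans (cong (_% n) (toℕ-mod (toℕ i ℕ.+ k))) (m%n%n≡m%n (toℕ i ℕ.+ k) n)

    toℕ-injectiveₙ : ∀ {i j : Fin n} → toℕ i ≋ₙ toℕ j → i ≡ j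
    toℕ-injectiveₙ {i} {j} p = Fin.toℕ-injective
      (trans (sym (m<n⇒m%n≡m (Fin.toℕ<n i))) (trans p (m<n⇒m%n≡m (Fin.toℕ<n j))))

    suc-pred : suc (ℕ.pred n) ≡ n
    suc-pred = ℕ.suc-pred n

    -- k + k (n - 1) is a multiple of n.
    k+k[n-1] : ∀ x k → x ℕ.+ (k ℕ.+ k ℕ.* ℕ.pred n) ≋ₙ x
    k+k[n-1] x k = trans (cong (λ y → (x ℕ.+ y) % n) (trans (sym (ℕ.*-suc k (ℕ.pred n))) (cong (k ℕ.*_) suc-pred)))
      ([m+kn]%n≡m%n x k n)

    +-cancelʳₙ : ∀ {x y} k → x ℕ.+ k ≋ₙ y ℕ.+ k → x ≋ₙ y
    +-cancelʳₙ {x} {y} k p = trans (sym (k+k[n-1] x k)) (trans (shifted x y p) (k+k[n-1] y k))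
      where
      shifted : ∀ x y → x ℕ.+ k ≋ₙ y ℕ.+ k → x ℕ.+ (k ℕ.+ k ℕ.* ℕ.pred n) ≋ₙ y ℕ.+ (k ℕ.+ k ℕ.* ℕ.pred n)
      shifted x y p = trans (cong (_% n) (sym (ℕ.+-assoc x k _)))
        (trans (+-congₙ {x ℕ.+ k} {y ℕ.+ k} {k ℕ.* ℕ.pred n} p refl) (cong (_% n) (ℕ.+-assoc y k _)))

    shift-loopless : ∀ k → 1 ℕ.≤ k → k ℕ.< n → ∀ i → i ≢ shift n k i
    shift-loopless k 1≤k k<n i i≡σi = ℕ.<⇒≢ 1≤k (trans (sym (0%n)) (trans 0≋k (m<n⇒m%n≡m k<n)))
      where
      0%n : 0 % n ≡ 0
      0%n = m*n%n≡0 0 n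
      0≋k : 0 ≋ₙ k
      0≋k = +-cancelʳₙ (toℕ i) (trans (cong (_% n) (cong toℕ i≡σi)) (trans (toℕ-shift k i) (cong (_% n) (ℕ.+-comm (toℕ i) k))))

    -- Subtraction of `k` modulo `n`, expressed as addition of k (n - 1) to stay within ℕ.
    unshift : ℕ → Fin n → Fin n
    unshift k = shift n (k ℕ.* ℕ.pred n)

    unshift-shift : ∀ k i → unshift k (shift n k i) ≡ i
    unshift-shift k i = toℕ-injectiveₙ (trans (toℕ-shift _ (shift n k i))
      (trans (+-congₙ {y = k ℕ.* ℕ.pred n} (toℕ-shift k i) refl)
        (trans (cong (_% n) (ℕ.+-assoc (toℕ i) k _)) (k+k[n-1] (toℕ i) k))))

    shift-unshift : ∀ k i → shift n k (unshift k i) ≡ i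
    shift-unshift k i = toℕ-injectiveₙ (trans (toℕ-shift k (unshift k i))
      (trans (+-congₙ {y = k} (toℕ-shift (k ℕ.* ℕ.pred n) i) refl)
        (trans (cong (_% n) (trans (ℕ.+-assoc (toℕ i) _ k) (cong (toℕ i ℕ.+_) (ℕ.+-comm _ k)))) (k+k[n-1] (toℕ i) k))))

    -- Every vertex of a ring is the far end of exactly one listed edge of that ring. For 2k = n
    -- this supplies the second copy of the double edge.
    ∑-shift : ∀ k j → ∑ (λ i → 𝟙 (shift n k i) j) ≡ 1ℚ
    ∑-shift k j = trans (ℚM.∑-cong λ i → trans (transport i) (ℚM.𝟙-sym i (unshift k j))) (ℚM.∑-𝟙 (unshift k j))
      where
      transport : ∀ i → 𝟙 (shift n k i) j ≡ 𝟙 i (unshift k j)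
      transport i = by-dec (shift n k i Fin.≟ j)
        where
        by-dec : Dec (shift n k i ≡ j) → 𝟙 (shift n k i) j ≡ 𝟙 i (unshift k j)
        by-dec (yes p) = trans (ℚM.𝟙-≡ p) (sym (ℚM.𝟙-≡ (trans (sym (unshift-shift k i)) (cong (unshift k) p))))
        by-dec (no ¬p) = trans (ℚM.𝟙-≢ ¬p) (sym (ℚM.𝟙-≢ λ q → ¬p (trans (cong (shift n k) q) (shift-unshift k j))))

  boxSize : ℕ → ℕ
  boxSize m = 2 ℕ.* (suc (m ℕ.+ m) ℕ.* suc (m ℕ.+ m))

  module PetersenWalks (n k : ℕ) .{{_ : NonZero n}} (3≤n : 3 ℕ.≤ n) (1≤k : 1 ℕ.≤ k) (2k≤n : 2 ℕ.* k ℕ.≤ n) where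
    open Cyclic n

    V : Set
    V = Fin (2 ℕ.* n)

    aₙ bₙ : Fin n → V
    aₙ = Defs.a n
    bₙ = Defs.b n

    outer spokes inner : Multigraph (2 ℕ.* n)
    outer  = tabulate (λ i → aₙ i , aₙ (shift n 1 i))
    spokes = tabulate (λ i → aₙ i , bₙ i)
    inner  = tabulate (λ i → bₙ i , bₙ (shift n k i))

    1<n : 1 ℕ.< n
    1<n = ℕ.≤-trans (ℕ.s≤s (ℕ.s≤s ℕ.z≤n)) 3≤n

    k<n : k ℕ.< n
    k<n = ℕ.<-≤-trans (ℕ.m<m+n k (subst (0 ℕ.<_) (sym (ℕ.+-identityʳ k)) 1≤k)) 2k≤n

    combine-≢ : ∀ (s s′ : Fin 2) (i j : Fin n) → s ≢ s′ → combine s i ≢ combine s′ j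
    combine-≢ s s′ i j s≢s′ e = s≢s′ (Fin.combine-injectiveˡ s i s′ j e)

    0≢1 : zero ≢ Fin.suc {1} zero
    0≢1 ()

    combine-𝟙 : ∀ (s : Fin 2) (i j : Fin n) → 𝟙 (combine s i) (combine s j) ≡ 𝟙 i j
    combine-𝟙 s i j = by-dec (i Fin.≟ j)
      where
      by-dec : Dec (i ≡ j) → 𝟙 (combine s i) (combine s j) ≡ 𝟙 i j
      by-dec (yes p) = trans (ℚM.𝟙-≡ (cong (combine s) p)) (sym (ℚM.𝟙-≡ p))
      by-dec (no ¬p) = trans (ℚM.𝟙-≢ (λ e → ¬p (Fin.combine-injectiveʳ s i s j e))) (sym (ℚM.𝟙-≢ ¬p))

    ∑-same : ∀ (s : Fin 2) (σ : Fin n → Fin n) j → ∑ (λ i → 𝟙 (σ i) j) ≡ 1ℚ → ∑ (λ i → 𝟙 (combine s (σ i)) (combine s j)) ≡ 1ℚ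
    ∑-same s σ j σ-bij = trans (ℚM.∑-cong λ i → combine-𝟙 s (σ i) j) σ-bij

    ∑-other : ∀ (s s′ : Fin 2) (σ : Fin n → Fin n) j → s ≢ s′ → ∑ (λ i → 𝟙 (combine s (σ i)) (combine s′ j)) ≡ 0ℚ
    ∑-other s s′ σ j s≢s′ = ℚM.∑-zero λ i → ℚM.𝟙-≢ (combine-≢ s s′ (σ i) j s≢s′)

    ∑-id : ∀ j → ∑ (λ (i : Fin n) → 𝟙 i j) ≡ 1ℚ
    ∑-id j = trans (ℚM.∑-cong λ i → ℚM.𝟙-sym i j) (ℚM.∑-𝟙 j)

    block-sum : ∀ (s s′ : Fin 2) (σ : Fin n → Fin n) → (∀ i → combine s i ≢ combine s′ (σ i)) → ∀ v {p q} →
      ∑ (λ i → 𝟙 (combine s i) v) ≡ p → ∑ (λ i → 𝟙 (combine s′ (σ i)) v) ≡ q →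
      row-sum (tabulate (λ i → combine s i , combine s′ (σ i))) v ≡ p + q
    block-sum s s′ σ loopless v e e′ = trans (row-sum-tabulate (λ i → combine s i , combine s′ (σ i)) loopless v)
      (trans (ℚM.∑-+ (λ i → 𝟙 (combine s i) v) (λ i → 𝟙 (combine s′ (σ i)) v)) (cong₂ _+_ e e′))

    petersen-row-sum : ∀ v p₁ p₂ p₃ → row-sum outer v ≡ p₁ → row-sum spokes v ≡ p₂ → row-sum inner v ≡ p₃ →
                       row-sum (petersen n k) v ≡ p₁ + (p₂ + p₃)
    petersen-row-sum v p₁ p₂ p₃ e₁ e₂ e₃ = trans (row-sum-++ outer (spokes ++ inner) v)
      (cong₂ _+_ e₁ (trans (row-sum-++ spokes inner v) (cong₂ _+_ e₂ e₃)))

    outer-loopless : ∀ i → aₙ i ≢ aₙ (shift n 1 i)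
    outer-loopless i e = shift-loopless 1 ℕ.≤-refl 1<n i (Fin.combine-injectiveʳ {2} zero i zero (shift n 1 i) e)

    inner-loopless : ∀ i → bₙ i ≢ bₙ (shift n k i)
    inner-loopless i e = shift-loopless k 1≤k k<n i (Fin.combine-injectiveʳ {2} (suc zero) i (suc zero) (shift n k i) e)

    spokes-loopless : ∀ i → aₙ i ≢ bₙ i
    spokes-loopless i = combine-≢ zero (suc zero) i i 0≢1

    regular-a : ∀ j → row-sum (petersen n k) (aₙ j) ≡ three
    regular-a j = trans
      -- Outer edges, spokes and inner edges, each as first ends plus second ends.
      (petersen-row-sum (aₙ j) (1ℚ + 1ℚ) (1ℚ + 0ℚ) (0ℚ + 0ℚ)
        (block-sum zero zero (shift n 1) outer-loopless (aₙ j) (∑-same zero (λ i → i) j (∑-id j)) (∑-same zero (shift n 1) j (∑-shift 1 j)))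
        (block-sum zero (suc zero) (λ i → i) spokes-loopless (aₙ j) (∑-same zero (λ i → i) j (∑-id j)) (∑-other (suc zero) zero (λ i → i) j (0≢1 ∘ sym)))
        (block-sum (suc zero) (suc zero) (shift n k) inner-loopless (aₙ j) (∑-other (suc zero) zero (λ i → i) j (0≢1 ∘ sym)) (∑-other (suc zero) zero (shift n k) j (0≢1 ∘ sym))))
      refl

    regular-b : ∀ j → row-sum (petersen n k) (bₙ j) ≡ three
    regular-b j = trans
      (petersen-row-sum (bₙ j) (0ℚ + 0ℚ) (0ℚ + 1ℚ) (1ℚ + 1ℚ)
        (block-sum zero zero (shift n 1) outer-loopless (bₙ j) (∑-other zero (suc zero) (λ i → i) j 0≢1) (∑-other zero (suc zero) (shift n 1) j 0≢1))
        (block-sum zero (suc zero) (λ i → i) spokes-loopless (bₙ j) (∑-other zero (suc zero) (λ i → i) j 0≢1) (∑-same (suc zero) (λ i → i) j (∑-id j)))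
        (block-sum (suc zero) (suc zero) (shift n k) inner-loopless (bₙ j) (∑-same (suc zero) (λ i → i) j (∑-id j)) (∑-same (suc zero) (shift n k) j (∑-shift k j))))
      refl

    regular : ∀ v → row-sum (petersen n k) v ≡ three
    regular v = subst (λ v → row-sum (petersen n k) v ≡ three) (Fin.combine-remQuot {2} n v)
      (on-ring (proj₁ (remQuot {2} n v)) (proj₂ (remQuot {2} n v)))
      where
      on-ring : ∀ s j → row-sum (petersen n k) (combine s j) ≡ three
      on-ring zero       j = regular-a j
      on-ring (suc zero) j = regular-b j

    pos : V → ℕ
    pos v = toℕ (proj₂ (remQuot {2} n v))

    pos-combine : ∀ s i → pos (combine s i) ≡ toℕ i
    pos-combine s i = cong (toℕ ∘ proj₂) (Fin.remQuot-combine {2} s i)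

    -- A step changes the index by 0, ±1 or ±k; adding 1 + k makes the
    -- displacement x + k y with 0 ≤ x, y ≤ 2.
    Displaced : ℕ → V → V → Set
    Displaced j v u = ∃[ x ] ∃[ y ] (x ℕ.≤ j ℕ.+ j × y ℕ.≤ j ℕ.+ j × pos u ℕ.+ j ℕ.* suc k ≋ₙ pos v ℕ.+ (x ℕ.+ k ℕ.* y))

    displaced-compose : ∀ {j v l u} → Displaced 1 v l → Displaced j l u → Displaced (suc j) v u
    displaced-compose {j} {v} {l} {u} (x , y , x≤ , y≤ , p) (x′ , y′ , x′≤ , y′≤ , q) =
      x ℕ.+ x′ , y ℕ.+ y′ , add-≤ x≤ x′≤ , add-≤ y≤ y′≤ ,
      trans (cong (_% n) (solve 3 (λ u k jk → u :+ (con 1 :+ k :+ jk) := (u :+ jk) :+ (con 1 :+ k)) refl (pos u) k (j ℕ.* suc k)))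
        (trans (+-congₙ {y = suc k} q refl)
          (trans (cong (_% n) (solve 4 (λ l k x y → (l :+ (x :+ k :* y)) :+ (con 1 :+ k) := (l :+ con 1 :* (con 1 :+ k)) :+ (x :+ k :* y)) refl (pos l) k x′ y′))
            (trans (+-congₙ {y = x′ ℕ.+ k ℕ.* y′} p refl)
              (cong (_% n) (solve 6 (λ v k x y x′ y′ → (v :+ (x :+ k :* y)) :+ (x′ :+ k :* y′) := v :+ ((x :+ x′) :+ k :* (y :+ y′))) refl (pos v) k x y x′ y′)))))
      where
      open ℕ-Solver
      add-≤ : ∀ {x x′} → x ℕ.≤ 2 → x′ ℕ.≤ j ℕ.+ j → x ℕ.+ x′ ℕ.≤ suc j ℕ.+ suc j
      add-≤ x≤ x′≤ = ℕ.≤-trans (ℕ.+-mono-≤ x≤ x′≤) (ℕ.≤-reflexive (cong suc (sym (ℕ.+-suc j j))))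

    displaced-step : ∀ {v u} x y → x ℕ.≤ 2 → y ℕ.≤ 2 → pos u ℕ.+ suc k ≋ₙ pos v ℕ.+ (x ℕ.+ k ℕ.* y) → Displaced 1 v u
    displaced-step {v} {u} x y x≤ y≤ p = x , y , x≤ , y≤ , trans (cong (λ z → (pos u ℕ.+ z) % n) (ℕ.*-identityˡ (suc k))) p

    -- The pair `x`, `y` encodes the displacement δ + 1 + k of the forward traversal, and `x′`, `y′`
    -- the displacement 1 + k - δ of the backward one. The separate `f` lets spokes, whose second
    -- index is literally `i`, be treated as δ = 0.
    edge-displaced : ∀ (s s′ : Fin 2) δ i f → shift n δ i ≡ f → ∀ x y x′ y′ → x ℕ.≤ 2 → y ℕ.≤ 2 → x′ ℕ.≤ 2 → y′ ℕ.≤ 2 →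
      (∀ p → p ℕ.+ δ ℕ.+ suc k ≡ p ℕ.+ (x ℕ.+ k ℕ.* y)) → (∀ p → p ℕ.+ suc k ≡ p ℕ.+ δ ℕ.+ (x′ ℕ.+ k ℕ.* y′)) →
      ∀ {v u} → Joins v u (combine s i , combine s′ f) → Displaced 1 v u
    edge-displaced s s′ δ i _ refl x y x′ y′ x≤ y≤ x′≤ y′≤ forward backward (inj₁ (refl , refl)) =
      displaced-step x y x≤ y≤ (trans (cong (λ p → (p ℕ.+ suc k) % n) (pos-combine s′ (shift n δ i)))
        (trans (+-congₙ {y = suc k} (toℕ-shift δ i) refl)
          (cong (_% n) (trans (forward (toℕ i)) (cong (ℕ._+ (x ℕ.+ k ℕ.* y)) (sym (pos-combine s i)))))))
    edge-displaced s s′ δ i _ refl x y x′ y′ x≤ y≤ x′≤ y′≤ forward backward (inj₂ (refl , refl)) =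
      displaced-step x′ y′ x′≤ y′≤ (trans (cong (_% n) (trans (cong (ℕ._+ suc k) (pos-combine s i)) (backward (toℕ i))))
        (trans (+-congₙ {y = x′ ℕ.+ k ℕ.* y′} (sym (toℕ-shift δ i)) refl)
          (cong (λ p → (p ℕ.+ (x′ ℕ.+ k ℕ.* y′)) % n) (sym (pos-combine s′ (shift n δ i))))))

    shift-0 : ∀ i → shift n 0 i ≡ i
    shift-0 i = toℕ-injectiveₙ (trans (toℕ-shift 0 i) (cong (_% n) (ℕ.+-identityʳ (toℕ i))))

    adjacency-displaced : ∀ v u → adjacency (petersen n k) v u ≡ 0 ⊎ Displaced 1 v u
    adjacency-displaced v u = adjacency-++-zero-or outer (spokes ++ inner)
      -- With the offset 1 + k, the displacements +1 and -1 become 2 + k and 0 + k, a spoke becomes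
      -- 1 + k, and +k and -k become 1 + 2k and 1 + 0k.
      (adjacency-tabulate-zero-or _ λ i → edge-displaced zero zero 1 i _ refl 2 1 0 1 ≤2 ≤1 ℕ.z≤n ≤1
        (λ p → solve 2 (λ p k → p :+ con 1 :+ (con 1 :+ k) := p :+ (con 2 :+ k :* con 1)) refl p k)
        (λ p → solve 2 (λ p k → p :+ (con 1 :+ k) := p :+ con 1 :+ (con 0 :+ k :* con 1)) refl p k))
      (adjacency-++-zero-or spokes inner
        (adjacency-tabulate-zero-or _ λ i → edge-displaced zero (suc zero) 0 i i (shift-0 i) 1 1 1 1 ≤1 ≤1 ≤1 ≤1
          (λ p → solve 2 (λ p k → p :+ con 0 :+ (con 1 :+ k) := p :+ (con 1 :+ k :* con 1)) refl p k)
          (λ p → solve 2 (λ p k → p :+ (con 1 :+ k) := p :+ con 0 :+ (con 1 :+ k :* con 1)) refl p k))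
        (adjacency-tabulate-zero-or _ λ i → edge-displaced (suc zero) (suc zero) k i _ refl 1 2 1 0 ≤1 ≤2 ≤1 ℕ.z≤n
          (λ p → solve 2 (λ p k → p :+ k :+ (con 1 :+ k) := p :+ (con 1 :+ k :* con 2)) refl p k)
          (λ p → solve 2 (λ p k → p :+ (con 1 :+ k) := p :+ k :+ (con 1 :+ k :* con 0)) refl p k)))
      where
      open ℕ-Solver
      ≤1 : 1 ℕ.≤ 2
      ≤1 = ℕ.s≤s ℕ.z≤n
      ≤2 : 2 ℕ.≤ 2
      ≤2 = ℕ.≤-refl

    M : Matrix ℚ (2 ℕ.* n)
    M = shiftedAdjacency (petersen n k)

    M≥0 : ∀ v u → 0ℚ ≤ M v u
    M≥0 v u = 0≤+ (0≤ι (adjacency (petersen n k) v u)) (0≤* 0≤three (𝟙-nonneg v u))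

    M-sym : ∀ v u → M v u ≡ M u v
    M-sym v u = cong₂ _+_ (cong ι (adjacency-sym (petersen n k) v u)) (cong (three *_) (ℚM.𝟙-sym v u))

    M-regular : ∀ v → ∑ (M v) ≡ six
    M-regular v = trans (ℚM.∑-+ (λ u → ι (adjacency (petersen n k) v u)) (λ u → three * 𝟙 v u))
      (cong₂ _+_ (regular v) (trans (sym (ℚM.∑-*ˡ three (𝟙 v))) (trans (cong (three *_) (ℚM.∑-𝟙 v)) (ℚ.*-identityʳ three))))

    three≤M : ∀ v → three ≤ M v v
    three≤M v = subst₂ _≤_ (ℚ.+-identityˡ three)
      (cong (ι (adjacency (petersen n k) v v) +_) (trans (sym (ℚ.*-identityʳ three)) (cong (three *_) (sym (ℚM.𝟙-diagonal v)))))
      (ℚ.+-monoˡ-≤ three (0≤ι (adjacency (petersen n k) v v)))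

    M-displaced : ∀ v u → M v u ≡ 0ℚ ⊎ Displaced 1 v u
    M-displaced v u = by-cases (v Fin.≟ u) (adjacency-displaced v u)
      where
      open ℕ-Solver
      by-cases : Dec (v ≡ u) → adjacency (petersen n k) v u ≡ 0 ⊎ Displaced 1 v u → M v u ≡ 0ℚ ⊎ Displaced 1 v u
      by-cases _          (inj₂ d) = inj₂ d
      -- The shift by 3 adds a step that stays in place, whose displacement 0 is encoded like that
      -- of a spoke.
      by-cases (yes refl) (inj₁ _) = inj₂ (displaced-step {v} {v} 1 1 (ℕ.s≤s ℕ.z≤n) (ℕ.s≤s ℕ.z≤n)
        (cong (_% n) (solve 2 (λ p k → p :+ (con 1 :+ k) := p :+ (con 1 :+ k :* con 1)) refl (pos v) k)))
      by-cases (no v≢u)   (inj₁ e) = inj₁ (trans (cong₂ _+_ (trans (cong ι e) ι-0)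
        (trans (cong (three *_) (ℚM.𝟙-≢ v≢u)) (ℚ.*-zeroʳ three))) (ℚ.+-identityʳ 0ℚ))

    pow-displaced : ∀ j v u → pow M j v u ≡ 0ℚ ⊎ Displaced j v u
    pow-displaced zero v u = by-cases (v Fin.≟ u)
      where
      open ℕ-Solver
      by-cases : Dec (v ≡ u) → 𝟙 v u ≡ 0ℚ ⊎ Displaced 0 v u
      by-cases (yes refl) = inj₂ (0 , 0 , ℕ.z≤n , ℕ.z≤n ,
        cong (_% n) (solve 2 (λ p k → p :+ con 0 := p :+ (con 0 :+ k :* con 0)) refl (pos v) k))
      by-cases (no v≢u)   = inj₁ (ℚM.𝟙-≢ v≢u)
    pow-displaced (suc j) v u = ∑-zero-or λ l → by-cases l (M-displaced v l) (pow-displaced j l u)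
      where
      by-cases : ∀ l → M v l ≡ 0ℚ ⊎ Displaced 1 v l → pow M j l u ≡ 0ℚ ⊎ Displaced j l u →
                 M v l * pow M j l u ≡ 0ℚ ⊎ Displaced (suc j) v u
      by-cases l (inj₁ e) _        = inj₁ (trans (cong (_* pow M j l u) e) (ℚ.*-zeroˡ (pow M j l u)))
      by-cases l (inj₂ _) (inj₁ e) = inj₁ (trans (cong (M v l *_) e) (ℚ.*-zeroʳ (M v l)))
      by-cases l (inj₂ d) (inj₂ e) = inj₂ (displaced-compose {j} {v} {l} {u} d e)

    -- The component `s` is the ring of the end vertex, which the displacements leave open. The last
    -- summand removes the accumulated offset m (1 + k) modulo `n`.
    box : ∀ m → V → Fin 2 × Fin (suc (m ℕ.+ m)) × Fin (suc (m ℕ.+ m)) → V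
    box m v (s , x , y) = combine s ((pos v ℕ.+ (toℕ x ℕ.+ k ℕ.* toℕ y) ℕ.+ (m ℕ.* suc k) ℕ.* ℕ.pred n) mod n)

    cell : ∀ m → V → Fin (boxSize m) → V
    cell m v p = box m v (Product.map₂ (remQuot (suc (m ℕ.+ m))) (remQuot {2} (suc (m ℕ.+ m) ℕ.* suc (m ℕ.+ m)) p))

    cell-combine : ∀ m v s x y → cell m v (combine s (combine x y)) ≡ box m v (s , x , y)
    cell-combine m v s x y = trans
      (cong (λ r → box m v (Product.map₂ (remQuot (suc (m ℕ.+ m))) r)) (Fin.remQuot-combine {2} s (combine x y)))
      (cong (λ r → box m v (s , r)) (Fin.remQuot-combine x y))

    displaced⇒cell : ∀ m v u → Displaced m v u → ∃[ p ] cell m v p ≡ u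
    displaced⇒cell m v u (x , y , x≤ , y≤ , e) =
      combine s (combine x′ y′) , trans (cell-combine m v s x′ y′)
        (trans (cong (combine s) (toℕ-injectiveₙ index)) (Fin.combine-remQuot {2} n u))
      where
      s = proj₁ (remQuot {2} n u)
      i = proj₂ (remQuot {2} n u)
      x′ y′ : Fin (suc (m ℕ.+ m))
      x′ = fromℕ< (ℕ.s≤s x≤)
      y′ = fromℕ< (ℕ.s≤s y≤)
      c = m ℕ.* suc k
      target = pos v ℕ.+ (toℕ x′ ℕ.+ k ℕ.* toℕ y′) ℕ.+ c ℕ.* ℕ.pred n
      index : toℕ (target mod n) ≋ₙ toℕ i
      index = trans (cong (_% n) (toℕ-mod target)) (trans (m%n%n≡m%n target n)
        (trans (+-congₙ {y = c ℕ.* ℕ.pred n}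
                 (trans (cong (_% n) (cong (pos v ℕ.+_) (cong₂ (λ x y → x ℕ.+ k ℕ.* y) (Fin.toℕ-fromℕ< (ℕ.s≤s x≤)) (Fin.toℕ-fromℕ< (ℕ.s≤s y≤))))) (sym e)) refl)
          (trans (cong (_% n) (ℕ.+-assoc (toℕ i) c _)) (k+k[n-1] (toℕ i) c))))

    module W = WalkCounts M M≥0 M-sym six M-regular

    cover : ∀ m v u → pow M m v u ≡ 0ℚ ⊎ ∃[ p ] cell m v p ≡ u
    cover m v u = Sum.map₂ (displaced⇒cell m v u) (pow-displaced m v u)

  -- From the graph spectrum to rational power sums.

  fromℚ-hom : IsRingHomomorphism (CommutativeRing.rawRing ℚ.+-*-commutativeRing) ℝR.rawRing fromℚ
  fromℚ-hom = record
    { isSemiringHomomorphism = record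
      { isNearSemiringHomomorphism = record
        { +-isMonoidHomomorphism = record
          { isMagmaHomomorphism = record
            { isRelHomomorphism = record { cong = λ {p} {q} p≡q → ≃-pointwise {fromℚ p} {fromℚ q} λ _ → p≡q }
            ; homo = λ p q → ≃-pointwise {fromℚ (p + q)} {fromℚ p +ᴿ fromℚ q} λ _ → refl
            }
          ; ε-homo = ≃-pointwise {fromℚ 0ℚ} {0ᴿ} λ _ → refl
          }
        ; *-homo = λ p q → ≃-pointwise {fromℚ (p * q)} {fromℚ p *ᴿ fromℚ q} λ _ → refl
        }
      ; 1#-homo = ≃-pointwise {fromℚ 1ℚ} {1ᴿ} λ _ → refl
      }
    ; -‿homo = λ p → ≃-pointwise {fromℚ (- p)} { -ᴿ fromℚ p} λ _ → refl
    }

  module ℚ→ℝ = Homomorphisms ℚ.+-*-commutativeRing ℝ-commutativeRing fromℚ-hom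

  product-cong : ∀ {N} (f g : Fin N → ℝ) → (∀ i → f i ≃ g i) → product f ≃ product g
  product-cong {zero}  f g f≃g = ≃-refl {1ᴿ}
  product-cong {suc N} f g f≃g = *ᴿ-cong {f zero} {g zero} {product (f ∘ suc)} {product (g ∘ suc)}
    (f≃g zero) (product-cong (f ∘ suc) (g ∘ suc) (f≃g ∘ suc))

  seq-sum : ∀ {N} (f : Fin N → ℝ) n → seq (sum f) n ≡ ∑ (λ i → seq (f i) n)
  seq-sum {zero}  f n = sym (ℚM.∑-empty (λ i → seq (f i) n))
  seq-sum {suc N} f n = trans (cong (seq (f zero) n +_) (seq-sum (f ∘ suc) n)) (sym (ℚM.∑-suc (λ i → seq (f i) n)))

  seq-∑ : ∀ {N} (f : Fin N → ℝ) (g : ℕ → ℚ) → (∀ n → ∑ (λ i → seq (f i) n) ≡ g n) → ∀ q → fromℚ q ≃ Dᴿ.∑ f →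
          ∀ δ → 0ℚ < δ → Eventually λ n → ∣ q - g n ∣ ≤ δ
  seq-∑ f g f≡g q q≃∑f δ 0<δ =
    mapᵉ (λ n → subst (λ z → ∣ q - z ∣ ≤ δ) (trans (seq-sum f n) (f≡g n)))
      (ℝR.trans {fromℚ q} {Dᴿ.∑ f} {sum f} q≃∑f (Dᴿ.∑≈sum f) δ 0<δ)

  module _ {N} (G : Multigraph N) (λs : Fin N → ℝ) (spectrum : IsGraphSpectrum G λs) where

    private
      M : Matrix ℚ N
      M = shiftedAdjacency G

      μ : Fin N → ℝ
      μ i = λs i +ᴿ fromℚ three

      entry : ∀ y i j → y *ᴿ Dᴿ.𝟙 i j +ᴿ (-ᴿ fromℚ (M i j)) ≃
              (if ⌊ i Fin.≟ j ⌋ then y -ᴿ fromℚ three else 0ᴿ) -ᴿ fromℕ (adjacency G i j)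
      entry y i j = ℝR.trans {y *ᴿ Dᴿ.𝟙 i j +ᴿ m} {y *ᴿ fromℚ (𝟙 i j) +ᴿ m} {d (i Fin.≟ j)}
        (+ᴿ-cong {y *ᴿ Dᴿ.𝟙 i j} {y *ᴿ fromℚ (𝟙 i j)} {m} {m}
          (*ᴿ-cong {y} {y} {Dᴿ.𝟙 i j} {fromℚ (𝟙 i j)} (≃-refl {y}) (ℝR.sym {fromℚ (𝟙 i j)} {Dᴿ.𝟙 i j} (ℚ→ℝ.𝟙-homo i j)))
          (≃-refl {m}))
        (≃-pointwise {y *ᴿ fromℚ (𝟙 i j) +ᴿ m} {d (i Fin.≟ j)} (by-dec (i Fin.≟ j)))
        where
        m : ℝ
        m = -ᴿ fromℚ (M i j)
        d : Dec (i ≡ j) → ℝ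
        d i≟j = (if ⌊ i≟j ⌋ then y -ᴿ fromℚ three else 0ᴿ) -ᴿ fromℕ (adjacency G i j)
        on-diagonal : ∀ y α t → y * 1ℚ + - (α + t * 1ℚ) ≡ y + - t + - α
        on-diagonal = solve 3 (λ y α t → y :* con 1ℚ :+ (:- (α :+ t :* con 1ℚ)) := y :+ (:- t) :+ (:- α)) refl
          where open +-*-Solver
        off-diagonal : ∀ y α t → y * 0ℚ + - (α + t * 0ℚ) ≡ 0ℚ + - α
        off-diagonal = solve 3 (λ y α t → y :* con 0ℚ :+ (:- (α :+ t :* con 0ℚ)) := con 0ℚ :+ (:- α)) refl
          where open +-*-Solver
        by-dec : (i≟j : Dec (i ≡ j)) → ∀ n → seq (y *ᴿ fromℚ (𝟙 i j) +ᴿ m) n ≡ seq (d i≟j) n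
        by-dec (yes i≡j) n = trans (cong (λ δ → seq y n * δ + - (ι (adjacency G i j) + three * δ)) (ℚM.𝟙-≡ i≡j))
          (trans (on-diagonal (seq y n) (ι (adjacency G i j)) three)
            (cong (λ α → seq y n + - three + - α) (sym (fromℕ≡ι (adjacency G i j)))))
        by-dec (no i≢j) n = trans (cong (λ δ → seq y n * δ + - (ι (adjacency G i j) + three * δ)) (ℚM.𝟙-≢ i≢j))
          (trans (off-diagonal (seq y n) (ι (adjacency G i j)) three)
            (cong (λ α → 0ℚ + - α) (sym (fromℕ≡ι (adjacency G i j)))))

      -- The spectrum hypothesis is taken at x = y - 3, since y - (A + 3) = (y - 3) - A.
      shifted-spectrum : ∀ y → Dᴿ.det (λ i j → y *ᴿ Dᴿ.𝟙 i j +ᴿ (-ᴿ fromℚ (M i j))) ≃ product (λ i → y +ᴿ (-ᴿ μ i))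
      shifted-spectrum y = ℝR.trans {Dᴿ.det A} {charPoly (λ u v → fromℕ (adjacency G u v)) x} {product (λ i → y +ᴿ (-ᴿ μ i))}
        (ℝR.trans {Dᴿ.det A} {Dᴿ.det B} {charPoly (λ u v → fromℕ (adjacency G u v)) x}
          (Dᴿ.det-cong {A = A} {B} (entry y)) (Dᴿ.det≈detᴰ B))
        (ℝR.trans {charPoly (λ u v → fromℕ (adjacency G u v)) x} {product (λ i → x -ᴿ λs i)} {product (λ i → y +ᴿ (-ᴿ μ i))}
          (spectrum x)
          (product-cong (λ i → x -ᴿ λs i) (λ i → y +ᴿ (-ᴿ μ i))
            (λ i → ≃-pointwise {x -ᴿ λs i} {y +ᴿ (-ᴿ μ i)} λ n → regroup (seq y n) three (seq (λs i) n))))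
        where
        x : ℝ
        x = y -ᴿ fromℚ three
        A B : Matrix ℝ N
        A i j = y *ᴿ Dᴿ.𝟙 i j +ᴿ (-ᴿ fromℚ (M i j))
        B i j = (if ⌊ i Fin.≟ j ⌋ then x else 0ᴿ) -ᴿ fromℕ (adjacency G i j)
        regroup : ∀ y t l → (y + - t) + - l ≡ y + - (l + t)
        regroup = solve 3 (λ y t l → (y :+ (:- t)) :+ (:- l) := y :+ (:- (l :+ t))) refl
          where open +-*-Solver

    -- The trace is an exact rational, so the equality of reals becomes an estimate between
    -- rationals at late indices; the counting argument works with these alone.
    power-sums-approximate : ∀ K δ → 0ℚ < δ →
      Eventually λ n → ∣ tr (pow M (suc K)) - ∑ (λ i → (seq (λs i) n + three) ^ℚ suc K) ∣ ≤ δ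
    power-sums-approximate K = seq-∑ (λ i → μ i ^ᴿ suc K) _
      (λ n → ℚM.∑-cong λ i → seq-^ (μ i) (suc K) n)
      (tr (pow M (suc K)))
      (ℝR.trans {fromℚ (tr (pow M (suc K)))} {Dᴿ.tr (Dᴿ.pow (λ i j → fromℚ (M i j)) (suc K))} {Dᴿ.∑ (λ i → μ i ^ᴿ suc K)}
        (ℚ→ℝ.tr-pow-homo M (suc K))
        (power-sums (λ i j → fromℚ (M i j)) μ shifted-spectrum K))

  -- Large eigenvalues

  ^-+ : ∀ p j k → p ^ℚ (j ℕ.+ k) ≡ p ^ℚ j * p ^ℚ k
  ^-+ p zero    k = sym (ℚ.*-identityˡ (p ^ℚ k))
  ^-+ p (suc j) k = trans (cong (p *_) (^-+ p j k)) (sym (ℚ.*-assoc p (p ^ℚ j) (p ^ℚ k)))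

  0≤^ : ∀ {p} k → 0ℚ ≤ p → 0ℚ ≤ p ^ℚ k
  0≤^ zero    0≤p = 0≤1
  0≤^ (suc k) 0≤p = 0≤* 0≤p (0≤^ k 0≤p)

  *-mono-≤-nonneg : ∀ {p q r s} → 0ℚ ≤ r → 0ℚ ≤ q → p ≤ q → r ≤ s → p * r ≤ q * s
  *-mono-≤-nonneg {p} {q} {r} {s} 0≤r 0≤q p≤q r≤s = ℚ.≤-trans (*-mono-≤ʳ r 0≤r p≤q) (*-mono-≤ˡ q 0≤q r≤s)

  ^-mono-≤ : ∀ {p q} k → 0ℚ ≤ p → p ≤ q → p ^ℚ k ≤ q ^ℚ k
  ^-mono-≤ zero    0≤p p≤q = ℚ.≤-refl
  ^-mono-≤ (suc k) 0≤p p≤q = *-mono-≤-nonneg (0≤^ k 0≤p) (ℚ.≤-trans 0≤p p≤q) p≤q (^-mono-≤ k 0≤p p≤q)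

  -- For negative `p` the odd power is `p` times a square, hence at most 0.
  odd-^-mono-≤ : ∀ {p q} m → 0ℚ ≤ q → p ≤ q → p ^ℚ suc (m ℕ.+ m) ≤ q ^ℚ suc (m ℕ.+ m)
  odd-^-mono-≤ {p} {q} m 0≤q p≤q = by-sign (ℚ.≤-total 0ℚ p)
    where
    by-sign : 0ℚ ≤ p ⊎ p ≤ 0ℚ → p ^ℚ suc (m ℕ.+ m) ≤ q ^ℚ suc (m ℕ.+ m)
    by-sign (inj₁ 0≤p) = ^-mono-≤ (suc (m ℕ.+ m)) 0≤p p≤q
    by-sign (inj₂ p≤0) = ℚ.≤-trans
      (subst (p ^ℚ suc (m ℕ.+ m) ≤_) (ℚ.*-zeroˡ (p ^ℚ (m ℕ.+ m)))
        (*-mono-≤ʳ (p ^ℚ (m ℕ.+ m)) (subst (0ℚ ≤_) (sym (^-+ p m m)) (0≤p*p (p ^ℚ m))) p≤0))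
      (0≤^ (suc (m ℕ.+ m)) 0≤q)

  bernoulli : ∀ x → 0ℚ ≤ x → ∀ k → 1ℚ + ι k * x ≤ (1ℚ + x) ^ℚ k
  bernoulli x 0≤x zero    = ℚ.≤-reflexive (trans (cong (λ z → 1ℚ + z * x) ι-0) (trans (cong (1ℚ +_) (ℚ.*-zeroˡ x)) (ℚ.+-identityʳ 1ℚ)))
  bernoulli x 0≤x (suc k) = begin
    1ℚ + ι (suc k) * x                      ≡⟨ cong (λ z → 1ℚ + z * x) (trans (ι-+ 1 k) (cong (_+ ι k) ι-1)) ⟩
    1ℚ + (1ℚ + ι k) * x                     ≡⟨ ℚ.+-identityʳ (1ℚ + (1ℚ + ι k) * x) ⟨
    1ℚ + (1ℚ + ι k) * x + 0ℚ                ≤⟨ ℚ.+-monoʳ-≤ (1ℚ + (1ℚ + ι k) * x) (0≤* (0≤ι k) (0≤p*p x)) ⟩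
    1ℚ + (1ℚ + ι k) * x + ι k * (x * x)     ≡⟨ solve 2 (λ x k → con 1ℚ :+ (con 1ℚ :+ k) :* x :+ k :* (x :* x) := (con 1ℚ :+ x) :* (con 1ℚ :+ k :* x)) refl x (ι k) ⟩
    (1ℚ + x) * (1ℚ + ι k * x)               ≤⟨ *-mono-≤ˡ (1ℚ + x) (0≤+ 0≤1 0≤x) (bernoulli x 0≤x k) ⟩
    (1ℚ + x) * (1ℚ + x) ^ℚ k                ∎
    where
    open ℚ.≤-Reasoning
    open +-*-Solver

  ^-distrib-* : ∀ p q k → (p * q) ^ℚ k ≡ p ^ℚ k * q ^ℚ k
  ^-distrib-* p q zero   = sym (ℚ.*-identityˡ 1ℚ)
  ^-distrib-* p q (suc k) = trans (cong (p * q *_) (^-distrib-* p q k))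
    (solve 4 (λ p q x y → p :* q :* (x :* y) := (p :* x) :* (q :* y)) refl p q (p ^ℚ k) (q ^ℚ k))
    where open +-*-Solver

  1≤^ : ∀ {p} k → 1ℚ ≤ p → 1ℚ ≤ p ^ℚ k
  1≤^ zero    1≤p = ℚ.≤-refl
  1≤^ {p} (suc k) 1≤p = subst (_≤ p * p ^ℚ k) (ℚ.*-identityˡ 1ℚ)
    (*-mono-≤-nonneg 0≤1 (ℚ.≤-trans 0≤1 1≤p) 1≤p (1≤^ k 1≤p))

  ι-suc : ∀ n → ι (suc n) ≡ 1ℚ + ι n
  ι-suc n = trans (ι-+ 1 n) (cong (_+ ι n) ι-1)

  -- The growth (1 + x)^(4q+1) ≥ (q x)^4 outweighs the 8 (4q+1)^2 ≤ 200 q^2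
  -- coming from the size of the box as soon as q x^2 ≥ 15.
  power-beats-box : ∀ x → 0ℚ < x → ∃[ m ] ι (4 ℕ.* boxSize m) < (1ℚ + x) ^ℚ suc (m ℕ.+ m)
  power-beats-box x 0<x =
    let y , 0<y , xxy≡1 = fraction (x * x) 1ℚ 0<xx (ℚ.positive⁻¹ 1ℚ)
        q′ , 15y≤q′ = archimedean (ι 15 * y)
        q = suc q′
    in q ℕ.+ q , large q′ (15≤qxx y xxy≡1 q′ 15y≤q′)
    where
    open +-*-Solver
    0≤x = ℚ.<⇒≤ 0<x
    0<xx : 0ℚ < x * x
    0<xx = ℚ.positive⁻¹ (x * x) {{ℚ.pos*pos⇒pos x {{ℚ.positive 0<x}} x {{ℚ.positive 0<x}}}}

    15≤qxx : ∀ y → x * x * y ≡ 1ℚ → ∀ q′ → ι 15 * y ≤ ι q′ → ι 15 ≤ ι (suc q′) * (x * x)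
    15≤qxx y xxy≡1 q′ 15y≤q′ = begin
      ι 15                  ≡⟨ trans (cong (ι 15 *_) xxy≡1) (ℚ.*-identityʳ (ι 15)) ⟨
      ι 15 * (x * x * y)    ≡⟨ solve 3 (λ c x y → c :* (x :* x :* y) := (c :* y) :* (x :* x)) refl (ι 15) x y ⟩
      (ι 15 * y) * (x * x)  ≤⟨ *-mono-≤ʳ (x * x) (ℚ.<⇒≤ 0<xx) (ℚ.≤-trans 15y≤q′ (ι-mono (ℕ.n≤1+n q′))) ⟩
      ι (suc q′) * (x * x)  ∎
      where open ℚ.≤-Reasoning

    box≤ : ∀ q′ → let q = suc q′ ; m = q ℕ.+ q in 4 ℕ.* boxSize m ℕ.≤ 200 ℕ.* (q ℕ.* q)
    box≤ q′ = begin
      4 ℕ.* (2 ℕ.* (J ℕ.* J))                        ≤⟨ ℕ.*-monoʳ-≤ 4 (ℕ.*-monoʳ-≤ 2 (ℕ.*-mono-≤ J≤5q J≤5q)) ⟩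
      4 ℕ.* (2 ℕ.* ((5 ℕ.* q) ℕ.* (5 ℕ.* q)))        ≡⟨ N.solve 1 (λ q → N.con 4 N.:* (N.con 2 N.:* ((N.con 5 N.:* q) N.:* (N.con 5 N.:* q))) N.:= N.con 200 N.:* (q N.:* q)) refl q ⟩
      200 ℕ.* (q ℕ.* q)                              ∎
      where
      module N = ℕ-Solver
      open ℕ.≤-Reasoning
      q = suc q′
      J = suc ((q ℕ.+ q) ℕ.+ (q ℕ.+ q))
      J≤5q : J ℕ.≤ 5 ℕ.* q
      J≤5q = ℕ.≤-trans (ℕ.+-monoˡ-≤ ((q ℕ.+ q) ℕ.+ (q ℕ.+ q)) (ℕ.s≤s (ℕ.z≤n {q′})))
        (ℕ.≤-reflexive (N.solve 1 (λ q → q N.:+ ((q N.:+ q) N.:+ (q N.:+ q)) N.:= N.con 5 N.:* q) refl q))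

    large : ∀ q′ → let q = suc q′ ; m = q ℕ.+ q in ι 15 ≤ ι q * (x * x) → ι (4 ℕ.* boxSize m) < (1ℚ + x) ^ℚ suc (m ℕ.+ m)
    large q′ 15≤s = begin-strict
      ι (4 ℕ.* boxSize (q ℕ.+ q))                  ≤⟨ ι-mono (box≤ q′) ⟩
      ι (200 ℕ.* (q ℕ.* q))                        ≡⟨ ι-* 200 (q ℕ.* q) ⟩
      -- The number 15 is the least natural number whose square exceeds 200.
      ι 200 * ι (q ℕ.* q)                          <⟨ ℚ.*-monoˡ-<-pos (ι (q ℕ.* q)) {{ℚ.positive (0<ι-suc _)}} 200<225 ⟩
      ι 225 * ι (q ℕ.* q)                          ≡⟨ cong₂ _*_ (ι-* 15 15) (ι-* q q) ⟩
      (ι 15 * ι 15) * (ι q * ι q)                  ≤⟨ *-mono-≤ʳ (ι q * ι q) (0≤p*p (ι q)) (*-mono-≤-nonneg (0≤ι 15) (ℚ.≤-trans (0≤ι 15) 15≤s) 15≤s 15≤s) ⟩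
      (s * s) * (ι q * ι q)                        ≡⟨ solve 2 (λ q x → (q :* (x :* x) :* (q :* (x :* x))) :* (q :* q) := ((q :* x) :* (q :* x)) :* ((q :* x) :* (q :* x))) refl (ι q) x ⟩
      (r * r) * (r * r)                            ≤⟨ *-mono-≤-nonneg (0≤p*p r) (0≤p*p w) rr≤ww rr≤ww ⟩
      (w * w) * (w * w)                            ≡⟨ trans (^-+ (1ℚ + x) (q ℕ.+ q) (q ℕ.+ q)) (cong₂ _*_ (^-+ (1ℚ + x) q q) (^-+ (1ℚ + x) q q)) ⟨
      (1ℚ + x) ^ℚ ((q ℕ.+ q) ℕ.+ (q ℕ.+ q))        ≡⟨ ℚ.*-identityˡ _ ⟨
      1ℚ * (1ℚ + x) ^ℚ ((q ℕ.+ q) ℕ.+ (q ℕ.+ q))   ≤⟨ *-mono-≤ʳ _ (0≤^ ((q ℕ.+ q) ℕ.+ (q ℕ.+ q)) (0≤+ 0≤1 0≤x)) 1≤1+x ⟩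
      (1ℚ + x) ^ℚ suc ((q ℕ.+ q) ℕ.+ (q ℕ.+ q))    ∎
      where
      open ℚ.≤-Reasoning
      q = suc q′
      s = ι q * (x * x)
      r = ι q * x
      w = (1ℚ + x) ^ℚ q
      1≤1+x : 1ℚ ≤ 1ℚ + x
      1≤1+x = subst (_≤ 1ℚ + x) (ℚ.+-identityʳ 1ℚ) (ℚ.+-monoʳ-≤ 1ℚ 0≤x)
      r≤w : r ≤ w
      r≤w = ℚ.≤-trans (subst (_≤ 1ℚ + r) (ℚ.+-identityˡ r) (ℚ.+-monoˡ-≤ r 0≤1)) (bernoulli x 0≤x q)
      0≤r : 0ℚ ≤ r
      0≤r = 0≤* (0≤ι q) 0≤x
      rr≤ww : r * r ≤ w * w
      rr≤ww = *-mono-≤-nonneg 0≤r (ℚ.≤-trans 0≤r r≤w) r≤w r≤w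
      200<225 : ι 200 < ι 225
      200<225 = subst₂ _<_ (ℚ.+-identityʳ (ι 200)) (sym (ι-+ 200 25)) (ℚ.+-monoʳ-< (ι 200) (0<ι-suc 24))

  p+p<q+q⇒p<q : ∀ {p q} → p + p < q + q → p < q
  p+p<q+q⇒p<q {p} {q} lt = ℚ.≰⇒> λ q≤p → ℚ.<-irrefl refl (ℚ.<-≤-trans lt (ℚ.+-mono-≤ q≤p q≤p))

  -- With x = e/6 one has (6 - e)(1 + x) = 6 - e²/6 ≤ 6, so 4P < (1 + x)^J gives 4P A < 6^J for A =
  -- (6 - e)^J. Of the factor 4, one 2 pays for 1 + A ≤ 2A, which uses e ≤ 1, and the other for 6^J
  -- being twice the right side. The 1 beside A is reserved for the error in the first power sum.
  box-dominated : ∀ e → 0ℚ < e → e ≤ 1ℚ →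
    ∃[ m ] ι (boxSize m) * (1ℚ + (six - e) ^ℚ suc (m ℕ.+ m)) < three * (six ^ℚ m * six ^ℚ m)
  box-dominated e 0<e e≤1 =
    let m , big = power-beats-box x 0<x in m , p+p<q+q⇒p<q (doubled m big)
    where
    open +-*-Solver
    sixth : ∃[ η ] (0ℚ < η × six * η ≡ e)
    sixth = fraction six e (ℚ.positive⁻¹ six) 0<e
    x = proj₁ sixth
    0<x = proj₁ (proj₂ sixth)
    6x≡e = proj₂ (proj₂ sixth)
    c = six - e
    1≤c : 1ℚ ≤ c
    1≤c = ℚ.+-monoʳ-≤ six (ℚ.neg-antimono-≤ (ℚ.≤-trans e≤1 1≤5))
      where
      1≤5 : 1ℚ ≤ six - 1ℚ
      1≤5 = subst (_≤ 1ℚ + (three + 1ℚ)) (ℚ.+-identityʳ 1ℚ) (ℚ.+-monoʳ-≤ 1ℚ (0≤+ 0≤three 0≤1))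
    0≤c = ℚ.≤-trans 0≤1 1≤c
    c[1+x]≤6 : c * (1ℚ + x) ≤ six
    c[1+x]≤6 = begin
      (six - e) * (1ℚ + x)                ≡⟨ ℚ.+-identityʳ _ ⟨
      (six - e) * (1ℚ + x) + 0ℚ           ≤⟨ ℚ.+-monoʳ-≤ ((six - e) * (1ℚ + x)) (0≤* (ℚ.<⇒≤ 0<e) (ℚ.<⇒≤ 0<x)) ⟩
      (six - e) * (1ℚ + x) + e * x        ≡⟨ solve 3 (λ s e x → (s :- e) :* (con 1ℚ :+ x) :+ e :* x := s :- e :+ s :* x) refl six e x ⟩
      six - e + six * x                   ≡⟨ cong (six - e +_) 6x≡e ⟩
      six - e + e                         ≡⟨ solve 2 (λ s e → s :- e :+ e := s) refl six e ⟩
      six                                 ∎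
      where open ℚ.≤-Reasoning
    doubled : ∀ m → ι (4 ℕ.* boxSize m) < (1ℚ + x) ^ℚ suc (m ℕ.+ m) → let A = c ^ℚ suc (m ℕ.+ m) ; h = three * (six ^ℚ m * six ^ℚ m) in
            ι (boxSize m) * (1ℚ + A) + ι (boxSize m) * (1ℚ + A) < h + h
    doubled m big = begin-strict
      P * (1ℚ + A) + P * (1ℚ + A)              ≤⟨ ℚ.+-mono-≤ P[1+A]≤ P[1+A]≤ ⟩
      P * (A + A) + P * (A + A)                ≡⟨ solve 2 (λ P A → P :* (A :+ A) :+ P :* (A :+ A) := (con 1ℚ :+ con 1ℚ :+ con 1ℚ :+ con 1ℚ) :* P :* A) refl P A ⟩
      (1ℚ + 1ℚ + 1ℚ + 1ℚ) * P * A              ≡⟨ cong (λ z → z * P * A) four ⟨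
      ι 4 * P * A                              ≡⟨ cong (_* A) (ι-* 4 (boxSize m)) ⟨
      ι (4 ℕ.* boxSize m) * A                  <⟨ ℚ.*-monoˡ-<-pos A {{ℚ.positive (ℚ.<-≤-trans (ℚ.positive⁻¹ 1ℚ) (1≤^ (suc (m ℕ.+ m)) 1≤c))}} big ⟩
      (1ℚ + x) ^ℚ suc (m ℕ.+ m) * A            ≡⟨ trans (ℚ.*-comm _ A) (sym (^-distrib-* c (1ℚ + x) (suc (m ℕ.+ m)))) ⟩
      (c * (1ℚ + x)) ^ℚ suc (m ℕ.+ m)          ≤⟨ ^-mono-≤ (suc (m ℕ.+ m)) (0≤* 0≤c (0≤+ 0≤1 (ℚ.<⇒≤ 0<x))) c[1+x]≤6 ⟩
      six * six ^ℚ (m ℕ.+ m)                   ≡⟨ cong (six *_) (^-+ six m m) ⟩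
      six * (six ^ℚ m * six ^ℚ m)              ≡⟨ ℚ.*-distribʳ-+ (six ^ℚ m * six ^ℚ m) three three ⟩
      three * (six ^ℚ m * six ^ℚ m) + three * (six ^ℚ m * six ^ℚ m) ∎
      where
      open ℚ.≤-Reasoning
      P = ι (boxSize m)
      A = c ^ℚ suc (m ℕ.+ m)
      P[1+A]≤ : P * (1ℚ + A) ≤ P * (A + A)
      P[1+A]≤ = *-mono-≤ˡ P (0≤ι (boxSize m)) (ℚ.+-monoˡ-≤ A (1≤^ (suc (m ℕ.+ m)) 1≤c))
      four : ι 4 ≡ 1ℚ + 1ℚ + 1ℚ + 1ℚ
      four = trans (ι-+ 3 1) (cong₂ _+_ (trans (ι-+ 2 1) (cong₂ _+_ (trans (ι-+ 1 1) (cong₂ _+_ ι-1 ι-1)) ι-1)) ι-1)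

  eventually-all : ∀ {N} {P : Fin N → ℕ → Set} → (∀ i → Eventually (P i)) → Eventually (λ n → ∀ i → P i n)
  eventually-all {zero}  ev = 0 , λ _ _ ()
  eventually-all {suc N} ev = mapᵉ (λ { n (p , ps) zero → p ; n (p , ps) (suc i) → ps i }) (ev zero ∧ᵉ eventually-all (ev ∘ suc))

  choose : Bool → ℚ
  choose b = if b then 1ℚ else 0ℚ

  card-∷ : ∀ {N} b (S : Subset N) → ι (card (b Vec.∷ S)) ≡ choose b + ι (card S)
  card-∷ true  S = ι-suc (card S)
  card-∷ false S = sym (ℚ.+-identityˡ (ι (card S)))

  card-tabulate : ∀ {N} (f : Fin N → Bool) → ι (card (Vec.tabulate f)) ≡ ∑ (choose ∘ f)
  card-tabulate {zero}  f = trans ι-0 (sym (ℚM.∑-empty (choose ∘ f)))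
  card-tabulate {suc N} f = trans (card-∷ (f zero) (Vec.tabulate (f ∘ suc)))
    (trans (cong (choose (f zero) +_) (card-tabulate (f ∘ suc))) (sym (ℚM.∑-suc (choose ∘ f))))

  -- The entries compared are rational approximations, for which `<` is decidable.
  above : ∀ {N} → ℚ → (Fin N → ℚ) → Subset N
  above c ν = Vec.tabulate λ i → ⌊ c ℚ.<? ν i ⌋

  ∈-above : ∀ {N} c (ν : Fin N → ℚ) i → i ∈ above c ν → c < ν i
  ∈-above c ν i i∈S = toWitness {a? = c ℚ.<? ν i}
    (Equivalence.from T-≡ (trans (sym (Vec.lookup∘tabulate (λ i → ⌊ c ℚ.<? ν i ⌋) i)) (Vec.[]=⇒lookup i∈S)))

  -- The weight z trades the two moments off: 2 z ν^J ≤ z^2 + ν^2J for ν > c,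
  -- while ν^J ≤ c^J for ν ≤ c because J is odd.
  moment-bound : ∀ {N} (ν : Fin N → ℚ) c m z → 0ℚ ≤ c → 0ℚ ≤ z → let J = suc (m ℕ.+ m) in
    (1ℚ + 1ℚ) * z * ∑ (λ i → ν i ^ℚ J) ≤
    ι (card (above c ν)) * (z * z) + ∑ (λ i → ν i ^ℚ (J ℕ.+ J)) + (1ℚ + 1ℚ) * z * (ι N * c ^ℚ J)
  moment-bound {N} ν c m z 0≤c 0≤z = begin
    2z * ∑ (λ i → ν i ^ℚ J)
      ≡⟨ ℚM.∑-*ˡ 2z (λ i → ν i ^ℚ J) ⟩
    ∑ (λ i → 2z * ν i ^ℚ J)
      ≤⟨ ∑-mono (λ i → termwise i (c ℚ.<? ν i)) ⟩
    ∑ (λ i → choose ⌊ c ℚ.<? ν i ⌋ * (z * z) + ν i ^ℚ (J ℕ.+ J) + 2z * c ^ℚ J)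
      ≡⟨ ℚM.∑-+ (λ i → choose ⌊ c ℚ.<? ν i ⌋ * (z * z) + ν i ^ℚ (J ℕ.+ J)) (λ _ → 2z * c ^ℚ J) ⟩
    ∑ (λ i → choose ⌊ c ℚ.<? ν i ⌋ * (z * z) + ν i ^ℚ (J ℕ.+ J)) + ∑ (λ (_ : Fin N) → 2z * c ^ℚ J)
      ≡⟨ cong₂ _+_
           (trans (ℚM.∑-+ (λ i → choose ⌊ c ℚ.<? ν i ⌋ * (z * z)) (λ i → ν i ^ℚ (J ℕ.+ J)))
             (cong (_+ ∑ (λ i → ν i ^ℚ (J ℕ.+ J)))
               (trans (sym (ℚM.∑-*ʳ (z * z) (λ i → choose ⌊ c ℚ.<? ν i ⌋)))
                 (cong (_* (z * z)) (sym (card-tabulate (λ i → ⌊ c ℚ.<? ν i ⌋)))))))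
           (trans (∑-const N (2z * c ^ℚ J)) (solve 3 (λ n w p → n :* (w :* p) := w :* (n :* p)) refl (ι N) 2z (c ^ℚ J))) ⟩
    ι (card (above c ν)) * (z * z) + ∑ (λ i → ν i ^ℚ (J ℕ.+ J)) + 2z * (ι N * c ^ℚ J) ∎
    where
    open ℚ.≤-Reasoning
    open +-*-Solver
    J = suc (m ℕ.+ m)
    2z = (1ℚ + 1ℚ) * z
    0≤2z : 0ℚ ≤ 2z
    0≤2z = 0≤* (0≤+ 0≤1 0≤1) 0≤z
    square : ∀ i → ν i ^ℚ (J ℕ.+ J) ≡ ν i ^ℚ J * ν i ^ℚ J
    square i = ^-+ (ν i) J J
    termwise : ∀ i (d : Dec (c < ν i)) → 2z * ν i ^ℚ J ≤ choose ⌊ d ⌋ * (z * z) + ν i ^ℚ (J ℕ.+ J) + 2z * c ^ℚ J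
    termwise i (yes _) = begin
      (1ℚ + 1ℚ) * z * ν i ^ℚ J                      ≡⟨ ℚ.*-assoc (1ℚ + 1ℚ) z (ν i ^ℚ J) ⟩
      (1ℚ + 1ℚ) * (z * ν i ^ℚ J)                    ≤⟨ 2*p*q≤p²+q² z (ν i ^ℚ J) ⟩
      z * z + ν i ^ℚ J * ν i ^ℚ J                   ≡⟨ cong₂ _+_ (sym (ℚ.*-identityˡ (z * z))) (sym (square i)) ⟩
      1ℚ * (z * z) + ν i ^ℚ (J ℕ.+ J)               ≡⟨ ℚ.+-identityʳ (1ℚ * (z * z) + ν i ^ℚ (J ℕ.+ J)) ⟨
      1ℚ * (z * z) + ν i ^ℚ (J ℕ.+ J) + 0ℚ          ≤⟨ ℚ.+-monoʳ-≤ (1ℚ * (z * z) + ν i ^ℚ (J ℕ.+ J)) (0≤* 0≤2z (0≤^ J 0≤c)) ⟩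
      1ℚ * (z * z) + ν i ^ℚ (J ℕ.+ J) + 2z * c ^ℚ J ∎
    termwise i (no c≮ν) = begin
      2z * ν i ^ℚ J                                 ≤⟨ *-mono-≤ˡ 2z 0≤2z (odd-^-mono-≤ m 0≤c (ℚ.≮⇒≥ c≮ν)) ⟩
      2z * c ^ℚ J                                   ≡⟨ ℚ.+-identityˡ (2z * c ^ℚ J) ⟨
      0ℚ + 2z * c ^ℚ J                              ≤⟨ ℚ.+-monoˡ-≤ (2z * c ^ℚ J) (0≤+ (ℚ.≤-reflexive (sym (ℚ.*-zeroˡ (z * z)))) (subst (0ℚ ≤_) (sym (square i)) (0≤p*p (ν i ^ℚ J)))) ⟩
      0ℚ * (z * z) + ν i ^ℚ (J ℕ.+ J) + 2z * c ^ℚ J ∎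

  ∣-∣≤⇒≤ : ∀ p q r → ∣ p - q ∣ ≤ r → p ≤ q + r
  ∣-∣≤⇒≤ p q r d = begin
    p            ≡⟨ solve 2 (λ p q → p := q :+ (p :- q)) refl p q ⟩
    q + (p - q)  ≤⟨ ℚ.+-monoʳ-≤ q (ℚ.≤-trans (p≤∣p∣ (p - q)) d) ⟩
    q + r        ∎
    where
    open ℚ.≤-Reasoning
    open +-*-Solver
    p≤∣p∣ : ∀ p → p ≤ ∣ p ∣
    p≤∣p∣ p = by-sign (ℚ.≤-total 0ℚ p)
      where
      by-sign : 0ℚ ≤ p ⊎ p ≤ 0ℚ → p ≤ ∣ p ∣
      by-sign (inj₁ 0≤p) = ℚ.≤-reflexive (sym (ℚ.0≤p⇒∣p∣≡p 0≤p))
      by-sign (inj₂ p≤0) = ℚ.≤-trans p≤0 (ℚ.0≤∣p∣ p)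

  ≤-of-2* : ∀ p q → p + p ≤ q + p → p ≤ q
  ≤-of-2* p q le = subst₂ _≤_ (eq p p) (eq q p) (ℚ.+-monoˡ-≤ (- p) le)
    where
    open +-*-Solver
    eq : ∀ p q → p + q - q ≡ p
    eq = solve 2 (λ p q → p :+ q :- q := p) refl

  -- T₁, T₂ are the traces of order J and 2J, and s₁, s₂ the corresponding
  -- power sums, known up to an error of 1.
  proportion : ∀ {n′ P h A B U θ ρ z C s T₁ T₂ s₁ s₂} → 1ℚ ≤ n′ → 0ℚ < P → 0ℚ < z →
    P * ρ ≡ h → ρ ≡ θ + (1ℚ + A) → U ≡ B + 1ℚ → z * θ ≡ U → C * (z * z) ≡ U →
    n′ * h ≤ P * T₁ → T₂ ≤ n′ * B → T₁ ≤ s₁ + 1ℚ → s₂ ≤ T₂ + 1ℚ →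
    (1ℚ + 1ℚ) * z * s₁ ≤ s * (z * z) + s₂ + (1ℚ + 1ℚ) * z * (n′ * A) →
    C * n′ ≤ s
  proportion {n′} {P} {h} {A} {B} {U} {θ} {ρ} {z} {C} {s} {T₁} {T₂} {s₁} {s₂}
    1≤n 0<P 0<z Pρ≡h ρ≡ U≡ zθ≡U Czz≡U lower upper T₁≤ s₂≤ moments =
    ℚ.*-cancelʳ-≤-pos (z * z) {{ℚ.pos*pos⇒pos z {{ℚ.positive 0<z}} z {{ℚ.positive 0<z}}}} (begin
      C * n′ * (z * z)   ≡⟨ solve 3 (λ c n w → c :* n :* w := n :* (c :* w)) refl C n′ (z * z) ⟩
      n′ * (C * (z * z)) ≡⟨ cong (n′ *_) Czz≡U ⟩
      n′ * U             ≤⟨ ≤-of-2* (n′ * U) (s * (z * z)) doubled ⟩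
      s * (z * z)        ∎)
    where
    open ℚ.≤-Reasoning
    open +-*-Solver
    2z = (1ℚ + 1ℚ) * z
    0≤2z : 0ℚ ≤ 2z
    0≤2z = 0≤* (0≤+ 0≤1 0≤1) (ℚ.<⇒≤ 0<z)
    nρ≤T₁ : n′ * ρ ≤ T₁
    nρ≤T₁ = ℚ.*-cancelˡ-≤-pos P {{ℚ.positive 0<P}} (begin
      P * (n′ * ρ)   ≡⟨ solve 3 (λ p n r → p :* (n :* r) := n :* (p :* r)) refl P n′ ρ ⟩
      n′ * (P * ρ)   ≡⟨ cong (n′ *_) Pρ≡h ⟩
      n′ * h         ≤⟨ lower ⟩
      P * T₁         ∎)
    -- The 1 in ρ = θ + (1 + A) leaves a surplus `n′`, which absorbs the approximation error because
    -- 1 ≤ n′. The 1 in U = B + 1 does the same for `s₂`.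
    nθ≤ : n′ * θ + n′ * A ≤ s₁
    nθ≤ = ℚ.≤-trans (ℚ.≤-reflexive
      (trans (solve 3 (λ n θ A → n :* θ :+ n :* A := n :* (θ :+ (con 1ℚ :+ A)) :- n) refl n′ θ A) (cong (λ r → n′ * r - n′) (sym ρ≡))))
      (ℚ.≤-trans (ℚ.+-mono-≤ (ℚ.≤-trans nρ≤T₁ T₁≤) (ℚ.neg-antimono-≤ 1≤n))
        (ℚ.≤-reflexive (solve 1 (λ s → s :+ con 1ℚ :- con 1ℚ := s) refl s₁)))
    s₂≤nU : s₂ ≤ n′ * U
    s₂≤nU = begin
      s₂                  ≤⟨ s₂≤ ⟩
      T₂ + 1ℚ             ≤⟨ ℚ.+-mono-≤ upper 1≤n ⟩
      n′ * B + n′         ≡⟨ solve 2 (λ n b → n :* b :+ n := n :* (b :+ con 1ℚ)) refl n′ B ⟩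
      n′ * (B + 1ℚ)       ≡⟨ cong (n′ *_) U≡ ⟨
      n′ * U              ∎
    cancel : ∀ {p q r} → p + r ≤ q + r → p ≤ q
    cancel {p} {q} {r} le = subst₂ _≤_ (eq p r) (eq q r) (ℚ.+-monoˡ-≤ (- r) le)
      where
      eq : ∀ p r → p + r - r ≡ p
      eq = solve 2 (λ p r → p :+ r :- r := p) refl
    -- As z θ = U, the lower bound on 2z s₁ contains n′ U twice: one copy pays for `s₂`, and the
    -- other is left for the counted eigenvalues.
    doubled : n′ * U + n′ * U ≤ s * (z * z) + n′ * U
    doubled = cancel {r = 2z * (n′ * A)} (begin
      n′ * U + n′ * U + 2z * (n′ * A)              ≡⟨ cong (λ u → n′ * u + n′ * u + 2z * (n′ * A)) (sym zθ≡U) ⟩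
      n′ * (z * θ) + n′ * (z * θ) + 2z * (n′ * A)  ≡⟨ solve 4 (λ n z θ A → n :* (z :* θ) :+ n :* (z :* θ) :+ (con 1ℚ :+ con 1ℚ) :* z :* (n :* A)
                                                          := (con 1ℚ :+ con 1ℚ) :* z :* (n :* θ :+ n :* A)) refl n′ z θ A ⟩
      2z * (n′ * θ + n′ * A)                       ≤⟨ *-mono-≤ˡ 2z 0≤2z nθ≤ ⟩
      2z * s₁                                      ≤⟨ moments ⟩
      s * (z * z) + s₂ + 2z * (n′ * A)             ≤⟨ ℚ.+-monoˡ-≤ (2z * (n′ * A)) (ℚ.+-monoʳ-≤ (s * (z * z)) s₂≤nU) ⟩
      s * (z * z) + n′ * U + 2z * (n′ * A)         ∎)

  -- ρ is the guaranteed normalised trace of order J = 2m + 1; z = U / θ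
  -- optimises moment-bound and gives the proportion C = U / z^2.
  record Constants (e : ℚ) : Set where
    field
      m : ℕ
      ρ θ U z C : ℚ
      0<z  : 0ℚ < z
      0<C  : 0ℚ < C
      Pρ≡h : ι (boxSize m) * ρ ≡ three * (six ^ℚ m * six ^ℚ m)
      ρ≡   : ρ ≡ θ + (1ℚ + (six - e) ^ℚ suc (m ℕ.+ m))
      U≡   : U ≡ six ^ℚ (suc (m ℕ.+ m) ℕ.+ suc (m ℕ.+ m)) + 1ℚ
      zθ≡U : z * θ ≡ U
      Czz≡U : C * (z * z) ≡ U

  0<boxSize : ∀ m → 0ℚ < ι (boxSize m)
  0<boxSize m = 0<ι-suc _

  0<three : 0ℚ < three
  0<three = ℚ.positive⁻¹ three

  0<six : 0ℚ < six
  0<six = ℚ.positive⁻¹ six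

  constants : ∀ e → 0ℚ < e → e ≤ 1ℚ → Constants e
  constants e 0<e e≤1 = record
    { m = m ; ρ = ρ ; θ = θ ; U = U ; z = z ; C = C
    ; 0<z = 0<z ; 0<C = proj₁ (proj₂ C-spec)
    ; Pρ≡h = Pρ≡h
    ; ρ≡ = solve 2 (λ r a → r := (r :- a) :+ a) refl ρ (1ℚ + A)
    ; U≡ = refl
    ; zθ≡U = trans (ℚ.*-comm z θ) (proj₂ (proj₂ z-spec))
    ; Czz≡U = trans (ℚ.*-comm C (z * z)) (proj₂ (proj₂ C-spec))
    }
    where
    open +-*-Solver
    dominated = box-dominated e 0<e e≤1
    m = proj₁ dominated
    A = (six - e) ^ℚ suc (m ℕ.+ m)
    P = ι (boxSize m)
    h = three * (six ^ℚ m * six ^ℚ m)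
    0<* : ∀ {p q} → 0ℚ < p → 0ℚ < q → 0ℚ < p * q
    0<* {p} {q} 0<p 0<q = ℚ.positive⁻¹ (p * q) {{ℚ.pos*pos⇒pos p {{ℚ.positive 0<p}} q {{ℚ.positive 0<q}}}}
    ρ-spec : ∃[ ρ ] (0ℚ < ρ × P * ρ ≡ h)
    ρ-spec = fraction P h (0<boxSize m) (0<* 0<three (0<* (0<^ m 0<six) (0<^ m 0<six)))
    ρ = proj₁ ρ-spec
    Pρ≡h = proj₂ (proj₂ ρ-spec)
    1+A<ρ : 1ℚ + A < ρ
    1+A<ρ = ℚ.*-cancelˡ-<-nonNeg P {{ℚ.nonNegative (0≤ι (boxSize m))}} (subst (P * (1ℚ + A) <_) (sym Pρ≡h) (proj₂ dominated))
    θ = ρ - (1ℚ + A)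
    0<θ : 0ℚ < θ
    0<θ = subst (_< θ) (ℚ.+-inverseʳ (1ℚ + A)) (ℚ.+-monoˡ-< (- (1ℚ + A)) 1+A<ρ)
    U = six ^ℚ (suc (m ℕ.+ m) ℕ.+ suc (m ℕ.+ m)) + 1ℚ
    0<U : 0ℚ < U
    0<U = ℚ.+-mono-< (0<^ (suc (m ℕ.+ m) ℕ.+ suc (m ℕ.+ m)) 0<six) (ℚ.positive⁻¹ 1ℚ)
    z-spec : ∃[ z ] (0ℚ < z × θ * z ≡ U)
    z-spec = fraction θ U 0<θ 0<U
    z = proj₁ z-spec
    0<z = proj₁ (proj₂ z-spec)
    C-spec : ∃[ C ] (0ℚ < C × (z * z) * C ≡ U)
    C-spec = fraction (z * z) U (0<* 0<z 0<z) 0<U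
    C = proj₁ C-spec

  fromℚ-*-≤ : ∀ C n s → C * ι n ≤ ι s → fromℚ C *ᴿ fromℕ n ≤ᴿ fromℕ s
  fromℚ-*-≤ C n s le δ 0<δ = 0 , λ _ _ → ℚ.≤-trans
    (subst₂ _≤_ (cong (C *_) (sym (fromℕ≡ι n))) (sym (fromℕ≡ι s)) le)
    (subst (_≤ seq (fromℕ s) 0 + δ) (ℚ.+-identityʳ (seq (fromℕ s) 0)) (ℚ.+-monoʳ-≤ (seq (fromℕ s) 0) (ℚ.<⇒≤ 0<δ)))

  module _ (n k : ℕ) .{{_ : NonZero n}} (3≤n : 3 ℕ.≤ n) (1≤k : 1 ℕ.≤ k) (2k≤n : 2 ℕ.* k ℕ.≤ n)
    (λs : Fin (2 ℕ.* n) → ℝ) (spectrum : IsGraphSpectrum (petersen n k) λs) (e : ℚ) (e≤1 : e ≤ 1ℚ) (K : Constants e) where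

    private
      open Constants K
      module P = PetersenWalks n k 3≤n 1≤k 2k≤n
      J : ℕ
      J = suc (m ℕ.+ m)

      shifted : ℕ → Fin (2 ℕ.* n) → ℚ
      shifted l i = seq (λs i) l + three

      Stable : ℕ → Set
      Stable l = ∀ i l′ → l ℕ.≤ l′ → ∣ seq (λs i) l - seq (λs i) l′ ∣ ≤ e

      close : ∀ K → Eventually λ l → ∣ tr (pow P.M (suc K)) - ∑ (λ i → shifted l i ^ℚ suc K) ∣ ≤ 1ℚ
      close K = power-sums-approximate (petersen n k) λs spectrum K 1ℚ (ℚ.positive⁻¹ 1ℚ)

      0≤6-e : 0ℚ ≤ six - e
      0≤6-e = ℚ.≤-trans (0≤+ 0≤three (0≤+ 0≤1 0≤1)) (ℚ.+-monoʳ-≤ six (ℚ.neg-antimono-≤ e≤1))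

    stable : 0ℚ < e → Eventually Stable
    stable 0<e = eventually-all λ i →
      let N , close = cauchy (λs i) e 0<e in N , λ l N≤l l′ l≤l′ → close l l′ N≤l (ℕ.≤-trans N≤l l≤l′)

    many-large : ∀ l → ∣ tr (pow P.M J) - ∑ (λ i → shifted l i ^ℚ J) ∣ ≤ 1ℚ →
                 ∣ tr (pow P.M (J ℕ.+ J)) - ∑ (λ i → shifted l i ^ℚ (J ℕ.+ J)) ∣ ≤ 1ℚ →
                 C * ι (2 ℕ.* n) ≤ ι (card (above (six - e) (shifted l)))
    many-large l close₁ close₂ = proportion {n′ = ι (2 ℕ.* n)} {P = ι (boxSize m)} {h = three * (six ^ℚ m * six ^ℚ m)}
      {A = (six - e) ^ℚ J} {B = six ^ℚ (J ℕ.+ J)} {U} {θ} {ρ} {z} {C} {ι (card (above (six - e) (shifted l)))}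
      {tr (pow P.M J)} {tr (pow P.M (J ℕ.+ J))} {∑ (λ i → shifted l i ^ℚ J)} {∑ (λ i → shifted l i ^ℚ (J ℕ.+ J))}
      (subst (_≤ ι (2 ℕ.* n)) ι-1 (ι-mono (ℕ.≤-trans (ℕ.≤-trans (ℕ.s≤s ℕ.z≤n) 3≤n) (ℕ.m≤m+n n (n ℕ.+ 0)))))
      (0<boxSize m) 0<z Pρ≡h ρ≡ U≡ zθ≡U Czz≡U
      (P.W.tr-lower three 0≤three P.three≤M m (P.cell m) (0<boxSize m) (P.cover m))
      (P.W.tr-upper (J ℕ.+ J))
      (∣-∣≤⇒≤ _ _ 1ℚ close₁)
      (∣-∣≤⇒≤ _ _ 1ℚ (subst (_≤ 1ℚ) (∣-∣-sym (tr (pow P.M (J ℕ.+ J))) (∑ (λ i → shifted l i ^ℚ (J ℕ.+ J)))) close₂))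
      (moment-bound (shifted l) (six - e) m z 0≤6-e (ℚ.<⇒≤ 0<z))

    -- The cut gives λ > 3 - e at index `l`, stability loses another e at later indices, and 2e ≤ ε.
    large-eigenvalue : ∀ ε l → Stable l → Eventually (λ l → e + e ≤ seq ε l) → ∀ i → six - e < shifted l i → fromℕ 3 -ᴿ ε ≤ᴿ λs i
    large-eigenvalue ε l st (N , 2e≤ε) i large δ 0<δ = l ℕ.⊔ N , λ l′ le →
      estimate (seq (λs i) l) (seq (λs i) l′) (seq ε l′) large
        (st i l′ (ℕ.≤-trans (ℕ.m≤m⊔n l N) le)) (2e≤ε l′ (ℕ.≤-trans (ℕ.m≤n⊔m l N) le))
      where
      open ℚ.≤-Reasoning
      open +-*-Solver
      estimate : ∀ x y w → six - e < x + three → ∣ x - y ∣ ≤ e → e + e ≤ w → three + - w ≤ y + δ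
      estimate x y w large x≈y 2e≤w = begin
        three + - w                    ≤⟨ ℚ.+-monoʳ-≤ three (ℚ.neg-antimono-≤ 2e≤w) ⟩
        three + - (e + e)              ≡⟨ solve 2 (λ t e → t :+ (:- (e :+ e)) := ((t :+ t) :- e) :+ (:- (t :+ e))) refl three e ⟩
        (six - e) + - (three + e)      ≤⟨ ℚ.+-monoˡ-≤ (- (three + e)) (ℚ.<⇒≤ large) ⟩
        (x + three) + - (three + e)    ≤⟨ ℚ.+-monoˡ-≤ (- (three + e)) (ℚ.+-monoˡ-≤ three (∣-∣≤⇒≤ x y e x≈y)) ⟩
        ((y + e) + three) + - (three + e) ≡⟨ solve 3 (λ y e t → ((y :+ e) :+ t) :+ (:- (t :+ e)) := y :+ con 0ℚ) refl y e three ⟩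
        y + 0ℚ                         ≤⟨ ℚ.+-monoʳ-≤ y (ℚ.<⇒≤ 0<δ) ⟩
        y + δ                          ∎

    many-eigenvalues : 0ℚ < e → ∀ ε → Eventually (λ l → e + e ≤ seq ε l) →
      ∃ λ (S : Subset (2 ℕ.* n)) → ((∀ i → i ∈ S → fromℕ 3 -ᴿ ε ≤ᴿ λs i) × fromℚ C *ᴿ fromℕ (2 ℕ.* n) ≤ᴿ fromℕ (card S))
    many-eigenvalues 0<e ε 2e≤ε =
      -- A single index `l` must serve all eigenvalues and both power sums. The arguments of `close`
      -- are one below the orders J and 2J.
      let l , all = stable 0<e ∧ᵉ (close (m ℕ.+ m) ∧ᵉ close ((m ℕ.+ m) ℕ.+ J))
          st , (close₁ , close₂) = all l ℕ.≤-refl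
      in above (six - e) (shifted l)
       , (λ i i∈S → large-eigenvalue ε l st 2e≤ε i (∈-above (six - e) (shifted l) i i∈S))
       , fromℚ-*-≤ C (2 ℕ.* n) (card (above (six - e) (shifted l))) (many-large l close₁ close₂)

  0<fromℚ : ∀ {p} → 0ℚ < p → 0ᴿ <ᴿ fromℚ p
  0<fromℚ {p} 0<p = p , 0<p , 0 , λ _ _ → ℚ.≤-reflexive (ℚ.+-identityˡ p)

  positive-below : ∀ ε → 0ᴿ <ᴿ ε → ∃[ e ] (0ℚ < e × e ≤ 1ℚ × Eventually λ l → e + e ≤ seq ε l)
  positive-below ε (δ , 0<δ , δ≤ε) =
    -- The cap at 1 secures e ≤ 1 and so 1 ≤ 6 - e; halving leaves room for the two losses of e.
    let e , 0<e , e+e≡μ = halve (δ ℚ.⊓ 1ℚ) 0<δ⊓1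
    in e , 0<e , ℚ.≤-trans (e≤e+e 0<e) (ℚ.≤-trans (ℚ.≤-reflexive e+e≡μ) (ℚ.p⊓q≤q δ 1ℚ))
         , mapᵉ (λ l δ≤εₗ → ℚ.≤-trans (ℚ.≤-trans (ℚ.≤-reflexive e+e≡μ) (ℚ.p⊓q≤p δ 1ℚ))
                              (subst (_≤ seq ε l) (ℚ.+-identityˡ δ) δ≤εₗ)) δ≤ε
    where
    e≤e+e : ∀ {e} → 0ℚ < e → e ≤ e + e
    e≤e+e {e} 0<e = subst (_≤ e + e) (ℚ.+-identityʳ e) (ℚ.+-monoʳ-≤ e (ℚ.<⇒≤ 0<e))
    0<δ⊓1 : 0ℚ < δ ℚ.⊓ 1ℚ
    0<δ⊓1 = Sum.[ (λ e → subst (0ℚ <_) (sym e) 0<δ) , (λ e → subst (0ℚ <_) (sym e) (ℚ.positive⁻¹ 1ℚ)) ]′ (ℚ.⊓-sel δ 1ℚ)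

open import Data.Nat.Base using (_≤_; _*_)
open import Data.Fin.Subset using (∣_∣)
open PetersenSpectrum using (module Constants; constants; positive-below; 0<fromℚ; many-eigenvalues)

theorem1p4 : ∀ (ε : ℝ) → 0ᴿ <ᴿ ε →
    ∃[ C ] (0ᴿ <ᴿ C ×
    (∀ (n k : ℕ) .{{_ : NonZero n}} → 3 ≤ n → 1 ≤ k → 2 * k ≤ n →
    ∀ (λs : Fin (2 * n) → ℝ) → IsGraphSpectrum (petersen n k) λs →
    ∃ λ (S : Subset (2 * n)) → ((∀ i → i ∈ S → fromℕ 3 -ᴿ ε ≤ᴿ λs i) ×
    C *ᴿ fromℕ (2 * n) ≤ᴿ fromℕ ∣ S ∣)))
theorem1p4 ε 0<ε =
  let e , 0<e , e≤1 , 2e≤ε = positive-below ε 0<ε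
      K = constants e 0<e e≤1
  in fromℚ (Constants.C K) , 0<fromℚ (Constants.0<C K) ,
     λ n k 3≤n 1≤k 2k≤n λs spectrum → many-eigenvalues n k 3≤n 1≤k 2k≤n λs spectrum e e≤1 K 0<e ε 2e≤ε
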